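{- Let $X$ be an $n\times n$ generalized Jacobi–Trudi matrix and let $I,J,I',J'$ be $k$-element subsets of $[n]=\{1,\dots,n\}$. Then $$\Delta_{I\vee I',\,J\vee J'}(X)\cdot\Delta_{I\wedge I',\,J\wedge J'}(X) - \Delta_{I,J}(X)\cdot\Delta_{I',J'}(X)$$ is Schur nonnegative.
   Context: $h_k$ denotes the $k$-th complete homogeneous symmetric function, with $h_0=1$ and $h_k=0$ for $k<0$. A generalized Jacobi–Trudi matrix is an $n\times n$ matrix of the form $(h_{\mu_i-\nu_j})_{i,j=1}^n$ for partitions $\mu=(\mu_1\ge\cdots\ge\mu_n\ge0)$ and $\nu=(\nu_1\ge\cdots\ge\nu_n\ge 0)$. For subsets $I,J\subseteq[n]$ of equal size, $\Delta_{I,J}(X)$ is the minor of $X$ with row set $I$ and column set $J$. For $I=\{i_1<\cdots<i_k\}$ and $J=\{j_1<\cdots<j_k\}$, $I\vee J:=\{\max(i_1,j_1)<\cdots<\max(i_k,j_k)\}$ and $I\wedge J:=\{\min(i_1,j_1)<\cdots<\min(i_k,j_k)\}$. A symmetric function is Schur nonnegative if it is a nonnegative linear combination of Schur functions. -}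

module Defs where

open import Level using (0ℓ)
open import Algebra.Bundles using (CommutativeRing)
open import Data.Nat as ℕ using (ℕ; zero; suc)
open import Data.Integer as ℤ using (ℤ; +_; -[1+_])
open import Data.Fin using (Fin; zero; suc; toℕ; punchIn; _<_; _≤?_)
open import Relation.Nullary using (yes; no)
open import Data.Product using (Σ; _×_; _,_; ∃)
open import Data.List using (List; []; _∷_)

-- The ring of symmetric functions Λ is the free commutative ring
-- ℤ[h₁,h₂,…].  An element of Λ is represented by a "uniform polynomial
-- expression" in the h's: a value definable in every commutative ring R
-- from an assignment gen : ℕ → Carrier, where gen k plays the role of h_{k+1}.
Sym : Set₁
Sym = (R : CommutativeRing 0ℓ 0ℓ) → (ℕ → CommutativeRing.Carrier R) → CommutativeRing.Carrier R

module Ring (R : CommutativeRing 0ℓ 0ℓ) where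
  open CommutativeRing R using (Carrier; 0#; 1#; _+_; _*_; _-_)

  altSum : ∀ {m} → (Fin m → Carrier) → Carrier
  altSum {zero}  f = 0#
  altSum {suc m} f = f zero - altSum (λ j → f (suc j))

  det : ∀ {m} → (Fin m → Fin m → Carrier) → Carrier
  det {zero}  M = 1#
  det {suc m} M = altSum (λ j → M zero j * det (λ a b → M (suc a) (punchIn j b)))

  -- minor Δ_{I,J}(X) with rows I and columns J given as increasing maps
  minor : ∀ {n k} → (Fin n → Fin n → Carrier) → (Fin k → Fin n) → (Fin k → Fin n) → Carrier
  minor X I J = det (λ a b → X (I a) (J b))

  hZ : (ℕ → Carrier) → ℤ → Carrier
  hZ gen -[1+ _ ]    = 0#
  hZ gen (+ zero)    = 1#
  hZ gen (+ (suc k)) = gen k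

  JT : ∀ {n} → (ℕ → Carrier) → (Fin n → ℕ) → (Fin n → ℕ) → Fin n → Fin n → Carrier
  JT gen μ ν i j = hZ gen ((+ μ i) ℤ.- (+ ν j))

  _·_ : ℕ → Carrier → Carrier
  zero  · x = 0#
  suc c · x = x + c · x

Decreasing : ∀ {n} → (Fin n → ℕ) → Set
Decreasing {n} μ = ∀ (i j : Fin n) → i < j → μ j ℕ.≤ μ i

-- strictly increasing map Fin k → Fin n  (a k-element subset of [n], listed in order)
StrictInc : ∀ {k n} → (Fin k → Fin n) → Set
StrictInc {k} I = ∀ (a b : Fin k) → a < b → I a < I b

record Partition : Set where
  field
    len   : ℕ
    parts : Fin len → ℕ
    dec   : Decreasing parts

-- Schur function via the Jacobi–Trudi identity s_λ = det(h_{λ_i - i + j})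
schur : Partition → Sym
schur λp R gen = Ring.det R (λ a b → Ring.hZ R gen (((+ parts a) ℤ.- (+ toℕ a)) ℤ.+ (+ toℕ b)))
  where open Partition λp

linComb : List (Partition × ℕ) → Sym
linComb []             R gen = CommutativeRing.0# R
linComb ((λp , c) ∷ t) R gen = CommutativeRing._+_ R (Ring._·_ R c (schur λp R gen)) (linComb t R gen)

-- Schur nonnegative: a nonnegative integer combination of Schur functions
-- (equality in Λ = identity in every commutative ring under every assignment of the h's)
SchurNonneg : Sym → Set₁
SchurNonneg f = Σ (List (Partition × ℕ)) λ L →
  ∀ (R : CommutativeRing 0ℓ 0ℓ) (gen : ℕ → CommutativeRing.Carrier R) →
    CommutativeRing._≈_ R (f R gen) (linComb L R gen)

maxF : ∀ {n} → Fin n → Fin n → Fin n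
maxF i j with i ≤? j
... | yes _ = j
... | no  _ = i

minF : ∀ {n} → Fin n → Fin n → Fin n
minF i j with i ≤? j
... | yes _ = i
... | no  _ = j

_∨ₛ_ : ∀ {k n} → (Fin k → Fin n) → (Fin k → Fin n) → Fin k → Fin n
(I ∨ₛ J) a = maxF (I a) (J a)

_∧ₛ_ : ∀ {k n} → (Fin k → Fin n) → (Fin k → Fin n) → Fin k → Fin n
(I ∧ₛ J) a = minF (I a) (J a)

jtDiff : ∀ {n k} → (Fin n → ℕ) → (Fin n → ℕ) → (I J I' J' : Fin k → Fin n) → Sym
jtDiff μ ν I J I' J' R gen =
    (minor X (I ∨ₛ I') (J ∨ₛ J') * minor X (I ∧ₛ I') (J ∧ₛ J'))
  - (minor X I J * minor X I' J')
  where
    open CommutativeRing R using (_*_; _-_)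
    open Ring R using (minor; JT)
    X = JT gen μ ν

{-# OPTIONS --safe #-}
module Submission where

-- For an integer vector α put s_α = det(h_{α_a - a + b}); it is antisymmetric in the shifted entries α_a - a.
-- A product of two k × k minors is the sum of s_α over pairs (red, blue) of Gelfand–Tsetlin patterns with 2k
-- levels, α being the joint content.  Exchanging the colours on a set of nodes identifies the pairs belonging
-- to (I, J), (I', J') with those pairs belonging to (I ∧ I', J ∧ J'), (I ∨ I', J ∨ J') for which the boundary
-- nodes to be exchanged are not connected to the others through edges that forbid exchanging one end only.
-- The difference is therefore the sum of s_α over the remaining, connected pairs.  Read the columns of the two
-- tableaux from right to left, blue before red, and stop when the content read first fails to be a partition,
-- say in the letters i, i + 1.  Vary level i to the left of that column: connectivity depends only on certain
-- bits, each of which is constant on the box of possible values or cuts out a sub-box with the same centre, and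
-- s_α is antisymmetric about this centre, so these pairs cancel.  The surviving pairs have a partition as content.

open import Defs
open import Level using (0ℓ)
open import Algebra.Bundles using (CommutativeRing)
import Algebra.Properties.Ring
import Algebra.Solver.Ring.NaturalCoefficients.Default
open import Data.Bool as Bool using (Bool; true; false; _∧_; if_then_else_)
open import Data.Empty using (⊥; ⊥-elim)
open import Data.Fin as Fin using (Fin; zero; suc; toℕ; inject₁; fromℕ; punchIn)
import Data.Fin.Properties as Finₚ
import Data.Fin.Relation.Unary.Top as Top
open import Data.Integer as ℤ using (ℤ; +_; -[1+_])
import Data.Integer.Properties as ℤₚ
import Data.Integer.Solver
open import Data.List using (List; []; _∷_; _++_; map; concatMap)
open import Data.List.Membership.Propositional using (_∈_; lose; find)
import Data.List.Membership.Propositional.Properties as ∈ₚ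
open import Data.List.Relation.Unary.All as All using (All; []; _∷_; all?)
import Data.List.Relation.Unary.All.Properties as Allₚ
open import Data.List.Relation.Unary.Any as Any using (Any; here; there; any?)
open import Data.Nat as ℕ using (ℕ; zero; suc; _≤_; _<_; z≤n; s≤s; _∸_; _⊔_; _⊓_)
import Data.Nat.Properties as ℕₚ
open import Data.Nat.Solver using (module +-*-Solver)
open import Data.Product using (∃; _×_; _,_; proj₁; proj₂)
open import Data.Product.Properties using (≡-dec)
open import Data.Sum as Sum using (_⊎_; inj₁; inj₂)
open import Data.Unit using (⊤; tt)
open import Data.Vec as Vec using (Vec; []; _∷_; _∷ʳ_; lookup; tabulate; zip; zipWith; replicate)
import Data.Vec.Properties as Vecₚ
open import Function using (_∘_; id)
open import Relation.Binary using (DecidableEquality; tri<; tri≈; tri>)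
open import Relation.Binary.PropositionalEquality as ≡ using (_≡_)
import Relation.Binary.Reasoning.Setoid
open import Relation.Nullary using (¬_; Dec; yes; no)
open import Relation.Nullary.Decidable using (_×-dec_; _⊎-dec_; _→-dec_; ¬?; ⌊_⌋)

-- Finite sums

-- The sum over pairs of patterns comes from letting h_r(x₁,...,x_N) act on functions of N integers,
-- x_i raising the i-th argument by one. At an index ending in 0 this operator sends `s` to h_r
-- times `s` of the shortened index. One row is spent on each factor, so N operators applied to `s`
-- at 0 give a product of N functions h_r. Two k × k minors multiply to a combination of products of
-- 2k such functions; hence N = 2k, and the tableau expansion, an identity in N commuting variables,
-- becomes an expansion in s_α with α an arbitrary content. A pair may admit many exchanges and no
-- canonical one is chosen: an exchange preserves which other exchanges are admissible, so
-- inclusion-exclusion over all of them compares the two sums. Stopping at the first failure pins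
-- down the centre: the content of i + 1 then exceeds that of i by exactly one, and no row whose
-- lower bound lies in the unread columns has a value beyond them. This puts the centre of the box
-- at the fixed point of the antisymmetry of s_α.

vecs : {X : Set} → List X → (n : ℕ) → List (Vec X n)
vecs xs zero    = [] ∷ []
vecs xs (suc n) = concatMap (λ x → map (x ∷_) (vecs xs n)) xs

pairs : {X : Set} → List X → List (X × X)
pairs xs = concatMap (λ x → map (x ,_) xs) xs

range : ℕ → List ℕ
range zero    = []
range (suc n) = 0 ∷ map suc (range n)

between? : ∀ lo hi y → Dec (lo ≤ y × y ≤ hi)
between? lo hi y = (lo ℕ.≤? y) ×-dec (y ℕ.≤? hi)

module Sums (R : CommutativeRing 0ℓ 0ℓ) where
  open CommutativeRing R hiding (zero)
  open Algebra.Properties.Ring ring public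
    using (-‿+-comm; -‿distribˡ-*; -‿distribʳ-*; -0#≈0#)
  open Relation.Binary.Reasoning.Setoid setoid
  module Solver = Algebra.Solver.Ring.NaturalCoefficients.Default commutativeSemiring
  open Solver using (solve; _:=_; _:+_; _:*_)

  +-interchange : ∀ a b c d → (a + b) + (c + d) ≈ (a + c) + (b + d)
  +-interchange = solve 4 (λ a b c d → (a :+ b) :+ (c :+ d) := (a :+ c) :+ (b :+ d)) refl

  *-interchange : ∀ a b c d → (a * b) * (c * d) ≈ (a * c) * (b * d)
  *-interchange = solve 4 (λ a b c d → (a :* b) :* (c :* d) := (a :* c) :* (b :* d)) refl

  x∙yz≈y∙xz : ∀ a b c → a * (b * c) ≈ b * (a * c)
  x∙yz≈y∙xz = solve 3 (λ a b c → a :* (b :* c) := b :* (a :* c)) refl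

  neg-unique : ∀ {x y} → x + y ≈ 0# → x ≈ - y
  neg-unique {x} {y} e = begin
    x               ≈⟨ +-identityʳ x ⟨
    x + 0#          ≈⟨ +-congˡ (-‿inverseʳ y) ⟨
    x + (y + - y)   ≈⟨ +-assoc x y (- y) ⟨
    (x + y) + - y   ≈⟨ +-congʳ e ⟩
    0# + - y        ≈⟨ +-identityˡ (- y) ⟩
    - y             ∎

  ∑ : {X : Set} → List X → (X → Carrier) → Carrier
  ∑ []       f = 0#
  ∑ (x ∷ xs) f = f x + ∑ xs f

  module _ {X : Set} where
    ∑-cong : ∀ (xs : List X) {f g} → (∀ x → f x ≈ g x) → ∑ xs f ≈ ∑ xs g
    ∑-cong []       e = refl
    ∑-cong (x ∷ xs) e = +-cong (e x) (∑-cong xs e)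

    ∑-0 : ∀ (xs : List X) → ∑ xs (λ _ → 0#) ≈ 0#
    ∑-0 []       = refl
    ∑-0 (x ∷ xs) = trans (+-identityˡ _) (∑-0 xs)

    ∑-zero : ∀ (xs : List X) {f} → (∀ x → f x ≈ 0#) → ∑ xs f ≈ 0#
    ∑-zero xs e = trans (∑-cong xs e) (∑-0 xs)

    ∑-+ : ∀ (xs : List X) f g → ∑ xs (λ x → f x + g x) ≈ ∑ xs f + ∑ xs g
    ∑-+ []       f g = sym (+-identityˡ 0#)
    ∑-+ (x ∷ xs) f g = trans (+-congˡ (∑-+ xs f g)) (+-interchange _ _ _ _)

    ∑-neg : ∀ (xs : List X) f → ∑ xs (λ x → - f x) ≈ - ∑ xs f
    ∑-neg []       f = sym -0#≈0#
    ∑-neg (x ∷ xs) f = trans (+-congˡ (∑-neg xs f)) (-‿+-comm _ _)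

    ∑-*ˡ : ∀ (xs : List X) c f → c * ∑ xs f ≈ ∑ xs (λ x → c * f x)
    ∑-*ˡ []       c f = zeroʳ c
    ∑-*ˡ (x ∷ xs) c f = trans (distribˡ _ _ _) (+-congˡ (∑-*ˡ xs c f))

    ∑-*ʳ : ∀ (xs : List X) c f → ∑ xs f * c ≈ ∑ xs (λ x → f x * c)
    ∑-*ʳ []       c f = zeroˡ c
    ∑-*ʳ (x ∷ xs) c f = trans (distribʳ _ _ _) (+-congˡ (∑-*ʳ xs c f))

    ∑-++ : ∀ (xs ys : List X) f → ∑ (xs ++ ys) f ≈ ∑ xs f + ∑ ys f
    ∑-++ []       ys f = sym (+-identityˡ _)
    ∑-++ (x ∷ xs) ys f = trans (+-congˡ (∑-++ xs ys f)) (sym (+-assoc _ _ _))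

  ∑-swap : {X Y : Set} (xs : List X) (ys : List Y) (f : X → Y → Carrier) →
           ∑ xs (λ x → ∑ ys (f x)) ≈ ∑ ys (λ y → ∑ xs (λ x → f x y))
  ∑-swap []       ys f = sym (∑-0 ys)
  ∑-swap (x ∷ xs) ys f = trans (+-congˡ (∑-swap xs ys f)) (sym (∑-+ ys _ _))

  ∑-map : {X Y : Set} (h : X → Y) (xs : List X) (f : Y → Carrier) → ∑ (map h xs) f ≈ ∑ xs (f ∘ h)
  ∑-map h []       f = refl
  ∑-map h (x ∷ xs) f = +-congˡ (∑-map h xs f)

  ∑-concatMap : {X Y : Set} (h : X → List Y) (xs : List X) (f : Y → Carrier) →
              ∑ (concatMap h xs) f ≈ ∑ xs (λ x → ∑ (h x) f)
  ∑-concatMap h []       f = refl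
  ∑-concatMap h (x ∷ xs) f = trans (∑-++ (h x) _ f) (+-congˡ (∑-concatMap h xs f))

  ∑-vecs : {X : Set} (xs : List X) (n : ℕ) (f : Vec X (suc n) → Carrier) →
           ∑ (vecs xs (suc n)) f ≈ ∑ xs (λ x → ∑ (vecs xs n) (λ v → f (x ∷ v)))
  ∑-vecs xs n f = trans (∑-concatMap _ xs f) (∑-cong xs (λ x → ∑-map (x ∷_) (vecs xs n) f))

  ∑-pairs : {X : Set} (xs : List X) (f : X × X → Carrier) →
            ∑ (pairs xs) f ≈ ∑ xs (λ x → ∑ xs (λ y → f (x , y)))
  ∑-pairs xs f = trans (∑-concatMap _ xs f) (∑-cong xs (λ x → ∑-map (x ,_) xs f))

  -- Sums over subsets are written as sums over one fixed list with an indicator, so that comparing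
  -- two subsets becomes a comparison of conditions term by term.
  when : {P : Set} → Dec P → Carrier → Carrier
  when (yes _) x = x
  when (no _)  x = 0#

  when-cong : {P Q : Set} (p? : Dec P) (q? : Dec Q) → (P → Q) → (Q → P) →
              ∀ {x y} → (P → x ≈ y) → when p? x ≈ when q? y
  when-cong (yes p) (yes q) to from e = e p
  when-cong (yes p) (no ¬q) to from e = ⊥-elim (¬q (to p))
  when-cong (no ¬p) (yes q) to from e = ⊥-elim (¬p (from q))
  when-cong (no ¬p) (no ¬q) to from e = refl

  when-congʳ : {P : Set} (p? : Dec P) → ∀ {x y} → (P → x ≈ y) → when p? x ≈ when p? y
  when-congʳ p? = when-cong p? p? id id

  when-yes : {P : Set} (p? : Dec P) → P → ∀ {x} → when p? x ≈ x
  when-yes (yes _) p = refl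
  when-yes (no ¬p) p = ⊥-elim (¬p p)

  when-no : {P : Set} (p? : Dec P) → ¬ P → ∀ {x} → when p? x ≈ 0#
  when-no (yes p) ¬p = ⊥-elim (¬p p)
  when-no (no _)  ¬p = refl

  when-zero : {P : Set} (p? : Dec P) → ∀ {x} → (P → x ≈ 0#) → when p? x ≈ 0#
  when-zero (yes p) e = e p
  when-zero (no _)  e = refl

  when-× : {P Q : Set} (p? : Dec P) (q? : Dec Q) → ∀ {x} → when (p? ×-dec q?) x ≈ when p? (when q? x)
  when-× (yes p) (yes q) = refl
  when-× (yes p) (no ¬q) = refl
  when-× (no ¬p) q?      = refl

  when-comm : {P Q : Set} (p? : Dec P) (q? : Dec Q) → ∀ {x} → when p? (when q? x) ≈ when q? (when p? x)
  when-comm (yes p) q? = refl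
  when-comm (no ¬p) (yes _) = refl
  when-comm (no ¬p) (no _) = refl

  when-+ : {P : Set} (p? : Dec P) → ∀ x y → when p? (x + y) ≈ when p? x + when p? y
  when-+ (yes _) x y = refl
  when-+ (no _)  x y = sym (+-identityˡ 0#)

  when-*ˡ : {P : Set} (p? : Dec P) → ∀ c x → c * when p? x ≈ when p? (c * x)
  when-*ˡ (yes _) c x = refl
  when-*ˡ (no _)  c x = zeroʳ c

  when-∑ : {P X : Set} (p? : Dec P) (xs : List X) (f : X → Carrier) →
           when p? (∑ xs f) ≈ ∑ xs (λ x → when p? (f x))
  when-∑ (yes _) xs f = refl
  when-∑ (no _)  xs f = sym (∑-0 xs)

  when-split : {P Q : Set} (p? : Dec P) (q? : Dec Q) → ∀ x →
               when p? x ≈ when (p? ×-dec q?) x + when (p? ×-dec (¬? q?)) x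
  when-split (yes _) (yes _) x = sym (+-identityʳ x)
  when-split (yes _) (no _)  x = sym (+-identityˡ x)
  when-split (no _)  q?      x = sym (+-identityˡ 0#)

  when-⊎ : {P Q : Set} (p? : Dec P) (q? : Dec Q) → ∀ x →
           when (p? ⊎-dec q?) x ≈ (when p? x + when q? x) - when (p? ×-dec q?) x
  when-⊎ (yes _) (yes _) x = sym (trans (+-assoc x x (- x)) (trans (+-congˡ (-‿inverseʳ x)) (+-identityʳ x)))
  when-⊎ (yes _) (no _)  x = sym (trans (+-cong (+-identityʳ x) -0#≈0#) (+-identityʳ x))
  when-⊎ (no _)  (yes _) x = sym (trans (+-cong (+-identityˡ x) -0#≈0#) (+-identityʳ x))
  when-⊎ (no _)  (no _)  x = sym (trans (+-cong (+-identityˡ 0#) -0#≈0#) (+-identityˡ 0#))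

  ∑< : ℕ → (ℕ → Carrier) → Carrier
  ∑< zero    F = 0#
  ∑< (suc n) F = F 0 + ∑< n (F ∘ suc)

  ∑-range : ∀ n F → ∑ (range n) F ≈ ∑< n F
  ∑-range zero    F = refl
  ∑-range (suc n) F = +-congˡ (trans (∑-map suc (range n) F) (∑-range n (F ∘ suc)))

  ∑<-cong : ∀ n {F G} → (∀ d → d < n → F d ≈ G d) → ∑< n F ≈ ∑< n G
  ∑<-cong zero    e = refl
  ∑<-cong (suc n) e = +-cong (e 0 (s≤s z≤n)) (∑<-cong n (λ d d<n → e (suc d) (s≤s d<n)))

  ∑<-zero : ∀ n {F} → (∀ d → d < n → F d ≈ 0#) → ∑< n F ≈ 0#
  ∑<-zero zero    e = refl
  ∑<-zero (suc n) e = trans (+-cong (e 0 (s≤s z≤n)) (∑<-zero n (λ d d<n → e (suc d) (s≤s d<n)))) (+-identityˡ 0#)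

  ∑<-snoc : ∀ n F → ∑< (suc n) F ≈ ∑< n F + F n
  ∑<-snoc zero    F = +-comm _ _
  ∑<-snoc (suc n) F = trans (+-congˡ (∑<-snoc n (F ∘ suc))) (sym (+-assoc _ _ _))

  -- The two outermost terms cancel, and the rest is a sum of the same kind, shorter by two. A
  -- middle term has no partner, and 2x = 0 does not give x = 0 in a general ring; hence the second
  -- hypothesis.
  ∑<-alternating : ∀ n {F} → (∀ a b → suc (a ℕ.+ b) ≡ n → F a + F b ≈ 0#) →
                   (∀ a → suc (a ℕ.+ a) ≡ n → F a ≈ 0#) → ∑< n F ≈ 0#
  ∑<-alternating zero          e z = refl
  ∑<-alternating (suc zero)    e z = trans (+-identityʳ _) (z 0 ≡.refl)
  ∑<-alternating (suc (suc n)) {F} e z = begin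
    F 0 + ∑< (suc n) (F ∘ suc)         ≈⟨ +-congˡ (∑<-snoc n (F ∘ suc)) ⟩
    F 0 + (∑< n (F ∘ suc) + F (suc n)) ≈⟨ solve 3 (λ a b c → a :+ (b :+ c) := b :+ (a :+ c)) refl _ _ _ ⟩
    ∑< n (F ∘ suc) + (F 0 + F (suc n)) ≈⟨ +-cong inner (e 0 (suc n) ≡.refl) ⟩
    0# + 0#                            ≈⟨ +-identityˡ 0# ⟩
    0#                                 ∎
    where
    inner : ∑< n (F ∘ suc) ≈ 0#
    inner = ∑<-alternating n
      (λ a b p → e (suc a) (suc b) (≡.cong suc (≡.trans (≡.cong suc (ℕₚ.+-suc a b)) (≡.cong suc p))))
      (λ a p → z (suc a) (≡.cong suc (≡.trans (≡.cong suc (ℕₚ.+-suc a a)) (≡.cong suc p))))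

  ∑<-prefix : ∀ n m F → m ≤ n → (∀ y → m ≤ y → F y ≈ 0#) → ∑< n F ≈ ∑< m F
  ∑<-prefix n       zero    F z≤n     e = ∑<-zero n (λ d _ → e d z≤n)
  ∑<-prefix (suc n) (suc m) F (s≤s p) e = +-congˡ (∑<-prefix n m (F ∘ suc) p (λ y q → e (suc y) (s≤s q)))

  ∑-interval : ∀ M lo hi (F : ℕ → Carrier) → lo ≤ suc hi → hi ≤ M →
               ∑ (range (suc M)) (λ y → when (between? lo hi y) (F y)) ≈ ∑< (suc hi ∸ lo) (λ d → F (lo ℕ.+ d))
  ∑-interval M lo hi F p q = trans (∑-range (suc M) _) (go (suc M) lo (suc hi) F p (s≤s q) _ (λ y a b → when-yes (between? lo hi y) (a , ℕₚ.≤-pred b))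
      (λ y ¬b → when-no (between? lo hi y) (λ (a , b) → ¬b (a , s≤s b))))
    where
    go : ∀ M lo hi (F : ℕ → Carrier) → lo ≤ hi → hi ≤ M → (G : ℕ → Carrier) → (∀ y → lo ≤ y → y < hi → G y ≈ F y) →
         (∀ y → ¬ (lo ≤ y × y < hi) → G y ≈ 0#) → ∑< M G ≈ ∑< (hi ∸ lo) (λ d → F (lo ℕ.+ d))
    go M zero hi F p q G e z = trans (∑<-prefix M hi G q (λ y a → z y (λ (_ , b) → ℕₚ.<⇒≱ b a)))
                                     (∑<-cong hi (λ d b → e d z≤n b))
    go (suc M) (suc lo) (suc hi) F (s≤s p) (s≤s q) G e z = trans (+-congʳ (z 0 (λ { (() , _) })))
      (trans (+-identityˡ _) (go M lo hi (F ∘ suc) p q (G ∘ suc) (λ y a b → e (suc y) (s≤s a) (s≤s b))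
        (λ y c → z (suc y) (λ { (s≤s a , s≤s b) → c (a , b) }))))

  -- Antisymmetry about K/2. The centre has a clause of its own because 2 may be a zero divisor.
  record Alternating (K : ℕ) (F : ℕ → Carrier) : Set where
    constructor mkAlt
    field
      anti  : ∀ a b → a ℕ.+ b ≡ K → F a + F b ≈ 0#
      fixed : ∀ a → a ℕ.+ a ≡ K → F a ≈ 0#
  open Alternating public

  ∑-alternating : ∀ M lo hi {F} → hi ≤ M → Alternating (lo ℕ.+ hi) F →
                  ∑ (range (suc M)) (λ y → when (between? lo hi y) (F y)) ≈ 0#
  ∑-alternating M lo hi {F} hi≤M A with lo ℕ.≤? suc hi
  ... | no  lo≰ = ∑-zero (range (suc M)) (λ y → when-no (between? lo hi y) (λ (a , b) → lo≰ (ℕₚ.m≤n⇒m≤1+n (ℕₚ.≤-trans a b))))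
  ... | yes lo≤ = trans (∑-interval M lo hi F lo≤ hi≤M) (∑<-alternating (suc hi ∸ lo)
        (λ a b p → anti A (lo ℕ.+ a) (lo ℕ.+ b) (lem a b p)) (λ a p → fixed A (lo ℕ.+ a) (lem a a p)))
    where
    lem : ∀ a b → suc (a ℕ.+ b) ≡ suc hi ∸ lo → (lo ℕ.+ a) ℕ.+ (lo ℕ.+ b) ≡ lo ℕ.+ hi
    lem a b p = ≡.trans (eq lo a b) (≡.cong (lo ℕ.+_) (ℕₚ.suc-injective (≡.trans (≡.sym (ℕₚ.+-suc lo (a ℕ.+ b))) (≡.trans (≡.cong (lo ℕ.+_) p) (ℕₚ.m+[n∸m]≡n lo≤)))))
      where
      eq : ∀ l a b → (l ℕ.+ a) ℕ.+ (l ℕ.+ b) ≡ l ℕ.+ (l ℕ.+ (a ℕ.+ b))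
      eq = +-*-Solver.solve 3 (λ l a b → (l +-*-Solver.:+ a) +-*-Solver.:+ (l +-*-Solver.:+ b) +-*-Solver.:= l +-*-Solver.:+ (l +-*-Solver.:+ (a +-*-Solver.:+ b))) ≡.refl

-- Determinants

module Determinants (R : CommutativeRing 0ℓ 0ℓ) where
  open CommutativeRing R hiding (zero)
  open Defs.Ring R using (altSum; det)
  open Sums R
  open Relation.Binary.Reasoning.Setoid setoid

  Matrix : ℕ → Set
  Matrix n = Fin n → Fin n → Carrier

  infixr 5 _◂_
  _◂_ : ∀ {n} {X : Set} → X → (Fin n → X) → Fin (suc n) → X
  (r ◂ M) zero    = r
  (r ◂ M) (suc i) = M i

  -- Sealed so that conversion checking never unfolds a determinant. Later arguments use the
  -- recursive equations listed here, and `Det-def` leads back to `det`.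
  opaque
    altΣ : ∀ {m} → (Fin m → Carrier) → Carrier
    altΣ = altSum

    Det : ∀ {n} → Matrix n → Carrier
    Det = det

    altΣ-nil : (f : Fin 0 → Carrier) → altΣ f ≈ 0#
    altΣ-nil f = refl

    altΣ-suc : ∀ {m} (f : Fin (suc m) → Carrier) → altΣ f ≈ f zero - altΣ (λ i → f (suc i))
    altΣ-suc f = refl

    Det-nil : (M : Matrix 0) → Det M ≈ 1#
    Det-nil M = refl

    Det-suc : ∀ {n} (M : Matrix (suc n)) → Det M ≈ altΣ (λ j → M zero j * Det (λ a b → M (suc a) (punchIn j b)))
    Det-suc M = refl

    Det-def : ∀ {n} (M : Matrix n) → Det M ≈ det M
    Det-def M = refl

  altΣ-cong : ∀ {m} {f g : Fin m → Carrier} → (∀ i → f i ≈ g i) → altΣ f ≈ altΣ g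
  altΣ-cong {zero}  {f} {g} e = trans (altΣ-nil f) (sym (altΣ-nil g))
  altΣ-cong {suc m} {f} {g} e = begin
    altΣ f                          ≈⟨ altΣ-suc f ⟩
    f zero - altΣ (λ i → f (suc i)) ≈⟨ +-cong (e zero) (-‿cong (altΣ-cong (λ i → e (suc i)))) ⟩
    g zero - altΣ (λ i → g (suc i)) ≈⟨ altΣ-suc g ⟨
    altΣ g                          ∎

  altΣ-0 : ∀ m → altΣ {m} (λ _ → 0#) ≈ 0#
  altΣ-0 zero    = altΣ-nil _
  altΣ-0 (suc m) = trans (altΣ-suc _) (trans (+-congˡ (trans (-‿cong (altΣ-0 m)) -0#≈0#)) (+-identityˡ 0#))

  altΣ-zero : ∀ {m} {f : Fin m → Carrier} → (∀ i → f i ≈ 0#) → altΣ f ≈ 0#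
  altΣ-zero {m} e = trans (altΣ-cong e) (altΣ-0 m)

  altΣ-+ : ∀ {m} (f g : Fin m → Carrier) → altΣ (λ i → f i + g i) ≈ altΣ f + altΣ g
  altΣ-+ {zero}  f g = trans (altΣ-nil _) (sym (trans (+-cong (altΣ-nil f) (altΣ-nil g)) (+-identityˡ 0#)))
  altΣ-+ {suc m} f g = begin
    altΣ (λ i → f i + g i)                                                 ≈⟨ altΣ-suc _ ⟩
    (f zero + g zero) - altΣ (λ i → f (suc i) + g (suc i))                 ≈⟨ +-congˡ (trans (-‿cong (altΣ-+ _ _)) (sym (-‿+-comm _ _))) ⟩
    (f zero + g zero) + (- altΣ (λ i → f (suc i)) - altΣ (λ i → g (suc i))) ≈⟨ +-interchange _ _ _ _ ⟩
    (f zero - altΣ (λ i → f (suc i))) + (g zero - altΣ (λ i → g (suc i)))  ≈⟨ +-cong (altΣ-suc f) (altΣ-suc g) ⟨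
    altΣ f + altΣ g                                                        ∎

  altΣ-* : ∀ {m} c (f : Fin m → Carrier) → altΣ (λ i → c * f i) ≈ c * altΣ f
  altΣ-* {zero}  c f = trans (altΣ-nil _) (sym (trans (*-congˡ (altΣ-nil f)) (zeroʳ c)))
  altΣ-* {suc m} c f = begin
    altΣ (λ i → c * f i)                         ≈⟨ altΣ-suc _ ⟩
    c * f zero - altΣ (λ i → c * f (suc i))      ≈⟨ +-congˡ (trans (-‿cong (altΣ-* c _)) (-‿distribʳ-* _ _)) ⟩
    c * f zero + c * (- altΣ (λ i → f (suc i)))  ≈⟨ distribˡ _ _ _ ⟨
    c * (f zero - altΣ (λ i → f (suc i)))        ≈⟨ *-congˡ (altΣ-suc f) ⟨
    c * altΣ f                                   ∎

  altΣ-neg : ∀ {m} (f : Fin m → Carrier) → altΣ (λ i → - f i) ≈ - altΣ f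
  altΣ-neg f = neg-unique (trans (sym (altΣ-+ _ f)) (altΣ-zero (λ i → -‿inverseˡ (f i))))

  altΣ-sub : ∀ {m} (f g : Fin m → Carrier) → altΣ (λ i → f i - g i) ≈ altΣ f - altΣ g
  altΣ-sub f g = trans (altΣ-+ f (λ i → - g i)) (+-congˡ (altΣ-neg g))

  altΣ-swap : ∀ {m n} (f : Fin m → Fin n → Carrier) →
              altΣ (λ i → altΣ (λ j → f i j)) ≈ altΣ (λ j → altΣ (λ i → f i j))
  altΣ-swap {zero}  f = trans (altΣ-nil _) (sym (altΣ-zero (λ j → altΣ-nil _)))
  altΣ-swap {suc m} f = begin
    altΣ (λ i → altΣ (f i))                                  ≈⟨ altΣ-suc _ ⟩
    altΣ (f zero) - altΣ (λ i → altΣ (f (suc i)))            ≈⟨ +-congˡ (-‿cong (altΣ-swap (λ i → f (suc i)))) ⟩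
    altΣ (f zero) - altΣ (λ j → altΣ (λ i → f (suc i) j))    ≈⟨ altΣ-sub (f zero) _ ⟨
    altΣ (λ j → f zero j - altΣ (λ i → f (suc i) j))         ≈⟨ altΣ-cong (λ j → altΣ-suc (λ i → f i j)) ⟨
    altΣ (λ j → altΣ (λ i → f i j))                          ∎

  altΣ-∑ : ∀ {m} {X : Set} (xs : List X) (f : Fin m → X → Carrier) →
           altΣ (λ i → ∑ xs (f i)) ≈ ∑ xs (λ x → altΣ (λ i → f i x))
  altΣ-∑ []       f = altΣ-0 _
  altΣ-∑ (x ∷ xs) f = trans (altΣ-+ (λ i → f i x) _) (+-congˡ (altΣ-∑ xs f))

  altΣ-init : ∀ {m} (f : Fin (suc m) → Carrier) → f (fromℕ m) ≈ 0# → altΣ f ≈ altΣ (λ i → f (inject₁ i))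
  altΣ-init {zero}  f e = trans (altΣ-suc f) (trans (+-cong e (trans (-‿cong (altΣ-nil _)) -0#≈0#)) (trans (+-identityˡ 0#) (sym (altΣ-nil _))))
  altΣ-init {suc m} f e = trans (altΣ-suc f) (trans (+-congˡ (-‿cong (altΣ-init (λ i → f (suc i)) e))) (sym (altΣ-suc _)))

  minor₀ : ∀ {m n} → (Fin m → Fin (suc n) → Carrier) → Fin (suc n) → Fin m → Fin n → Carrier
  minor₀ M j a b = M a (punchIn j b)

  Det-cong : ∀ {n} {M M' : Matrix n} → (∀ a b → M a b ≈ M' a b) → Det M ≈ Det M'
  Det-cong {zero}  {M} {M'} e = trans (Det-nil M) (sym (Det-nil M'))
  Det-cong {suc n} {M} {M'} e = trans (Det-suc M) (trans
    (altΣ-cong (λ j → *-cong (e zero j) (Det-cong (λ a b → e (suc a) (punchIn j b))))) (sym (Det-suc M')))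

  Det-◂ : ∀ {n} (x : Fin (suc n) → Carrier) M → Det (x ◂ M) ≈ altΣ (λ j → x j * Det (minor₀ M j))
  Det-◂ x M = Det-suc (x ◂ M)

  Det-◂◂ : ∀ {n} (x y : Fin (suc (suc n)) → Carrier) M →
           Det (x ◂ y ◂ M) ≈ altΣ (λ j → x j * Det ((λ b → y (punchIn j b)) ◂ minor₀ M j))
  Det-◂◂ x y M = trans (Det-◂ x (y ◂ M)) (altΣ-cong (λ j → *-congˡ (Det-cong (λ { zero b → refl ; (suc a) b → refl }))))

  Det-row0-+ : ∀ {n} (x y : Fin (suc n) → Carrier) M →
               Det ((λ j → x j + y j) ◂ M) ≈ Det (x ◂ M) + Det (y ◂ M)
  Det-row0-+ x y M = begin
    Det ((λ j → x j + y j) ◂ M)                        ≈⟨ Det-◂ _ M ⟩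
    altΣ (λ j → (x j + y j) * Det (minor₀ M j))        ≈⟨ altΣ-cong (λ j → distribʳ _ _ _) ⟩
    altΣ (λ j → x j * Det (minor₀ M j) + y j * Det (minor₀ M j)) ≈⟨ altΣ-+ _ _ ⟩
    altΣ (λ j → x j * Det (minor₀ M j)) + altΣ (λ j → y j * Det (minor₀ M j)) ≈⟨ +-cong (Det-◂ x M) (Det-◂ y M) ⟨
    Det (x ◂ M) + Det (y ◂ M) ∎

  Det-row0-* : ∀ {n} c (x : Fin (suc n) → Carrier) M → Det ((λ j → c * x j) ◂ M) ≈ c * Det (x ◂ M)
  Det-row0-* c x M = begin
    Det ((λ j → c * x j) ◂ M)                      ≈⟨ Det-◂ _ M ⟩
    altΣ (λ j → (c * x j) * Det (minor₀ M j))      ≈⟨ altΣ-cong (λ j → *-assoc _ _ _) ⟩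
    altΣ (λ j → c * (x j * Det (minor₀ M j)))      ≈⟨ altΣ-* c _ ⟩
    c * altΣ (λ j → x j * Det (minor₀ M j))        ≈⟨ *-congˡ (Det-◂ x M) ⟨
    c * Det (x ◂ M)                                ∎

  Det-row1-+ : ∀ {n} (w x y : Fin (suc (suc n)) → Carrier) M →
               Det (w ◂ (λ j → x j + y j) ◂ M) ≈ Det (w ◂ x ◂ M) + Det (w ◂ y ◂ M)
  Det-row1-+ w x y M = begin
    Det (w ◂ (λ j → x j + y j) ◂ M)   ≈⟨ Det-◂◂ w _ M ⟩
    altΣ (λ j → w j * Det ((λ b → x (punchIn j b) + y (punchIn j b)) ◂ _))
      ≈⟨ altΣ-cong (λ j → trans (*-congˡ (Det-row0-+ _ _ _)) (distribˡ _ _ _)) ⟩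
    altΣ (λ j → w j * Det ((λ b → x (punchIn j b)) ◂ _) + w j * Det ((λ b → y (punchIn j b)) ◂ _)) ≈⟨ altΣ-+ _ _ ⟩
    altΣ (λ j → w j * Det ((λ b → x (punchIn j b)) ◂ _)) + altΣ (λ j → w j * Det ((λ b → y (punchIn j b)) ◂ _))
      ≈⟨ +-cong (Det-◂◂ w x M) (Det-◂◂ w y M) ⟨
    Det (w ◂ x ◂ M) + Det (w ◂ y ◂ M) ∎

  Det-row1-* : ∀ {n} c (w x : Fin (suc (suc n)) → Carrier) M →
               Det (w ◂ (λ j → c * x j) ◂ M) ≈ c * Det (w ◂ x ◂ M)
  Det-row1-* c w x M = begin
    Det (w ◂ (λ j → c * x j) ◂ M)     ≈⟨ Det-◂◂ w _ M ⟩
    altΣ (λ j → w j * Det ((λ b → c * x (punchIn j b)) ◂ _))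
      ≈⟨ altΣ-cong (λ j → trans (*-congˡ (Det-row0-* _ _ _)) (x∙yz≈y∙xz (w j) c _)) ⟩
    altΣ (λ j → c * (w j * Det ((λ b → x (punchIn j b)) ◂ _))) ≈⟨ altΣ-* c _ ⟩
    c * altΣ (λ j → w j * Det ((λ b → x (punchIn j b)) ◂ _))   ≈⟨ *-congˡ (Det-◂◂ w x M) ⟨
    c * Det (w ◂ x ◂ M) ∎

  -- In the expansion along the first row every minor but the first keeps column 0 and is expanded
  -- along it by induction. Exchanging the two alternating sums collects the coefficient of each
  -- entry of column 0; both sums are tails, so they carry the same sign.
  Det-column-expansion : ∀ {n} (M : Matrix (suc n)) →
                         Det M ≈ altΣ (λ i → M i zero * Det (λ a b → M (punchIn i a) (suc b)))
  Det-column-expansion {zero}  M = trans (Det-suc M) (altΣ-cong (λ { zero → *-congˡ (Det-cong (λ ())) }))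
  Det-column-expansion {suc n} M = trans (Det-suc M) (trans (altΣ-suc _) (trans (+-congˡ (-‿cong (begin
    altΣ (λ j → x j * Det (λ a b → M (suc a) (punchIn (suc j) b)))
      ≈⟨ altΣ-cong (λ j → trans (*-congˡ (Det-column-expansion _)) (sym (altΣ-* (x j) _))) ⟩
    altΣ (λ j → altΣ (λ i → x j * (y i * D i j)))
      ≈⟨ altΣ-cong (λ j → altΣ-cong (λ i → x∙yz≈y∙xz (x j) (y i) (D i j))) ⟩
    altΣ (λ j → altΣ (λ i → y i * (x j * D i j)))
      ≈⟨ altΣ-swap (λ j i → y i * (x j * D i j)) ⟩
    altΣ (λ i → altΣ (λ j → y i * (x j * D i j)))
      ≈⟨ altΣ-cong (λ i → trans (altΣ-* (y i) (λ j → x j * D i j)) (*-congˡ (sym (Det-suc _)))) ⟩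
    altΣ (λ i → y i * Det (λ a b → M (punchIn (suc i) a) (suc b))) ∎))) (sym (altΣ-suc _))))
    where
    x : Fin (suc n) → Carrier
    x j = M zero (suc j)
    y : Fin (suc n) → Carrier
    y i = M (suc i) zero
    D : Fin (suc n) → Fin (suc n) → Carrier
    D i j = Det (λ a b → M (suc (punchIn i a)) (suc (punchIn j b)))

  Det-transpose : ∀ {n} (M : Matrix n) → Det M ≈ Det (λ a b → M b a)
  Det-transpose {zero}  M = Det-cong (λ ())
  Det-transpose {suc n} M = trans (Det-column-expansion M) (trans
    (altΣ-cong (λ i → *-congˡ (Det-transpose (λ a b → M (punchIn i a) (suc b))))) (sym (Det-suc _)))

  -- Along the first row, the first two terms are equal with opposite signs, and each later minor
  -- still contains both equal columns.
  Det-columns01 : ∀ {n} (M : Matrix (suc (suc n))) → (∀ a → M a zero ≈ M a (suc zero)) → Det M ≈ 0#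
  Det-columns01 {n} M e = begin
    Det M                                                     ≈⟨ Det-suc M ⟩
    altΣ (λ j → x j * D j)                                    ≈⟨ trans (altΣ-suc _) (+-congˡ (-‿cong (altΣ-suc _))) ⟩
    x 0F * D 0F - (x 1F * D 1F - altΣ (λ j → x (suc (suc j)) * D (suc (suc j))))
      ≈⟨ +-congˡ (-‿cong (trans (+-congˡ (trans (-‿cong (altΣ-zero (rest n M e))) -0#≈0#)) (+-identityʳ _))) ⟩
    x 0F * D 0F - x 1F * D 1F                                 ≈⟨ +-congʳ (*-cong (e zero) (Det-cong same)) ⟩
    x 1F * D 1F - x 1F * D 1F                                 ≈⟨ -‿inverseʳ _ ⟩
    0# ∎
    where
    0F 1F : Fin (suc (suc n))
    0F = zero
    1F = suc zero
    x = M zero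
    D : Fin (suc (suc n)) → Carrier
    D j = Det (λ a b → M (suc a) (punchIn j b))
    same : ∀ a b → M (suc a) (suc b) ≈ M (suc a) (punchIn 1F b)
    same a zero    = sym (e (suc a))
    same a (suc b) = refl
    rest : ∀ n (M : Matrix (suc (suc n))) → (∀ a → M a zero ≈ M a (suc zero)) → ∀ j →
           M zero (suc (suc j)) * Det (λ a b → M (suc a) (punchIn (suc (suc j)) b)) ≈ 0#
    rest (suc n) M e j = trans (*-congˡ (Det-columns01 (λ a b → M (suc a) (punchIn (suc (suc j)) b)) (λ a → e (suc a)))) (zeroʳ _)

  Det-rows01 : ∀ {n} (x : Fin (suc (suc n)) → Carrier) M → Det (x ◂ x ◂ M) ≈ 0#
  Det-rows01 x M = trans (Det-transpose (x ◂ x ◂ M)) (Det-columns01 (λ a b → (x ◂ x ◂ M) b a) (λ _ → refl))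

  Det-swap01 : ∀ {n} (x y : Fin (suc (suc n)) → Carrier) M → Det (x ◂ y ◂ M) + Det (y ◂ x ◂ M) ≈ 0#
  Det-swap01 x y M = sym (begin
    0#                                                     ≈⟨ Det-rows01 x+y M ⟨
    Det (x+y ◂ x+y ◂ M)                                    ≈⟨ Det-row0-+ x y (x+y ◂ M) ⟩
    Det (x ◂ x+y ◂ M) + Det (y ◂ x+y ◂ M)                  ≈⟨ +-cong (Det-row1-+ x x y M) (Det-row1-+ y x y M) ⟩
    (Det (x ◂ x ◂ M) + Det (x ◂ y ◂ M)) + (Det (y ◂ x ◂ M) + Det (y ◂ y ◂ M))
      ≈⟨ +-cong (trans (+-congʳ (Det-rows01 x M)) (+-identityˡ _)) (trans (+-congˡ (Det-rows01 y M)) (+-identityʳ _)) ⟩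
    Det (x ◂ y ◂ M) + Det (y ◂ x ◂ M) ∎)
    where
    x+y : Fin _ → Carrier
    x+y j = x j + y j

  ◂◂-η : ∀ {n} (M : Matrix (suc (suc n))) → Det M ≈ Det (M zero ◂ M (suc zero) ◂ (λ a → M (suc (suc a))))
  ◂◂-η M = Det-cong (λ { zero b → refl ; (suc zero) b → refl ; (suc (suc a)) b → refl })

  Det-row1-sub : ∀ {n} c (w x : Fin (suc (suc n)) → Carrier) M →
                 Det (w ◂ (λ j → x j - c * w j) ◂ M) ≈ Det (w ◂ x ◂ M)
  Det-row1-sub c w x M = begin
    Det (w ◂ (λ j → x j - c * w j) ◂ M)
      ≈⟨ Det-cong (λ { zero b → refl ; (suc zero) b → +-congˡ (-‿distribˡ-* c (w b)) ; (suc (suc a)) b → refl }) ⟩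
    Det (w ◂ (λ j → x j + (- c) * w j) ◂ M)                ≈⟨ Det-row1-+ w x (λ j → (- c) * w j) M ⟩
    Det (w ◂ x ◂ M) + Det (w ◂ (λ j → (- c) * w j) ◂ M)    ≈⟨ +-congˡ (trans (Det-row1-* (- c) w w M) (trans (*-congˡ (Det-rows01 w M)) (zeroʳ _))) ⟩
    Det (w ◂ x ◂ M) + 0#                                   ≈⟨ +-identityʳ _ ⟩
    Det (w ◂ x ◂ M) ∎

  Det-row0-sub : ∀ {n} c (w x : Fin (suc (suc n)) → Carrier) M →
                 Det ((λ j → x j - c * w j) ◂ w ◂ M) ≈ Det (x ◂ w ◂ M)
  Det-row0-sub c w x M = begin
    Det ((λ j → x j - c * w j) ◂ w ◂ M)
      ≈⟨ Det-cong (λ { zero b → +-congˡ (-‿distribˡ-* c (w b)) ; (suc a) b → refl }) ⟩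
    Det ((λ j → x j + (- c) * w j) ◂ w ◂ M)                ≈⟨ Det-row0-+ x (λ j → (- c) * w j) (w ◂ M) ⟩
    Det (x ◂ w ◂ M) + Det ((λ j → (- c) * w j) ◂ w ◂ M)    ≈⟨ +-congˡ (trans (Det-row0-* (- c) w (w ◂ M)) (trans (*-congˡ (Det-rows01 w M)) (zeroʳ _))) ⟩
    Det (x ◂ w ◂ M) + 0#                                   ≈⟨ +-identityʳ _ ⟩
    Det (x ◂ w ◂ M) ∎

  -- The rows subtracted are the original ones. Row 1 is restored first, with the untouched row 0;
  -- it is then the untouched first row of every minor, and induction restores the rest.
  Det-sub-previous : ∀ {n} (M M' : Matrix (suc n)) (c : Fin n → Carrier) → (∀ j → M' zero j ≈ M zero j) →
                     (∀ i j → M' (suc i) j ≈ M (suc i) j - c i * M (inject₁ i) j) → Det M' ≈ Det M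
  Det-sub-previous {zero}  M M' c e₀ e = Det-cong (λ { zero b → e₀ b })
  Det-sub-previous {suc n} M M' c e₀ e = begin
    Det M'
      ≈⟨ Det-cong (λ { zero b → e₀ b ; (suc zero) b → e zero b ; (suc (suc a)) b → refl }) ⟩
    Det (M zero ◂ (λ j → M (suc zero) j - c zero * M zero j) ◂ M'')
      ≈⟨ Det-row1-sub (c zero) (M zero) (M (suc zero)) M'' ⟩
    Det (M zero ◂ M (suc zero) ◂ M'')
      ≈⟨ Det-◂ (M zero) (M (suc zero) ◂ M'') ⟩
    altΣ (λ j → M zero j * Det (minor₀ (M (suc zero) ◂ M'') j))
      ≈⟨ altΣ-cong (λ j → *-congˡ (Det-sub-previous (λ a b → M (suc a) (punchIn j b)) (minor₀ (M (suc zero) ◂ M'') j) (λ i → c (suc i))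
           (λ b → refl) (λ i b → e (suc i) (punchIn j b)))) ⟩
    altΣ (λ j → M zero j * Det (λ a b → M (suc a) (punchIn j b)))
      ≈⟨ Det-suc M ⟨
    Det M ∎
    where
    M'' : Fin n → Fin (suc (suc n)) → Carrier
    M'' a = M' (suc (suc a))

  -- Here the untouched row is the last one, so the minors are restored first, by induction, and row
  -- 0 at the end.
  Det-sub-next : ∀ {n} (M M' : Matrix (suc n)) (c : Fin n → Carrier) → (∀ j → M' (fromℕ n) j ≈ M (fromℕ n) j) →
                 (∀ i j → M' (inject₁ i) j ≈ M (inject₁ i) j - c i * M (suc i) j) → Det M' ≈ Det M
  Det-sub-next {zero}  M M' c e₀ e = Det-cong (λ { zero b → e₀ b })
  Det-sub-next {suc n} M M' c e₀ e = begin
    Det M'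
      ≈⟨ Det-suc M' ⟩
    altΣ (λ j → M' zero j * Det (λ a b → M' (suc a) (punchIn j b)))
      ≈⟨ altΣ-cong (λ j → *-cong (e zero j) (Det-sub-next (λ a b → M (suc a) (punchIn j b)) (λ a b → M' (suc a) (punchIn j b)) (λ i → c (suc i))
           (λ b → e₀ (punchIn j b)) (λ i b → e (suc i) (punchIn j b)))) ⟩
    altΣ (λ j → x j * Det (λ a b → M (suc a) (punchIn j b)))
      ≈⟨ Det-◂ x (λ a → M (suc a)) ⟨
    Det (x ◂ (λ a → M (suc a)))
      ≈⟨ ◂◂-η (x ◂ (λ a → M (suc a))) ⟩
    Det (x ◂ M (suc zero) ◂ (λ a → M (suc (suc a))))
      ≈⟨ Det-row0-sub (c zero) (M (suc zero)) (M zero) (λ a → M (suc (suc a))) ⟩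
    Det (M zero ◂ M (suc zero) ◂ (λ a → M (suc (suc a))))
      ≈⟨ ◂◂-η M ⟨
    Det M ∎
    where
    x : Fin (suc (suc n)) → Carrier
    x j = M zero j - c zero * M (suc zero) j

  punchIn-inject₁ : ∀ {n} (j : Fin (suc n)) (b : Fin n) → punchIn (inject₁ j) (inject₁ b) ≡ inject₁ (punchIn j b)
  punchIn-inject₁ zero    b       = ≡.refl
  punchIn-inject₁ (suc j) zero    = ≡.refl
  punchIn-inject₁ (suc j) (suc b) = ≡.cong suc (punchIn-inject₁ j b)

  punchIn-inject₁-fromℕ : ∀ {n} (j : Fin (suc n)) → punchIn (inject₁ j) (fromℕ n) ≡ fromℕ (suc n)
  punchIn-inject₁-fromℕ         zero    = ≡.refl
  punchIn-inject₁-fromℕ {suc n} (suc j) = ≡.cong suc (punchIn-inject₁-fromℕ j)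

  punchIn-fromℕ : ∀ {n} (b : Fin n) → punchIn (fromℕ n) b ≡ inject₁ b
  punchIn-fromℕ zero    = ≡.refl
  punchIn-fromℕ (suc b) = ≡.cong suc (punchIn-fromℕ b)

  -- Expanding along the first row, the minor without the last column has a zero last row, and all
  -- other minors have the shape of the hypothesis again. The corner entry thus comes out without a
  -- sign.
  Det-last-row : ∀ {n} (M : Matrix (suc n)) → (∀ b → M (fromℕ n) (inject₁ b) ≈ 0#) →
                 Det M ≈ M (fromℕ n) (fromℕ n) * Det (λ a b → M (inject₁ a) (inject₁ b))
  Det-last-row {zero}  M e = trans (Det-suc M) (trans (altΣ-suc _) (trans (+-congˡ (trans (-‿cong (altΣ-nil _)) -0#≈0#))
    (trans (+-identityʳ _) (*-congˡ (Det-cong (λ ()))))))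
  Det-last-row {suc n} M e = begin
    Det M
      ≈⟨ Det-suc M ⟩
    altΣ (λ j → M zero j * Det (λ a b → M (suc a) (punchIn j b)))
      ≈⟨ altΣ-init _ (trans (*-congˡ (trans (Det-last-row (λ a b → M (suc a) (punchIn (fromℕ (suc n)) b)) (λ b → at (punchIn-fromℕ (inject₁ b)) (e (inject₁ b))))
            (trans (*-congʳ (at (punchIn-fromℕ (fromℕ n)) (e (fromℕ n)))) (zeroˡ _)))) (zeroʳ _)) ⟩
    altΣ (λ j → M zero (inject₁ j) * Det (λ a b → M (suc a) (punchIn (inject₁ j) b)))
      ≈⟨ altΣ-cong (λ j → trans (*-congˡ (trans (Det-last-row (λ a b → M (suc a) (punchIn (inject₁ j) b)) (λ b → at (punchIn-inject₁ j b) (e _)))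
            (*-cong (reflexive (≡.cong (M (fromℕ (suc n))) (punchIn-inject₁-fromℕ j))) (Det-cong (λ a b → reflexive (≡.cong (M (suc (inject₁ a))) (punchIn-inject₁ j b)))))))
            (x∙yz≈y∙xz _ _ _)) ⟩
    altΣ (λ j → M (fromℕ (suc n)) (fromℕ (suc n)) * (M zero (inject₁ j) * Det (λ a b → M (suc (inject₁ a)) (inject₁ (punchIn j b)))))
      ≈⟨ altΣ-* (M (fromℕ (suc n)) (fromℕ (suc n))) _ ⟩
    M (fromℕ (suc n)) (fromℕ (suc n)) * altΣ (λ j → M zero (inject₁ j) * Det (λ a b → M (suc (inject₁ a)) (inject₁ (punchIn j b))))
      ≈⟨ *-congˡ (Det-suc (λ a b → M (inject₁ a) (inject₁ b))) ⟨
    M (fromℕ (suc n)) (fromℕ (suc n)) * Det (λ a b → M (inject₁ a) (inject₁ b)) ∎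
    where
    at : ∀ {z z'} → z ≡ z' → M (fromℕ (suc n)) z' ≈ 0# → M (fromℕ (suc n)) z ≈ 0#
    at ≡.refl p = p

  ∏ : ∀ {n} → (Fin n → Carrier) → Carrier
  ∏ {zero}  w = 1#
  ∏ {suc n} w = w zero * ∏ (λ i → w (suc i))

  -- Multilinearity in the rows. The map `p` selects columns, so that the minors met in the
  -- induction are instances of the same statement.
  Det-expand-rows : ∀ {X : Set} (xs : List X) {n} (w : Fin n → X → Carrier) {m} (e : Fin n → X → Fin m → Carrier) (p : Fin n → Fin m) →
                    Det (λ i j → ∑ xs (λ x → w i x * e i x (p j))) ≈
                    ∑ (vecs xs n) (λ v → ∏ (λ i → w i (lookup v i)) * Det (λ i j → e i (lookup v i) (p j)))
  Det-expand-rows xs {zero}  w e p = trans (Det-nil _) (sym (trans (+-identityʳ _) (trans (*-identityˡ _) (Det-nil _))))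
  Det-expand-rows {X} xs {suc n} w {m} e p = begin
    Det (λ i j → ∑ xs (λ x → w i x * e i x (p j)))
      ≈⟨ Det-suc _ ⟩
    altΣ (λ j → ∑ xs (λ x → w zero x * e zero x (p j)) * Det (λ a b → ∑ xs (λ x → w (suc a) x * e (suc a) x (p (punchIn j b)))))
      ≈⟨ altΣ-cong (λ j → *-congˡ (Det-expand-rows xs (λ i → w (suc i)) (λ i → e (suc i)) (λ b → p (punchIn j b)))) ⟩
    altΣ (λ j → ∑ xs (λ x → w zero x * e zero x (p j)) * ∑ (vecs xs n) (λ v → W v * D v j))
      ≈⟨ altΣ-cong (λ j → trans (∑-*ʳ xs _ _) (∑-cong xs (λ x → ∑-*ˡ (vecs xs n) _ _))) ⟩
    altΣ (λ j → ∑ xs (λ x → ∑ (vecs xs n) (λ v → (w zero x * e zero x (p j)) * (W v * D v j))))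
      ≈⟨ trans (altΣ-∑ xs _) (∑-cong xs (λ x → altΣ-∑ (vecs xs n) _)) ⟩
    ∑ xs (λ x → ∑ (vecs xs n) (λ v → altΣ (λ j → (w zero x * e zero x (p j)) * (W v * D v j))))
      ≈⟨ ∑-cong xs (λ x → ∑-cong (vecs xs n) (λ v → trans (altΣ-cong (λ j → *-interchange (w zero x) (e zero x (p j)) (W v) (D v j))) (altΣ-* (w zero x * W v) _))) ⟩
    ∑ xs (λ x → ∑ (vecs xs n) (λ v → (w zero x * W v) * altΣ (λ j → e zero x (p j) * D v j)))
      ≈⟨ ∑-cong xs (λ x → ∑-cong (vecs xs n) (λ v → *-congˡ (Det-suc _))) ⟨
    ∑ xs (λ x → ∑ (vecs xs n) (λ v → (w zero x * W v) * Det (λ i j → e i (lookup (x ∷ v) i) (p j))))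
      ≈⟨ ∑-vecs xs n _ ⟨
    ∑ (vecs xs (suc n)) (λ v → ∏ (λ i → w i (lookup v i)) * Det (λ i j → e i (lookup v i) (p j))) ∎
    where
    W : Vec X n → Carrier
    W v = ∏ (λ i → w (suc i) (lookup v i))
    D : Vec X n → Fin (suc n) → Carrier
    D v j = Det (λ a b → e (suc a) (lookup v a) (p (punchIn j b)))

module ℤS = Data.Integer.Solver.+-*-Solver

-- Complete symmetric functions acting on Schur determinants

antidiagonal : ℕ → List (ℕ × ℕ)
antidiagonal zero    = (0 , 0) ∷ []
antidiagonal (suc r) = (0 , suc r) ∷ map (λ (g , h) → suc g , h) (antidiagonal r)

zeros : ∀ n → Vec ℤ n
zeros n = replicate n (+ 0)

module Antidiagonal (R : CommutativeRing 0ℓ 0ℓ) where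
  open CommutativeRing R hiding (zero)
  open Sums R
  open Relation.Binary.Reasoning.Setoid setoid

  ∑ᵃ : ℕ → (ℕ → ℕ → Carrier) → Carrier
  ∑ᵃ r f = ∑ (antidiagonal r) (λ (g , h) → f g h)

  ∑ᵃ-suc : ∀ r f → ∑ᵃ (suc r) f ≈ f 0 (suc r) + ∑ᵃ r (λ g h → f (suc g) h)
  ∑ᵃ-suc r f = +-congˡ (∑-map _ (antidiagonal r) _)

  ∑ᵃ-cong : ∀ r {f f'} → (∀ g h → f g h ≈ f' g h) → ∑ᵃ r f ≈ ∑ᵃ r f'
  ∑ᵃ-cong r e = ∑-cong (antidiagonal r) (λ (g , h) → e g h)

  ∑ᵃ-snoc : ∀ r f → ∑ᵃ (suc r) f ≈ ∑ᵃ r (λ g h → f g (suc h)) + f (suc r) 0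
  ∑ᵃ-snoc zero    f = trans (∑ᵃ-suc 0 f) (trans (+-congˡ (+-identityʳ _)) (+-congʳ (sym (+-identityʳ _))))
  ∑ᵃ-snoc (suc r) f = begin
    ∑ᵃ (suc (suc r)) f                                                   ≈⟨ ∑ᵃ-suc (suc r) f ⟩
    f 0 (suc (suc r)) + ∑ᵃ (suc r) (λ g h → f (suc g) h)                 ≈⟨ +-congˡ (∑ᵃ-snoc r _) ⟩
    f 0 (suc (suc r)) + (∑ᵃ r (λ g h → f (suc g) (suc h)) + f (suc (suc r)) 0) ≈⟨ +-assoc _ _ _ ⟨
    (f 0 (suc (suc r)) + ∑ᵃ r (λ g h → f (suc g) (suc h))) + f (suc (suc r)) 0 ≈⟨ +-congʳ (∑ᵃ-suc r (λ g h → f g (suc h))) ⟨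
    ∑ᵃ (suc r) (λ g h → f g (suc h)) + f (suc (suc r)) 0                 ∎

  ∑ᵃ-swap : ∀ r f → ∑ᵃ r f ≈ ∑ᵃ r (λ g h → f h g)
  ∑ᵃ-swap zero    f = refl
  ∑ᵃ-swap (suc r) f = begin
    ∑ᵃ (suc r) f                                 ≈⟨ ∑ᵃ-suc r f ⟩
    f 0 (suc r) + ∑ᵃ r (λ g h → f (suc g) h)     ≈⟨ +-congˡ (∑ᵃ-swap r _) ⟩
    f 0 (suc r) + ∑ᵃ r (λ g h → f (suc h) g)     ≈⟨ +-comm _ _ ⟩
    ∑ᵃ r (λ g h → f (suc h) g) + f 0 (suc r)     ≈⟨ ∑ᵃ-snoc r (λ g h → f h g) ⟨
    ∑ᵃ (suc r) (λ g h → f h g)                   ∎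

  ∑ᵃ-assoc : ∀ r (f : ℕ → ℕ → ℕ → Carrier) →
             ∑ᵃ r (λ g m → ∑ᵃ m (λ h l → f g h l)) ≈ ∑ᵃ r (λ m l → ∑ᵃ m (λ g h → f g h l))
  ∑ᵃ-assoc zero    f = refl
  ∑ᵃ-assoc (suc r) f = begin
    ∑ᵃ (suc r) (λ g m → ∑ᵃ m (λ h l → f g h l))
      ≈⟨ ∑ᵃ-suc r _ ⟩
    ∑ᵃ (suc r) (λ h l → f 0 h l) + ∑ᵃ r (λ g m → ∑ᵃ m (λ h l → f (suc g) h l))
      ≈⟨ +-cong (∑ᵃ-suc r _) (∑ᵃ-assoc r _) ⟩
    (f 0 0 (suc r) + ∑ᵃ r (λ h l → f 0 (suc h) l)) + ∑ᵃ r (λ m l → ∑ᵃ m (λ g h → f (suc g) h l))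
      ≈⟨ trans (+-assoc _ _ _) (+-congˡ (sym (∑-+ (antidiagonal r) _ _))) ⟩
    f 0 0 (suc r) + ∑ᵃ r (λ m l → f 0 (suc m) l + ∑ᵃ m (λ g h → f (suc g) h l))
      ≈⟨ +-cong (+-identityʳ _) (∑ᵃ-cong r (λ m l → ∑ᵃ-suc m _)) ⟨
    ∑ᵃ 0 (λ g h → f g h (suc r)) + ∑ᵃ r (λ m l → ∑ᵃ (suc m) (λ g h → f g h l))
      ≈⟨ ∑ᵃ-suc r _ ⟨
    ∑ᵃ (suc r) (λ m l → ∑ᵃ m (λ g h → f g h l)) ∎

  ∑ᵃ-alternating : ∀ r f → (∀ g h → f g h + f h g ≈ 0#) → (∀ g → f g g ≈ 0#) → ∑ᵃ r f ≈ 0#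
  ∑ᵃ-alternating r f e z = trans (flat r f) (∑<-alternating (suc r)
      (λ a b p → trans (+-cong (at a b p) (at b a (≡.trans (≡.cong suc (ℕₚ.+-comm b a)) p))) (e a b))
      (λ a p → trans (at a a p) (z a)))
    where
    flat : ∀ r f → ∑ᵃ r f ≈ ∑< (suc r) (λ g → f g (r ℕ.∸ g))
    flat zero    f = refl
    flat (suc r) f = trans (∑ᵃ-suc r f) (+-congˡ (flat r _))
    at : ∀ a b → suc (a ℕ.+ b) ≡ suc r → f a (r ℕ.∸ a) ≈ f a b
    at a b p = reflexive (≡.cong (f a) (≡.trans (≡.cong (ℕ._∸ a) (≡.sym (ℕₚ.suc-injective p))) (ℕₚ.m+n∸m≡n a b)))

  -- Power series in one variable u with the Cauchy product. One determinant over this ring holds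
  -- the actions of all h_r at once, as its coefficients (`coefficient-Det`).
  PowerSeries : CommutativeRing 0ℓ 0ℓ
  PowerSeries = record
    { Carrier = ℕ → Carrier
    ; _≈_ = λ f g → ∀ n → f n ≈ g n
    ; _+_ = λ f g n → f n + g n
    ; _*_ = λ f g n → ∑ᵃ n (λ a b → f a * g b)
    ; -_ = λ f n → - f n
    ; 0# = λ _ → 0#
    ; 1# = one
    ; isCommutativeRing = record
      { isRing = record
        { +-isAbelianGroup = record
          { isGroup = record
            { isMonoid = record
              { isSemigroup = record
                { isMagma = record
                  { isEquivalence = record
                    { refl = λ n → refl ; sym = λ e n → sym (e n) ; trans = λ d e n → trans (d n) (e n) }
                  ; ∙-cong = λ d e n → +-cong (d n) (e n) }
                ; assoc = λ f g h n → +-assoc _ _ _ }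
              ; identity = (λ f n → +-identityˡ _) , (λ f n → +-identityʳ _) }
            ; inverse = (λ f n → -‿inverseˡ _) , (λ f n → -‿inverseʳ _)
            ; ⁻¹-cong = λ e n → -‿cong (e n) }
          ; comm = λ f g n → +-comm _ _ }
        ; *-cong = λ d e n → ∑ᵃ-cong n (λ a b → *-cong (d a) (e b))
        ; *-assoc = λ f g h n → begin
            ∑ᵃ n (λ m c → ∑ᵃ m (λ a b → f a * g b) * h c)
              ≈⟨ ∑ᵃ-cong n (λ m c → trans (∑-*ʳ (antidiagonal m) (h c) _) (∑ᵃ-cong m (λ a b → *-assoc _ _ _))) ⟩
            ∑ᵃ n (λ m c → ∑ᵃ m (λ a b → f a * (g b * h c)))
              ≈⟨ ∑ᵃ-assoc n (λ a b c → f a * (g b * h c)) ⟨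
            ∑ᵃ n (λ a m → ∑ᵃ m (λ b c → f a * (g b * h c)))
              ≈⟨ ∑ᵃ-cong n (λ a m → ∑-*ˡ (antidiagonal m) (f a) _) ⟨
            ∑ᵃ n (λ a m → f a * ∑ᵃ m (λ b c → g b * h c)) ∎
        ; *-identity = one-left , (λ f n → trans (comm f one n) (one-left f n))
        ; distrib = (λ f g h n → trans (∑ᵃ-cong n (λ a b → distribˡ _ _ _)) (∑-+ (antidiagonal n) _ _))
                  , (λ f g h n → trans (∑ᵃ-cong n (λ a b → distribʳ _ _ _)) (∑-+ (antidiagonal n) _ _))
        }
      ; *-comm = comm
      }
    }
    where
    one : ℕ → Carrier
    one zero    = 1#
    one (suc n) = 0#
    comm : ∀ f g n → ∑ᵃ n (λ a b → f a * g b) ≈ ∑ᵃ n (λ a b → g a * f b)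
    comm f g n = trans (∑ᵃ-swap n _) (∑ᵃ-cong n (λ a b → *-comm _ _))
    one-left : ∀ f n → ∑ᵃ n (λ a b → one a * f b) ≈ f n
    one-left f zero    = trans (+-identityʳ _) (*-identityˡ _)
    one-left f (suc n) = trans (∑ᵃ-suc n _) (trans (+-cong (*-identityˡ _)
      (∑-zero (antidiagonal n) (λ _ → zeroˡ _))) (+-identityʳ _))

module CompleteAction (R : CommutativeRing 0ℓ 0ℓ) where
  open CommutativeRing R hiding (zero)
  open Sums R
  open Determinants R
  open Antidiagonal R
  open Relation.Binary.Reasoning.Setoid setoid

  Weights : ℕ → Set
  Weights n = Vec ℤ n → Carrier

  -- The action of h_r(x₁,…,xₙ) on functions of n integers, xᵢ raising the i-th argument by one.
  hAct : ∀ {n} → ℕ → Weights n → Weights n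
  hAct zero    t []      = t []
  hAct (suc r) t []      = 0#
  hAct r       t (a ∷ α) = ∑ᵃ r (λ g h → hAct h (λ β → t ((a ℤ.+ + g) ∷ β)) α)

  hAct-∷ : ∀ {n} r (t : Weights (suc n)) a α →
           hAct r t (a ∷ α) ≈ ∑ᵃ r (λ g h → hAct h (λ β → t ((a ℤ.+ + g) ∷ β)) α)
  hAct-∷ zero    t a α = refl
  hAct-∷ (suc r) t a α = refl

  hAct-cong : ∀ {n} r {t t' : Weights n} → (∀ α → t α ≈ t' α) → ∀ α → hAct r t α ≈ hAct r t' α
  hAct-cong zero    e []      = e []
  hAct-cong (suc r) e []      = refl
  hAct-cong r {t} {t'} e (a ∷ α) = trans (hAct-∷ r t a α) (trans
    (∑ᵃ-cong r (λ g h → hAct-cong h (λ β → e _) α)) (sym (hAct-∷ r t' a α)))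

  hAct-∑ : ∀ {n} r {X : Set} (xs : List X) (t : X → Weights n) α →
           hAct r (λ β → ∑ xs (λ x → t x β)) α ≈ ∑ xs (λ x → hAct r (t x) α)
  hAct-∑ zero    xs t []      = refl
  hAct-∑ (suc r) xs t []      = sym (∑-0 xs)
  hAct-∑ r xs t (a ∷ α) = begin
    hAct r (λ β → ∑ xs (λ x → t x β)) (a ∷ α) ≈⟨ hAct-∷ r _ a α ⟩
    ∑ᵃ r (λ g h → hAct h (λ β → ∑ xs (λ x → t x ((a ℤ.+ + g) ∷ β))) α) ≈⟨ ∑ᵃ-cong r (λ g h → hAct-∑ h xs _ α) ⟩
    ∑ᵃ r (λ g h → ∑ xs (λ x → hAct h (λ β → t x ((a ℤ.+ + g) ∷ β)) α)) ≈⟨ ∑-swap (antidiagonal r) xs _ ⟩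
    ∑ xs (λ x → ∑ᵃ r (λ g h → hAct h (λ β → t x ((a ℤ.+ + g) ∷ β)) α)) ≈⟨ ∑-cong xs (λ x → hAct-∷ r (t x) a α) ⟨
    ∑ xs (λ x → hAct r (t x) (a ∷ α)) ∎

  hAct-+ : ∀ {n} r (t t' : Weights n) α → hAct r (λ β → t β + t' β) α ≈ hAct r t α + hAct r t' α
  hAct-+ zero    t t' []      = refl
  hAct-+ (suc r) t t' []      = sym (+-identityˡ 0#)
  hAct-+ r t t' (a ∷ α) = trans (hAct-∷ r _ a α) (trans (∑ᵃ-cong r (λ g h → hAct-+ h _ _ α))
    (trans (∑-+ (antidiagonal r) _ _) (+-cong (sym (hAct-∷ r t a α)) (sym (hAct-∷ r t' a α)))))

  hAct-* : ∀ {n} r c (t : Weights n) α → hAct r (λ β → c * t β) α ≈ c * hAct r t α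
  hAct-* zero    c t []      = refl
  hAct-* (suc r) c t []      = sym (zeroʳ c)
  hAct-* r c t (a ∷ α) = trans (hAct-∷ r _ a α) (trans (∑ᵃ-cong r (λ g h → hAct-* h c _ α))
    (trans (sym (∑-*ˡ (antidiagonal r) c _)) (*-congˡ (sym (hAct-∷ r t a α)))))

  hAct-0 : ∀ {n} r (α : Vec ℤ n) → hAct r (λ _ → 0#) α ≈ 0#
  hAct-0 r α = trans (hAct-cong r (λ _ → sym (zeroˡ 0#)) α) (trans (hAct-* r 0# (λ _ → 0#) α) (zeroˡ _))

  hAct-neg : ∀ {n} r (t : Weights n) α → hAct r (λ β → - t β) α ≈ - hAct r t α
  hAct-neg r t α = neg-unique (trans (sym (hAct-+ r _ t α)) (trans (hAct-cong r (λ β → -‿inverseˡ _) α) (hAct-0 r α)))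

  hAct-altΣ : ∀ {n} r {m} (t : Fin m → Weights n) α →
              hAct r (λ β → altΣ (λ i → t i β)) α ≈ altΣ (λ i → hAct r (t i) α)
  hAct-altΣ r {zero}  t α = trans (hAct-cong r (λ β → altΣ-nil _) α) (trans (hAct-0 r α) (sym (altΣ-nil _)))
  hAct-altΣ r {suc m} t α = begin
    hAct r (λ β → altΣ (λ i → t i β)) α                              ≈⟨ hAct-cong r (λ β → altΣ-suc _) α ⟩
    hAct r (λ β → t zero β - altΣ (λ i → t (suc i) β)) α             ≈⟨ hAct-+ r _ _ α ⟩
    hAct r (t zero) α + hAct r (λ β → - altΣ (λ i → t (suc i) β)) α  ≈⟨ +-congˡ (trans (hAct-neg r _ α) (-‿cong (hAct-altΣ r (λ i → t (suc i)) α))) ⟩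
    hAct r (t zero) α - altΣ (λ i → hAct r (t (suc i)) α)            ≈⟨ altΣ-suc _ ⟨
    altΣ (λ i → hAct r (t i) α)                                      ∎

  -- The carrier may have 2-torsion, so antisymmetry under (a , b) ↦ (b - 1 , a + 1) does not imply vanishing at its fixed points.
  Alt : ∀ {n} → Weights n → Set
  Alt {zero}        t = ⊤
  Alt {suc zero}    t = ⊤
  Alt {suc (suc n)} t = (∀ a b α → t (a ∷ ℤ.suc b ∷ α) + t (b ∷ ℤ.suc a ∷ α) ≈ 0#)
                      × (∀ a α → t (a ∷ ℤ.suc a ∷ α) ≈ 0#)
                      × (∀ a → Alt (λ α → t (a ∷ α)))

  Alt-cong : ∀ {n} {t t' : Weights n} → (∀ α → t α ≈ t' α) → Alt t → Alt t'
  Alt-cong {zero}        e A = tt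
  Alt-cong {suc zero}    e A = tt
  Alt-cong {suc (suc n)} e (A , Z , B) = (λ a b α → trans (+-cong (sym (e _)) (sym (e _))) (A a b α)) ,
    (λ a α → trans (sym (e _)) (Z a α)) , (λ a → Alt-cong (λ α → e (a ∷ α)) (B a))

  Alt-∑ : ∀ {n} {X : Set} (xs : List X) {t : X → Weights n} → (∀ x → Alt (t x)) → Alt (λ α → ∑ xs (λ x → t x α))
  Alt-∑ {zero}        xs A = tt
  Alt-∑ {suc zero}    xs A = tt
  Alt-∑ {suc (suc n)} xs A = (λ a b α → trans (sym (∑-+ xs _ _)) (∑-zero xs (λ x → proj₁ (A x) a b α))) ,
    (λ a α → ∑-zero xs (λ x → proj₁ (proj₂ (A x)) a α)) , (λ a → Alt-∑ xs (λ x → proj₂ (proj₂ (A x)) a))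

  Alt-altΣ : ∀ {n m} {t : Fin m → Weights n} → (∀ x → Alt (t x)) → Alt (λ α → altΣ (λ x → t x α))
  Alt-altΣ {zero}        A = tt
  Alt-altΣ {suc zero}    A = tt
  Alt-altΣ {suc (suc n)} A = (λ a b α → trans (sym (altΣ-+ _ _)) (altΣ-zero (λ x → proj₁ (A x) a b α))) ,
    (λ a α → altΣ-zero (λ x → proj₁ (proj₂ (A x)) a α)) , (λ a → Alt-altΣ (λ x → proj₂ (proj₂ (A x)) a))

  Alt-* : ∀ {n} c {t : Weights n} → Alt t → Alt (λ α → c * t α)
  Alt-* {zero}        c A = tt
  Alt-* {suc zero}    c A = tt
  Alt-* {suc (suc n)} c (A , Z , B) = (λ a b α → trans (sym (distribˡ c _ _)) (trans (*-congˡ (A a b α)) (zeroʳ c))) ,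
    (λ a α → trans (*-congˡ (Z a α)) (zeroʳ c)) , (λ a → Alt-* c (B a))

  hAct-∷∷ : ∀ {n} r (t : Weights (suc (suc n))) a b α →
            hAct r t (a ∷ b ∷ α) ≈ ∑ᵃ r (λ m l → hAct l (λ β → ∑ᵃ m (λ g h → t ((a ℤ.+ + g) ∷ (b ℤ.+ + h) ∷ β))) α)
  hAct-∷∷ r t a b α = begin
    hAct r t (a ∷ b ∷ α)
      ≈⟨ hAct-∷ r t a (b ∷ α) ⟩
    ∑ᵃ r (λ g m → hAct m (λ β → t ((a ℤ.+ + g) ∷ β)) (b ∷ α))
      ≈⟨ ∑ᵃ-cong r (λ g m → hAct-∷ m _ b α) ⟩
    ∑ᵃ r (λ g m → ∑ᵃ m (λ h l → hAct l (λ β → t ((a ℤ.+ + g) ∷ (b ℤ.+ + h) ∷ β)) α))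
      ≈⟨ ∑ᵃ-assoc r (λ g h l → hAct l (λ β → t ((a ℤ.+ + g) ∷ (b ℤ.+ + h) ∷ β)) α) ⟩
    ∑ᵃ r (λ m l → ∑ᵃ m (λ g h → hAct l (λ β → t ((a ℤ.+ + g) ∷ (b ℤ.+ + h) ∷ β)) α))
      ≈⟨ ∑ᵃ-cong r (λ m l → hAct-∑ l (antidiagonal m) _ α) ⟨
    ∑ᵃ r (λ m l → hAct l (λ β → ∑ᵃ m (λ g h → t ((a ℤ.+ + g) ∷ (b ℤ.+ + h) ∷ β))) α) ∎

  -- The amounts g and h by which the first two arguments are raised enter symmetrically when their
  -- sum m is fixed. Exchanging g and h therefore matches the terms that antisymmetry of t cancels.
  -- Later positions follow by induction.
  Alt-hAct : ∀ {n} r {t : Weights n} → Alt t → Alt (hAct r t)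
  Alt-hAct {zero}        r A = tt
  Alt-hAct {suc zero}    r A = tt
  Alt-hAct {suc (suc n)} r {t} (A , Z , B) = anti′ , fixed′ , λ a → Alt-cong (λ α → sym (hAct-∷ r t a α))
      (Alt-∑ (antidiagonal r) (λ (g , h) → Alt-hAct h (B (a ℤ.+ + g))))
    where
    shift : ∀ b h → ℤ.suc b ℤ.+ + h ≡ ℤ.suc (b ℤ.+ + h)
    shift b h = ℤₚ.+-assoc (+ 1) b (+ h)
    D : ℕ → ℤ → ℤ → Weights n
    D m a b β = ∑ᵃ m (λ g h → t ((a ℤ.+ + g) ∷ (b ℤ.+ + h) ∷ β))
    D-anti : ∀ m a b β → D m a (ℤ.suc b) β + D m b (ℤ.suc a) β ≈ 0#
    D-anti m a b β = trans (+-congˡ (∑ᵃ-swap m _)) (trans (sym (∑-+ (antidiagonal m) _ _)) (∑-zero (antidiagonal m) (λ (g , h) →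
      trans (+-cong (reflexive (≡.cong (λ z → t ((a ℤ.+ + g) ∷ z ∷ β)) (shift b h)))
                    (reflexive (≡.cong (λ z → t ((b ℤ.+ + h) ∷ z ∷ β)) (shift a g))))
            (A (a ℤ.+ + g) (b ℤ.+ + h) β))))
    D-fixed : ∀ m a β → D m a (ℤ.suc a) β ≈ 0#
    D-fixed m a β = ∑ᵃ-alternating m _
      (λ g h → trans (+-cong (reflexive (≡.cong (λ z → t ((a ℤ.+ + g) ∷ z ∷ β)) (shift a h)))
                             (reflexive (≡.cong (λ z → t ((a ℤ.+ + h) ∷ z ∷ β)) (shift a g))))
                     (A (a ℤ.+ + g) (a ℤ.+ + h) β))
      (λ g → trans (reflexive (≡.cong (λ z → t ((a ℤ.+ + g) ∷ z ∷ β)) (shift a g))) (Z (a ℤ.+ + g) β))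
    anti′ : ∀ a b α → hAct r t (a ∷ ℤ.suc b ∷ α) + hAct r t (b ∷ ℤ.suc a ∷ α) ≈ 0#
    anti′ a b α = trans (+-cong (hAct-∷∷ r t a (ℤ.suc b) α) (hAct-∷∷ r t b (ℤ.suc a) α))
      (trans (sym (∑-+ (antidiagonal r) _ _)) (∑-zero (antidiagonal r) (λ (m , l) →
        trans (sym (hAct-+ l _ _ α)) (trans (hAct-cong l (D-anti m a b) α) (hAct-0 l α)))))
    fixed′ : ∀ a α → hAct r t (a ∷ ℤ.suc a ∷ α) ≈ 0#
    fixed′ a α = trans (hAct-∷∷ r t a (ℤ.suc a) α) (∑-zero (antidiagonal r) (λ (m , l) →
      trans (hAct-cong l (D-fixed m a) α) (hAct-0 l α)))

  -- By induction the operator on the tail raises only the second entry. All terms in which that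
  -- entry is positive cancel, (g , h + 1) against (h , g + 1), and (r , 0) is left.
  hAct-zeros : ∀ {n} r {t : Weights (suc n)} → Alt t → hAct r t (zeros (suc n)) ≈ t (+ r ∷ zeros n)
  hAct-zeros {zero}  r {t} A = trans (hAct-∷ r t (+ 0) []) (go r (λ g β → t (+ g ∷ β)))
    where
    go : ∀ r (u : ℕ → Weights 0) → ∑ᵃ r (λ g h → hAct h (u g) []) ≈ u r []
    go zero    u = +-identityʳ _
    go (suc r) u = trans (∑ᵃ-suc r _) (trans (+-identityˡ _) (go r (u ∘ suc)))
  hAct-zeros {suc n} r {t} (A , Z , B) = begin
    hAct r t (zeros (suc (suc n)))
      ≈⟨ hAct-∷ r t (+ 0) (zeros (suc n)) ⟩
    ∑ᵃ r (λ g h → hAct h (λ β → t (+ g ∷ β)) (zeros (suc n)))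
      ≈⟨ ∑ᵃ-cong r (λ g h → hAct-zeros h (B (+ g))) ⟩
    ∑ᵃ r (λ g h → t (+ g ∷ + h ∷ zeros n))
      ≈⟨ go r ⟩
    t (+ r ∷ zeros (suc n)) ∎
    where
    go : ∀ r → ∑ᵃ r (λ g h → t (+ g ∷ + h ∷ zeros n)) ≈ t (+ r ∷ zeros (suc n))
    go zero    = +-identityʳ _
    go (suc r) = trans (∑ᵃ-snoc r _) (trans (+-congʳ (∑ᵃ-alternating r _
      (λ g h → A (+ g) (+ h) (zeros n)) (λ g → Z (+ g) (zeros n)))) (+-identityˡ _))

  hActs : ∀ {n m} → Vec ℕ m → Weights n → Weights n
  hActs []       t = t
  hActs (r ∷ rs) t = hAct r (hActs rs t)

  hActs-cong : ∀ {n m} (rs : Vec ℕ m) {t t' : Weights n} → (∀ α → t α ≈ t' α) → ∀ α → hActs rs t α ≈ hActs rs t' α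
  hActs-cong []       e α = e α
  hActs-cong (r ∷ rs) e α = hAct-cong r (hActs-cong rs e) α

  hActs-* : ∀ {n m} (rs : Vec ℕ m) c (t : Weights n) α → hActs rs (λ β → c * t β) α ≈ c * hActs rs t α
  hActs-* []       c t α = refl
  hActs-* (r ∷ rs) c t α = trans (hAct-cong r (hActs-* rs c t) α) (hAct-* r c _ α)

  hActs-∷ʳ : ∀ {n m} (xs : Vec ℕ m) r (t : Weights n) α → hActs (xs ∷ʳ r) t α ≈ hActs xs (hAct r t) α
  hActs-∷ʳ []       r t α = refl
  hActs-∷ʳ (x ∷ xs) r t α = hAct-cong x (hActs-∷ʳ xs r t) α

  Alt-hActs : ∀ {n m} (rs : Vec ℕ m) {t : Weights n} → Alt t → Alt (hActs rs t)
  Alt-hActs []       A = A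
  Alt-hActs (r ∷ rs) A = Alt-hAct r (Alt-hActs rs A)

  Alt-init : ∀ {n} z {t : Weights (suc n)} → Alt t → Alt (λ α → t (α ∷ʳ z))
  Alt-init {zero}        z A = tt
  Alt-init {suc zero}    z A = tt
  Alt-init {suc (suc n)} z {t} (A , Z , B) = (λ a b α → A a b (α ∷ʳ z)) , (λ a α → Z a (α ∷ʳ z)) , (λ a → Alt-init z {λ α → t (a ∷ α)} (B a))

  data TrailingZeros (q : ℕ) : ∀ {n} → Vec ℤ n → Set where
    exact : TrailingZeros q (zeros q)
    skip  : ∀ {n a} {α : Vec ℤ n} → TrailingZeros q α → TrailingZeros q (a ∷ α)

  zeros-∷ʳ : ∀ n → zeros n ∷ʳ + 0 ≡ zeros (suc n)
  zeros-∷ʳ zero    = ≡.refl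
  zeros-∷ʳ (suc n) = ≡.cong (+ 0 ∷_) (zeros-∷ʳ n)

  -- With at least q+1 trailing zeros, one application of hAct touches only the first of them, so the last variable is idle.
  hAct-drop : ∀ {n q} r {T : Weights (suc n)} {T' : Weights n} → Alt T → Alt T' →
              (∀ {β} → TrailingZeros q β → T (β ∷ʳ + 0) ≈ T' β) →
              ∀ {α} → TrailingZeros (suc q) α → hAct r T (α ∷ʳ + 0) ≈ hAct r T' α
  hAct-drop {q = q} r {T} {T'} A A' e exact = begin
    hAct r T (zeros (suc q) ∷ʳ + 0)  ≈⟨ reflexive (≡.cong (hAct r T) (zeros-∷ʳ (suc q))) ⟩
    hAct r T (zeros (suc (suc q)))   ≈⟨ hAct-zeros r A ⟩
    T (+ r ∷ zeros (suc q))          ≈⟨ reflexive (≡.cong (λ z → T (+ r ∷ z)) (zeros-∷ʳ q)) ⟨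
    T (+ r ∷ (zeros q ∷ʳ + 0))       ≈⟨ e (skip exact) ⟩
    T' (+ r ∷ zeros q)               ≈⟨ hAct-zeros r A' ⟨
    hAct r T' (zeros (suc q))        ∎
  hAct-drop {suc zero}    r {T} {T'} A A' e (skip ())
  hAct-drop {suc (suc n)} r {T} {T'} (_ , _ , B) (_ , _ , B') e {a ∷ α} (skip z) = begin
    hAct r T (a ∷ (α ∷ʳ + 0))                                            ≈⟨ hAct-∷ r T a _ ⟩
    ∑ᵃ r (λ g h → hAct h (λ β → T ((a ℤ.+ + g) ∷ β)) (α ∷ʳ + 0))        ≈⟨ ∑ᵃ-cong r (λ g h → hAct-drop h (B _) (B' _) (λ w → e (skip w)) z) ⟩
    ∑ᵃ r (λ g h → hAct h (λ β → T' ((a ℤ.+ + g) ∷ β)) α)                ≈⟨ hAct-∷ r T' a α ⟨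
    hAct r T' (a ∷ α) ∎

  -- Every operator fills at most one more trailing zero. An index with as many trailing zeros as
  -- there are operators therefore keeps them from reaching the zero appended to it.
  hActs-drop : ∀ {n q} (rs : Vec ℕ q) {t : Weights (suc n)} → Alt t → ∀ {α} → TrailingZeros q α →
               hActs rs t (α ∷ʳ + 0) ≈ hActs rs (λ β → t (β ∷ʳ + 0)) α
  hActs-drop []       A z = refl
  hActs-drop (r ∷ rs) A z = hAct-drop r (Alt-hActs rs A) (Alt-hActs rs (Alt-init (+ 0) A)) (hActs-drop rs A) z

negative : ∀ a b → a < b → + a ℤ.- + b ≡ -[1+ ℕ.pred (b ∸ a) ]
negative a b a<b = ≡.trans (ℤₚ.m-n≡m⊖n a b) (≡.trans (ℤₚ.⊖-< a<b) (neg (b ∸ a) (ℕₚ.m<n⇒0<n∸m a<b)))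
  where
  neg : ∀ d → 0 < d → ℤ.- + d ≡ -[1+ ℕ.pred d ]
  neg (suc d) _ = ≡.refl

module SchurDeterminants (R : CommutativeRing 0ℓ 0ℓ) (gen : ℕ → CommutativeRing.Carrier R) where
  open CommutativeRing R hiding (zero)
  open Sums R
  open Determinants R
  open Antidiagonal R
  open CompleteAction R
  open Relation.Binary.Reasoning.Setoid setoid

  h : ℤ → Carrier
  h = Defs.Ring.hZ R gen

  s : ∀ {n} → Weights n
  s α = Det (λ a b → h ((lookup α a ℤ.- + toℕ a) ℤ.+ + toℕ b))

  -- An argument moved to the next row and increased by one gives the same row. This turns
  -- exchanging two rows into the shifted antisymmetry `Alt`, and, not being tied to the entries h,
  -- it passes to minors in the induction of `Alt-Det`.
  Shifted : ∀ {n m} → (Fin n → ℤ → Fin m → Carrier) → Set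
  Shifted {n} E = ∀ (i j : Fin n) → toℕ j ≡ suc (toℕ i) → ∀ z b → E i z b ≈ E j (ℤ.suc z) b

  Alt-Det : ∀ {n} (E : Fin n → ℤ → Fin n → Carrier) → Shifted E → Alt (λ α → Det (λ a b → E a (lookup α a) b))
  Alt-Det {zero}        E S = tt
  Alt-Det {suc zero}    E S = tt
  Alt-Det {suc (suc n)} E S =
      (λ a b α → trans (+-cong (Det-cong (λ { zero c → refl ; (suc zero) c → sym (S zero (suc zero) ≡.refl b c) ; (suc (suc i)) c → refl }))
                               (Det-cong (λ { zero c → refl ; (suc zero) c → sym (S zero (suc zero) ≡.refl a c) ; (suc (suc i)) c → refl })))
                       (Det-swap01 (E zero a) (E zero b) (λ i → E (suc (suc i)) (lookup α i))))
    , (λ a α → trans (Det-cong (λ { zero c → refl ; (suc zero) c → sym (S zero (suc zero) ≡.refl a c) ; (suc (suc i)) c → refl }))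
                     (Det-rows01 (E zero a) (λ i → E (suc (suc i)) (lookup α i))))
    , (λ a → Alt-cong (λ α → sym (Det-suc (λ i b → E i (lookup (a ∷ α) i) b)))
        (Alt-altΣ (λ j → Alt-* (E zero a j) (Alt-Det (λ i z b → E (suc i) z (punchIn j b))
          (λ i i' p z b → S (suc i) (suc i') (≡.cong suc p) z (punchIn j b))))))

  Alt-s : ∀ {n} → Alt (s {n})
  Alt-s = Alt-Det (λ a z b → h ((z ℤ.- + toℕ a) ℤ.+ + toℕ b)) (λ i j p z b →
    reflexive (≡.cong (λ w → h (w ℤ.+ + toℕ b)) (≡.trans (shift z (+ toℕ i)) (≡.cong (λ w → ℤ.suc z ℤ.- + w) (≡.sym p)))))
    where
    shift : ∀ z i → z ℤ.- i ≡ ℤ.suc z ℤ.- (+ 1 ℤ.+ i)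
    shift = ℤS.solve 2 (λ z i → z ℤS.:- i ℤS.:= (ℤS.con (+ 1) ℤS.:+ z) ℤS.:- (ℤS.con (+ 1) ℤS.:+ i)) ≡.refl

  private
    module P = CommutativeRing PowerSeries
    module PD = Determinants PowerSeries

  coefficient-altΣ : ∀ {m} (f : Fin m → ℕ → Carrier) r → PD.altΣ f r ≈ altΣ (λ i → f i r)
  coefficient-altΣ {zero}  f r = trans (PD.altΣ-nil f r) (sym (altΣ-nil _))
  coefficient-altΣ {suc m} f r = trans (PD.altΣ-suc f r) (trans (+-congˡ (-‿cong (coefficient-altΣ (λ i → f (suc i)) r))) (sym (altΣ-suc _)))

  -- Row a of the matrix is the generating series of the rows with argument a raised by g. A
  -- determinant is linear in each row, so its coefficient of u^r collects all ways of raising the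
  -- arguments by r in total.
  coefficient-Det : ∀ {n} (E : Fin n → ℤ → Fin n → Carrier) α r →
                    PD.Det (λ a b g → E a (lookup α a ℤ.+ + g) b) r ≈ hAct r (λ α → Det (λ a b → E a (lookup α a) b)) α
  coefficient-Det E []      zero    = trans (PD.Det-nil _ 0) (sym (Det-nil _))
  coefficient-Det E []      (suc r) = PD.Det-nil _ (suc r)
  coefficient-Det {suc n} E (a ∷ α) r = begin
    PD.Det (λ i b g → E i (lookup (a ∷ α) i ℤ.+ + g) b) r
      ≈⟨ PD.Det-suc _ r ⟩
    PD.altΣ (λ j → (λ g → E zero (a ℤ.+ + g) j) P.* PD.Det (λ i b g → E (suc i) (lookup α i ℤ.+ + g) (punchIn j b))) r
      ≈⟨ coefficient-altΣ _ r ⟩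
    altΣ (λ j → ∑ᵃ r (λ g m → E zero (a ℤ.+ + g) j * PD.Det (λ i b g → E (suc i) (lookup α i ℤ.+ + g) (punchIn j b)) m))
      ≈⟨ altΣ-cong (λ j → ∑ᵃ-cong r (λ g m → *-congˡ (coefficient-Det (λ i z b → E (suc i) z (punchIn j b)) α m))) ⟩
    altΣ (λ j → ∑ᵃ r (λ g m → E zero (a ℤ.+ + g) j * hAct m (D j) α))
      ≈⟨ altΣ-∑ (antidiagonal r) _ ⟩
    ∑ᵃ r (λ g m → altΣ (λ j → E zero (a ℤ.+ + g) j * hAct m (D j) α))
      ≈⟨ ∑ᵃ-cong r (λ g m → trans (hAct-altΣ m _ α) (altΣ-cong (λ j → hAct-* m _ _ α))) ⟨
    ∑ᵃ r (λ g m → hAct m (λ β → altΣ (λ j → E zero (a ℤ.+ + g) j * D j β)) α)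
      ≈⟨ ∑ᵃ-cong r (λ g m → hAct-cong m (λ β → Det-suc (λ i b → E i (lookup ((a ℤ.+ + g) ∷ β) i) b)) α) ⟨
    ∑ᵃ r (λ g m → hAct m (λ β → Det (λ i b → E i (lookup ((a ℤ.+ + g) ∷ β) i) b)) α)
      ≈⟨ hAct-∷ r _ a α ⟨
    hAct r (λ α → Det (λ i b → E i (lookup α i) b)) (a ∷ α) ∎
    where
    D : Fin (suc n) → Weights n
    D j β = Det (λ i b → E (suc i) (lookup β i) (punchIn j b))

  const : Carrier → ℕ → Carrier
  const c zero    = c
  const c (suc _) = 0#

  *-const : ∀ f c r → (f P.* const c) r ≈ f r * c
  *-const f c zero    = +-identityʳ _
  *-const f c (suc r) = trans (∑ᵃ-snoc r _) (trans (+-congʳ (∑-zero (antidiagonal r) (λ _ → zeroʳ _))) (+-identityˡ _))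

  const-* : ∀ a b r → (const a P.* const b) r ≈ const (a * b) r
  const-* a b zero    = *-const (const a) b 0
  const-* a b (suc r) = trans (*-const (const a) b (suc r)) (zeroˡ b)

  const-altΣ : ∀ {m} (f : Fin m → Carrier) r → PD.altΣ (λ i → const (f i)) r ≈ const (altΣ f) r
  const-altΣ f zero    = coefficient-altΣ _ 0
  const-altΣ f (suc r) = trans (coefficient-altΣ _ (suc r)) (altΣ-0 _)

  const-cong : ∀ {a b} → a ≈ b → ∀ r → const a r ≈ const b r
  const-cong e zero    = e
  const-cong e (suc r) = refl

  const-Det : ∀ {n} (M : Matrix n) r → PD.Det (λ a b → const (M a b)) r ≈ const (Det M) r
  const-Det {zero}  M r = trans (PD.Det-nil _ r) (P.trans one (const-cong (sym (Det-nil M))) r)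
    where
    one : ∀ r → P.1# r ≈ const 1# r
    one zero    = refl
    one (suc r) = refl
  const-Det {suc n} M r = trans (PD.Det-suc _ r) (P.trans (PD.altΣ-cong (λ j →
      P.trans (P.*-congˡ (const-Det (λ a b → M (suc a) (punchIn j b)))) (const-* _ _)))
    (P.trans (const-altΣ _) (const-cong (sym (Det-suc M)))) r)

  indeterminate : ℕ → Carrier
  indeterminate zero          = 0#
  indeterminate (suc zero)    = 1#
  indeterminate (suc (suc n)) = 0#

  indeterminate-* : ∀ f r → (indeterminate P.* f) (suc r) ≈ f r
  indeterminate-* f r = trans (∑ᵃ-suc r _) (trans (+-congʳ (zeroˡ _)) (trans (+-identityˡ _) (go r)))
    where
    go : ∀ r → ∑ᵃ r (λ a b → indeterminate (suc a) * f b) ≈ f r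
    go zero    = trans (+-identityʳ _) (*-identityˡ _)
    go (suc r) = trans (∑ᵃ-suc r _) (trans (+-cong (*-identityˡ _) (∑-zero (antidiagonal r) (λ _ → zeroˡ _))) (+-identityʳ _))

  -- Summing h_{z+b+g} u^g over g and subtracting u times the next column leaves every column but the last constant.
  pieri : ∀ {n} r (β : Vec ℤ n) → hAct r s (β ∷ʳ + 0) ≈ h (+ r) * s β
  pieri {n} r β = begin
    hAct r s α                                              ≈⟨ coefficient-Det (λ a z b → h ((z ℤ.- + toℕ a) ℤ.+ + toℕ b)) α r ⟨
    PD.Det G r                                              ≈⟨ PD.Det-transpose G r ⟩
    PD.Det (λ a b → G b a) r                                ≈⟨ PD.Det-sub-next (λ a b → G b a) (λ a b → G' b a) (λ _ → indeterminate) last-col col r ⟨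
    PD.Det (λ a b → G' b a) r                               ≈⟨ PD.Det-transpose G' r ⟨
    PD.Det G' r                                             ≈⟨ PD.Det-last-row G' last-row r ⟩
    (G' (fromℕ n) (fromℕ n) P.* PD.Det (λ a b → G' (inject₁ a) (inject₁ b))) r
      ≈⟨ P.*-cong corner (P.trans (PD.Det-cong block) (const-Det _)) r ⟩
    ((λ g → h (+ g)) P.* const (s β)) r                     ≈⟨ *-const _ (s β) r ⟩
    h (+ r) * s β                                           ∎
    where
    α = β ∷ʳ + 0
    G : Fin (suc n) → Fin (suc n) → ℕ → Carrier
    G a b g = h (((lookup α a ℤ.+ + g) ℤ.- + toℕ a) ℤ.+ + toℕ b)
    open Top using (view; ‵fromℕ; ‵inject₁)
    G'-col : Fin (suc n) → ∀ {b : Fin (suc n)} → Top.View b → ℕ → Carrier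
    G'-col a ‵fromℕ         = G a (fromℕ n)
    G'-col a (‵inject₁ b)   = const (G a (inject₁ b) 0)
    G' : Fin (suc n) → Fin (suc n) → ℕ → Carrier
    G' a b = G'-col a (view b)
    G'-last : ∀ a → G' a (fromℕ n) ≡ G a (fromℕ n)
    G'-last a rewrite Top.view-fromℕ n = ≡.refl
    G'-inject : ∀ a b → G' a (inject₁ b) ≡ const (G a (inject₁ b) 0)
    G'-inject a b rewrite Top.view-inject₁ b = ≡.refl
    last-col : ∀ a g → G' a (fromℕ n) g ≈ G a (fromℕ n) g
    last-col a g = reflexive (≡.cong (λ f → f g) (G'-last a))
    step : ∀ z a g b → ((z ℤ.+ (+ 1 ℤ.+ g)) ℤ.- a) ℤ.+ b ≡ ((z ℤ.+ g) ℤ.- a) ℤ.+ (+ 1 ℤ.+ b)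
    step = ℤS.solve 4 (λ z a g b → ((z ℤS.:+ (ℤS.con (+ 1) ℤS.:+ g)) ℤS.:- a) ℤS.:+ b ℤS.:= ((z ℤS.:+ g) ℤS.:- a) ℤS.:+ (ℤS.con (+ 1) ℤS.:+ b)) ≡.refl
    col : ∀ b a g → G' a (inject₁ b) g ≈ G a (inject₁ b) g - (indeterminate P.* G a (suc b)) g
    col b a zero    = trans (reflexive (≡.cong (λ f → f 0) (G'-inject a b))) (sym (trans (+-congˡ (trans (-‿cong (trans (+-identityʳ _) (zeroˡ _))) -0#≈0#)) (+-identityʳ _)))
    col b a (suc g) = trans (reflexive (≡.cong (λ f → f (suc g)) (G'-inject a b))) (sym (trans (+-congˡ (-‿cong (indeterminate-* _ g)))
      (trans (+-congʳ (reflexive (≡.cong h (≡.trans (step (lookup α a) (+ toℕ a) (+ g) (+ toℕ (inject₁ b)))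
        (≡.cong (λ w → ((lookup α a ℤ.+ + g) ℤ.- + toℕ a) ℤ.+ + suc w) (Finₚ.toℕ-inject₁ b)))))) (-‿inverseʳ _))))
    lookup-last : ∀ {n} (β : Vec ℤ n) z → lookup (β ∷ʳ z) (fromℕ n) ≡ z
    lookup-last []      z = ≡.refl
    lookup-last (_ ∷ β) z = lookup-last β z
    lookup-init : ∀ {n} (β : Vec ℤ n) z i → lookup (β ∷ʳ z) (inject₁ i) ≡ lookup β i
    lookup-init (_ ∷ β) z zero    = ≡.refl
    lookup-init (_ ∷ β) z (suc i) = lookup-init β z i
    -- The last argument is 0 and sits in row n, so the constant term in column b < n is h with the
    -- negative index b - n.
    last-row : ∀ b g → G' (fromℕ n) (inject₁ b) g ≈ 0#
    last-row b (suc g) = reflexive (≡.cong (λ f → f (suc g)) (G'-inject (fromℕ n) b))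
    last-row b zero    = trans (reflexive (≡.cong (λ f → f 0) (G'-inject (fromℕ n) b)))
      (trans (reflexive (≡.cong₂ (λ x y → h ((x ℤ.- + y) ℤ.+ + toℕ (inject₁ b))) (≡.trans (ℤₚ.+-identityʳ _) (lookup-last β (+ 0))) (Finₚ.toℕ-fromℕ n)))
        (reflexive (≡.cong h (≡.trans (ℤS.solve 2 (λ m b → (ℤS.con (+ 0) ℤS.:- m) ℤS.:+ b ℤS.:= b ℤS.:- m) ≡.refl (+ n) (+ toℕ (inject₁ b)))
          (negative _ n (≡.subst (ℕ._< n) (≡.sym (Finₚ.toℕ-inject₁ b)) (Finₚ.toℕ<n b)))))))
    corner : ∀ g → G' (fromℕ n) (fromℕ n) g ≈ h (+ g)
    corner g = trans (last-col (fromℕ n) g) (reflexive (≡.trans (≡.cong (λ w → h (((w ℤ.+ + g) ℤ.- + toℕ (fromℕ n)) ℤ.+ + toℕ (fromℕ n))) (lookup-last β (+ 0)))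
      (≡.cong h (cancel (+ g) (+ toℕ (fromℕ n))))))
      where
      cancel : ∀ g a → ((+ 0 ℤ.+ g) ℤ.- a) ℤ.+ a ≡ g
      cancel = ℤS.solve 2 (λ g a → ((ℤS.con (+ 0) ℤS.:+ g) ℤS.:- a) ℤS.:+ a ℤS.:= g) ≡.refl
    block : ∀ a b g → G' (inject₁ a) (inject₁ b) g ≈ const (h ((lookup β a ℤ.- + toℕ a) ℤ.+ + toℕ b)) g
    block a b g = trans (reflexive (≡.cong (λ f → f g) (G'-inject (inject₁ a) b)))
      (const-cong (reflexive (≡.cong h (≡.cong₂ ℤ._+_ (≡.cong₂ ℤ._-_ (≡.trans (ℤₚ.+-identityʳ _) (lookup-init β (+ 0) a)) (≡.cong +_ (Finₚ.toℕ-inject₁ a))) (≡.cong +_ (Finₚ.toℕ-inject₁ b))))) g)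

  ∏h : ∀ {n} → Vec ℕ n → Carrier
  ∏h []       = 1#
  ∏h (r ∷ rs) = h (+ r) * ∏h rs

  ∏h-∷ʳ : ∀ {m} (xs : Vec ℕ m) r → ∏h (xs ∷ʳ r) ≈ ∏h xs * h (+ r)
  ∏h-∷ʳ []       r = trans (*-identityʳ _) (sym (*-identityˡ _))
  ∏h-∷ʳ (x ∷ xs) r = trans (*-congˡ (∏h-∷ʳ xs r)) (sym (*-assoc _ _ _))

  -- The innermost operator acts first: `pieri` makes it the factor h_r and frees the last row,
  -- provided that the other operators do not touch that row, which is `hActs-drop`. There remain n
  -- - 1 operators on n - 1 rows.
  hActs-s : ∀ {n} (rs : Vec ℕ n) → hActs rs s (zeros n) ≈ ∏h rs
  hActs-s {zero}  []       = Det-nil _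
  hActs-s {suc n} rs with Vec.initLast rs
  ... | rs' , r , ≡.refl = begin
    hActs (rs' ∷ʳ r) s (zeros (suc n))                   ≈⟨ reflexive (≡.cong (hActs (rs' ∷ʳ r) s) (zeros-∷ʳ n)) ⟨
    hActs (rs' ∷ʳ r) s (zeros n ∷ʳ + 0)                  ≈⟨ hActs-∷ʳ rs' r s (zeros n ∷ʳ + 0) ⟩
    hActs rs' (hAct r s) (zeros n ∷ʳ + 0)                ≈⟨ hActs-drop rs' (Alt-hAct r Alt-s) exact ⟩
    hActs rs' (λ β → hAct r s (β ∷ʳ + 0)) (zeros n)      ≈⟨ hActs-cong rs' (pieri r) (zeros n) ⟩
    hActs rs' (λ β → h (+ r) * s β) (zeros n)            ≈⟨ hActs-* rs' (h (+ r)) s (zeros n) ⟩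
    h (+ r) * hActs rs' s (zeros n)                      ≈⟨ trans (*-congˡ (hActs-s rs')) (*-comm _ _) ⟩
    ∏h rs' * h (+ r)                                     ≈⟨ ∏h-∷ʳ rs' r ⟨
    ∏h (rs' ∷ʳ r)                                        ∎

-- Operators on weights

module CompleteSymmetric (B : CommutativeRing 0ℓ 0ℓ) where
  open CommutativeRing B using (Carrier; 0#; 1#; _+_; _*_)

  complete : ∀ {v} → Vec Carrier v → ℕ → Carrier
  complete []       zero    = 1#
  complete []       (suc r) = 0#
  complete (x ∷ xs) zero    = 1#
  complete (x ∷ xs) (suc r) = complete xs (suc r) + x * complete (x ∷ xs) r

  completeℤ : ∀ {v} → Vec Carrier v → ℤ → Carrier
  completeℤ xs = Defs.Ring.hZ B (λ r → complete xs (suc r))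

-- Syntax instead of arbitrary endomorphisms of functions on integer vectors: operators of this form
-- are additive and commute with each other, and both facts are inductions on the expression.
data Expr (n : ℕ) : Set where
  var       : Fin n → Expr n
  𝟘 𝟙       : Expr n
  _⊕_ _⊗_   : Expr n → Expr n → Expr n
  ⊖_        : Expr n → Expr n

wk : ∀ {n} → Expr n → Expr (suc n)
wk (var i) = var (suc i)
wk 𝟘       = 𝟘
wk 𝟙       = 𝟙
wk (e ⊕ f) = wk e ⊕ wk f
wk (e ⊗ f) = wk e ⊗ wk f
wk (⊖ e)   = ⊖ wk e

raise : ∀ {n} → Fin n → Vec ℤ n → Vec ℤ n
raise zero    (a ∷ α) = (a ℤ.+ + 1) ∷ α
raise (suc i) (a ∷ α) = a ∷ raise i α

raise-comm : ∀ {n} (i j : Fin n) α → raise i (raise j α) ≡ raise j (raise i α)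
raise-comm zero    zero    (a ∷ α) = ≡.refl
raise-comm zero    (suc j) (a ∷ α) = ≡.refl
raise-comm (suc i) zero    (a ∷ α) = ≡.refl
raise-comm (suc i) (suc j) (a ∷ α) = ≡.cong (a ∷_) (raise-comm i j α)

vars : ∀ n → Vec (Expr n) n
vars zero    = []
vars (suc n) = var zero ∷ Vec.map wk (vars n)

-- Polynomials in commuting raising operators, acting on functions of n integers.
module Operators (R : CommutativeRing 0ℓ 0ℓ) where
  open CommutativeRing R hiding (zero)
  open Sums R
  open Antidiagonal R
  open CompleteAction R
  open Relation.Binary.Reasoning.Setoid setoid

  act : ∀ {n} → Expr n → Weights n → Weights n
  act (var i) t α = t (raise i α)
  act 𝟘       t α = 0#
  act 𝟙       t α = t α
  act (e ⊕ f) t α = act e t α + act f t α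
  act (e ⊗ f) t α = act e (act f t) α
  act (⊖ e)   t α = - act e t α

  act-cong : ∀ {n} (e : Expr n) {t t' : Weights n} → (∀ α → t α ≈ t' α) → ∀ α → act e t α ≈ act e t' α
  act-cong (var i) p α = p _
  act-cong 𝟘       p α = refl
  act-cong 𝟙       p α = p α
  act-cong (e ⊕ f) p α = +-cong (act-cong e p α) (act-cong f p α)
  act-cong (e ⊗ f) p α = act-cong e (act-cong f p) α
  act-cong (⊖ e)   p α = -‿cong (act-cong e p α)

  act-+ : ∀ {n} (e : Expr n) (t t' : Weights n) α → act e (λ β → t β + t' β) α ≈ act e t α + act e t' α
  act-+ (var i) t t' α = refl
  act-+ 𝟘       t t' α = sym (+-identityˡ 0#)
  act-+ 𝟙       t t' α = refl
  act-+ (e ⊕ f) t t' α = trans (+-cong (act-+ e t t' α) (act-+ f t t' α)) (+-interchange _ _ _ _)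
  act-+ (e ⊗ f) t t' α = trans (act-cong e (act-+ f t t') α) (act-+ e _ _ α)
  act-+ (⊖ e)   t t' α = trans (-‿cong (act-+ e t t' α)) (sym (-‿+-comm _ _))

  act-0 : ∀ {n} (e : Expr n) α → act e (λ _ → 0#) α ≈ 0#
  act-0 (var i) α = refl
  act-0 𝟘       α = refl
  act-0 𝟙       α = refl
  act-0 (e ⊕ f) α = trans (+-cong (act-0 e α) (act-0 f α)) (+-identityˡ 0#)
  act-0 (e ⊗ f) α = trans (act-cong e (act-0 f) α) (act-0 e α)
  act-0 (⊖ e)   α = trans (-‿cong (act-0 e α)) -0#≈0#

  act-neg : ∀ {n} (e : Expr n) (t : Weights n) α → act e (λ β → - t β) α ≈ - act e t α
  act-neg e t α = neg-unique (trans (sym (act-+ e _ t α)) (trans (act-cong e (λ β → -‿inverseˡ _) α) (act-0 e α)))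

  var-comm : ∀ {n} i (e : Expr n) t α → act e t (raise i α) ≈ act e (λ β → t (raise i β)) α
  var-comm i (var j) t α = reflexive (≡.cong t (raise-comm j i α))
  var-comm i 𝟘       t α = refl
  var-comm i 𝟙       t α = refl
  var-comm i (e ⊕ f) t α = +-cong (var-comm i e t α) (var-comm i f t α)
  var-comm i (e ⊗ f) t α = trans (var-comm i e (act f t) α) (act-cong e (var-comm i f t) α)
  var-comm i (⊖ e)   t α = -‿cong (var-comm i e t α)

  act-comm : ∀ {n} (e f : Expr n) t α → act e (act f t) α ≈ act f (act e t) α
  act-comm (var i) f t α = var-comm i f t α
  act-comm 𝟘       f t α = sym (act-0 f α)
  act-comm 𝟙       f t α = refl
  act-comm (e ⊕ g) f t α = trans (+-cong (act-comm e f t α) (act-comm g f t α)) (sym (act-+ f _ _ α))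
  act-comm (e ⊗ g) f t α = trans (act-cong e (act-comm g f t) α) (act-comm e f (act g t) α)
  act-comm (⊖ e)   f t α = trans (-‿cong (act-comm e f t α)) (sym (act-neg f _ α))

  -- Expressions are equal when they act equally on everything. A polynomial identity valid in all
  -- commutative rings can thus be instantiated here and applied to `s`.
  record _≋_ {n} (e f : Expr n) : Set where
    constructor pointwise
    field at : ∀ t α → act e t α ≈ act f t α
  open _≋_ public

  OperatorRing : ℕ → CommutativeRing 0ℓ 0ℓ
  OperatorRing n = record
    { Carrier = Expr n
    ; _≈_ = _≋_
    ; _+_ = _⊕_ ; _*_ = _⊗_ ; -_ = ⊖_ ; 0# = 𝟘 ; 1# = 𝟙
    ; isCommutativeRing = record
      { isRing = record
        { +-isAbelianGroup = record
          { isGroup = record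
            { isMonoid = record
              { isSemigroup = record
                { isMagma = record
                  { isEquivalence = record
                    { refl  = pointwise λ t α → refl
                    ; sym   = λ p → pointwise λ t α → sym (at p t α)
                    ; trans = λ p q → pointwise λ t α → trans (at p t α) (at q t α) }
                  ; ∙-cong = λ p q → pointwise λ t α → +-cong (at p t α) (at q t α) }
                ; assoc = λ _ _ _ → pointwise λ t α → +-assoc _ _ _ }
              ; identity = (λ _ → pointwise λ t α → +-identityˡ _) , (λ _ → pointwise λ t α → +-identityʳ _) }
            ; inverse = (λ _ → pointwise λ t α → -‿inverseˡ _) , (λ _ → pointwise λ t α → -‿inverseʳ _)
            ; ⁻¹-cong = λ p → pointwise λ t α → -‿cong (at p t α) }
          ; comm = λ _ _ → pointwise λ t α → +-comm _ _ }
        ; *-cong = λ {e} {e'} {f} {f'} p q → pointwise λ t α → trans (at p (act f t) α) (act-cong e' (at q t) α)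
        ; *-assoc = λ _ _ _ → pointwise λ t α → refl
        ; *-identity = (λ _ → pointwise λ t α → refl) , (λ _ → pointwise λ t α → refl)
        ; distrib = (λ e _ _ → pointwise λ t α → act-+ e _ _ α) , (λ _ _ _ → pointwise λ t α → refl)
        }
      ; *-comm = λ e f → pointwise λ t α → act-comm e f t α
      }
    }

  act-wk : ∀ {n} (e : Expr n) t a α → act (wk e) t (a ∷ α) ≈ act e (λ β → t (a ∷ β)) α
  act-wk (var i) t a α = refl
  act-wk 𝟘       t a α = refl
  act-wk 𝟙       t a α = refl
  act-wk (e ⊕ f) t a α = +-cong (act-wk e t a α) (act-wk f t a α)
  act-wk (e ⊗ f) t a α = trans (act-wk e (act (wk f) t) a α) (act-cong e (act-wk f t a) α)
  act-wk (⊖ e)   t a α = -‿cong (act-wk e t a α)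

  module _ {n : ℕ} where
    open CompleteSymmetric (OperatorRing n) public

  complete-wk : ∀ {n v} (xs : Vec (Expr n) v) r → complete (Vec.map wk xs) r ≡ wk (complete xs r)
  complete-wk []       zero    = ≡.refl
  complete-wk []       (suc r) = ≡.refl
  complete-wk (x ∷ xs) zero    = ≡.refl
  complete-wk (x ∷ xs) (suc r) = ≡.cong₂ (λ y z → y ⊕ (wk x ⊗ z)) (complete-wk xs (suc r)) (complete-wk (x ∷ xs) r)

  complete-zero : ∀ {n v} (xs : Vec (Expr n) v) → complete xs 0 ≡ 𝟙
  complete-zero []       = ≡.refl
  complete-zero (x ∷ xs) = ≡.refl

  -- The recursion of `complete` separates the monomials free of the first variable from those
  -- divisible by it. For `hAct` these are the term g = 0 and the terms g > 0.
  act-complete : ∀ n r t α → act (complete (vars n) r) t α ≈ hAct r t α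
  act-complete zero    zero    t [] = refl
  act-complete zero    (suc r) t [] = refl
  act-complete (suc n) zero    t (a ∷ α) = begin
    t (a ∷ α)                                    ≈⟨ reflexive (≡.cong (λ z → t (z ∷ α)) (≡.sym (ℤₚ.+-identityʳ a))) ⟩
    t ((a ℤ.+ + 0) ∷ α)                          ≈⟨ reflexive (≡.cong (λ e → act e (λ β → t ((a ℤ.+ + 0) ∷ β)) α) (complete-zero (vars n))) ⟨
    act (complete (vars n) 0) (λ β → t ((a ℤ.+ + 0) ∷ β)) α  ≈⟨ act-complete n 0 _ α ⟩
    hAct 0 (λ β → t ((a ℤ.+ + 0) ∷ β)) α         ≈⟨ +-identityʳ _ ⟨
    hAct 0 t (a ∷ α)                             ∎
  act-complete (suc n) (suc r) t (a ∷ α) = begin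
    act (complete (Vec.map wk (vars n)) (suc r)) t (a ∷ α) + act (complete (vars (suc n)) r) t ((a ℤ.+ + 1) ∷ α)
      ≈⟨ +-cong (trans (reflexive (≡.cong (λ e → act e t (a ∷ α)) (complete-wk (vars n) (suc r))))
                  (trans (act-wk (complete (vars n) (suc r)) t a α) (act-complete n (suc r) _ α)))
                (act-complete (suc n) r t _) ⟩
    hAct (suc r) (λ β → t (a ∷ β)) α + hAct r t ((a ℤ.+ + 1) ∷ α)
      ≈⟨ +-cong (hAct-cong (suc r) (λ β → reflexive (≡.cong (λ z → t (z ∷ β)) (≡.sym (ℤₚ.+-identityʳ a)))) α)
           (trans (hAct-∷ r t _ α) (∑ᵃ-cong r (λ g m → hAct-cong m (λ β → reflexive (≡.cong (λ z → t (z ∷ β)) (ℤₚ.+-assoc a (+ 1) (+ g)))) α))) ⟩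
    hAct (suc r) (λ β → t ((a ℤ.+ + 0) ∷ β)) α + ∑ᵃ r (λ g m → hAct m (λ β → t ((a ℤ.+ + suc g) ∷ β)) α)
      ≈⟨ ∑ᵃ-suc r _ ⟨
    hAct (suc r) t (a ∷ α) ∎

-- Evaluating polynomials in the operators on Schur determinants

module Evaluation (R : CommutativeRing 0ℓ 0ℓ) (gen : ℕ → CommutativeRing.Carrier R) (N : ℕ) where
  open CommutativeRing R hiding (zero)
  open Sums R
  open Determinants R
  open CompleteAction R
  open SchurDeterminants R gen
  open Operators R
  open Relation.Binary.Reasoning.Setoid setoid
  private
    module A  = CommutativeRing (OperatorRing N)
    module AD = Determinants (OperatorRing N)

  hA : ℤ → Expr N
  hA = completeℤ (vars N)

  act-hA : ∀ r t α → act (hA (+ r)) t α ≈ hAct r t α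
  act-hA zero    t α = trans (reflexive (≡.cong (λ e → act e t α) (≡.sym (complete-zero (vars N))))) (act-complete N 0 t α)
  act-hA (suc r) t α = act-complete N (suc r) t α

  hActs-0 : ∀ {n m} (xs : Vec ℕ m) (α : Vec ℤ n) → hActs xs (λ _ → 0#) α ≈ 0#
  hActs-0 []       α = refl
  hActs-0 (x ∷ xs) α = trans (hAct-cong x (hActs-0 xs) α) (hAct-0 x α)

  hActs-sub : ∀ {n m} (xs : Vec ℕ m) (t t' : Weights n) α → hActs xs (λ β → t β - t' β) α ≈ hActs xs t α - hActs xs t' α
  hActs-sub []       t t' α = refl
  hActs-sub (x ∷ xs) t t' α = trans (hAct-cong x (hActs-sub xs t t') α) (trans (hAct-+ x _ _ α) (+-congˡ (hAct-neg x _ α)))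

  -- e represents c with m further factors h_r still to be absorbed: at most N of them are allowed in total.
  record Represents (m : ℕ) (e : Expr N) (c : Carrier) : Set where
    constructor represents
    field absorb : ∀ (rs : Vec ℕ m) → hActs rs (act e s) (zeros N) ≈ ∏h rs * c
  open Represents

  represents-cong : ∀ {m e e' c c'} → e A.≈ e' → c ≈ c' → Represents m e c → Represents m e' c'
  represents-cong p q G = represents λ rs →
    trans (hActs-cong rs (λ α → sym (at p s α)) (zeros N)) (trans (absorb G rs) (*-congˡ q))

  represents-𝟙 : Represents N 𝟙 1#
  represents-𝟙 = represents λ rs → trans (hActs-s rs) (sym (*-identityʳ _))

  represents-0 : ∀ {m} → Represents m 𝟘 0#
  represents-0 = represents λ rs → trans (hActs-0 rs (zeros N)) (sym (zeroʳ _))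

  -- One of the open factors is spent on h_z. It is appended to `rs`, since the last operator of
  -- that list acts first. For negative z both sides are zero.
  represents-h : ∀ {m e c} z → Represents (suc m) e c → Represents m (hA z ⊗ e) (h z * c)
  represents-h {m} {e} {c} (+ r) G = represents λ rs → begin
    hActs rs (act (hA (+ r)) (act e s)) (zeros N)  ≈⟨ hActs-cong rs (act-hA r (act e s)) (zeros N) ⟩
    hActs rs (hAct r (act e s)) (zeros N)          ≈⟨ hActs-∷ʳ rs r (act e s) (zeros N) ⟨
    hActs (rs ∷ʳ r) (act e s) (zeros N)            ≈⟨ absorb G (rs ∷ʳ r) ⟩
    ∏h (rs ∷ʳ r) * c                               ≈⟨ trans (*-congʳ (∏h-∷ʳ rs r)) (*-assoc _ _ _) ⟩
    ∏h rs * (h (+ r) * c)                          ∎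
  represents-h {m} {e} {c} -[1+ r ] G = represents-cong (A.sym (A.zeroˡ e)) (sym (zeroˡ c)) represents-0

  represents-sub : ∀ {m e e' c c'} → Represents m e c → Represents m e' c' → Represents m (e ⊕ (⊖ e')) (c - c')
  represents-sub {m} {e} {e'} {c} {c'} G G' = represents λ rs → trans (hActs-sub rs (act e s) (act e' s) (zeros N))
    (trans (+-cong (absorb G rs) (trans (-‿cong (absorb G' rs)) (-‿distribʳ-* _ _))) (sym (distribˡ _ _ _)))

  represents-altΣ : ∀ {m k e c} (f : Fin k → Expr N) (f' : Fin k → Carrier) → (∀ j → Represents m (f j ⊗ e) (f' j * c)) →
                    Represents m (AD.altΣ f ⊗ e) (altΣ f' * c)
  represents-altΣ {m} {zero} {e} {c} f f' G = represents-cong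
    (A.sym (A.trans (A.*-congʳ (AD.altΣ-nil f)) (A.zeroˡ e)))
    (sym (trans (*-congʳ (altΣ-nil f')) (zeroˡ c))) represents-0
  represents-altΣ {m} {suc k} {e} {c} f f' G = represents-cong
    (A.sym (A.trans (A.*-congʳ (AD.altΣ-suc f)) (pointwise λ t α → refl)))
    (sym (trans (*-congʳ (altΣ-suc f')) (trans (distribʳ _ _ _) (+-congˡ (sym (-‿distribˡ-* _ _))))))
    (represents-sub (G zero) (represents-altΣ (λ i → f (suc i)) (λ i → f' (suc i)) (λ j → G (suc j))))

  -- Each product in the expansion of the determinant has k entries, so k of the open factors are
  -- spent.
  represents-Det : ∀ {m e c} k (Z : Fin k → Fin k → ℤ) → Represents (k ℕ.+ m) e c →
                   Represents m (AD.Det (λ a b → hA (Z a b)) ⊗ e) (Det (λ a b → h (Z a b)) * c)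
  represents-Det {m} {e} {c} zero Z G = represents-cong
    (A.sym (A.trans (A.*-congʳ (AD.Det-nil (λ a b → hA (Z a b)))) (A.*-identityˡ e)))
    (sym (trans (*-congʳ (Det-nil _)) (*-identityˡ c))) G
  represents-Det {m} {e} {c} (suc k) Z G = represents-cong
    (A.*-congʳ (A.sym (AD.Det-suc (λ a b → hA (Z a b)))))
    (*-congʳ (sym (Det-suc (λ a b → h (Z a b)))))
    (represents-altΣ _ _ (λ j → represents-cong (A.sym (A.*-assoc (hA (Z zero j)) (AD.Det (λ a b → hA (Z (suc a) (punchIn j b)))) e)) (sym (*-assoc _ _ _))
      (represents-h (Z zero j) (represents-Det k (λ a b → Z (suc a) (punchIn j b)) (≡.subst (λ q → Represents q e c) (≡.sym (ℕₚ.+-suc k m)) G)))))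

  -- Starting from 𝟙 with all N = 2k factors open, the second determinant leaves k of them open and
  -- the first one none.
  represents-Det² : ∀ k → N ≡ k ℕ.+ k → (Z Z' : Fin k → Fin k → ℤ) →
                    act (AD.Det (λ a b → hA (Z a b)) ⊗ AD.Det (λ a b → hA (Z' a b))) s (zeros N) ≈
                    Det (λ a b → h (Z a b)) * Det (λ a b → h (Z' a b))
  represents-Det² k N≡ Z Z' = trans (absorb (represents-Det {0} k Z (≡.subst (λ q → Represents q D' d') (≡.sym (ℕₚ.+-identityʳ k))
      (represents-cong (A.*-identityʳ D') (*-identityʳ d')
        (represents-Det {k} {𝟙} {1#} k Z' (≡.subst (λ q → Represents q 𝟙 1#) N≡ represents-𝟙))))) [])
    (*-identityˡ _)
    where
    D' = AD.Det (λ a b → hA (Z' a b))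
    d' = Det (λ a b → h (Z' a b))

-- Gelfand–Tsetlin patterns

-- Zig x y stands for y₀ ≥ x₀ ≥ y₁ ≥ x₁ ≥ …, where E is read as ≤.
module Interlacing {X : Set} (E : X → X → Set) where
  Below : ∀ {k} → X → Vec X k → Set
  Below x []      = ⊤
  Below x (y ∷ _) = E y x

  Zig : ∀ {k} → Vec X k → Vec X k → Set
  Zig []       []       = ⊤
  Zig (x ∷ xs) (y ∷ ys) = E x y × Below x ys × Zig xs ys

  Chain : ∀ {k n} → Vec X k → Vec X k → Vec (Vec X k) n → Set
  Chain top m []      = m ≡ top
  Chain top m (u ∷ U) = Zig m u × Chain top u U

  module Decide (E? : ∀ x y → Dec (E x y)) (_≟_ : DecidableEquality X) where
    below? : ∀ {k} x (ys : Vec X k) → Dec (Below x ys)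
    below? x []      = yes tt
    below? x (y ∷ _) = E? y x

    zig? : ∀ {k} (xs ys : Vec X k) → Dec (Zig xs ys)
    zig? []       []       = yes tt
    zig? (x ∷ xs) (y ∷ ys) = E? x y ×-dec (below? x ys ×-dec zig? xs ys)

    chain? : ∀ {k n} top (m : Vec X k) (U : Vec (Vec X k) n) → Dec (Chain top m U)
    chain? top m []      = Vecₚ.≡-dec _≟_ m top
    chain? top m (u ∷ U) = zig? m u ×-dec chain? top u U

-- The red and the blue entry at the same place. A pair of patterns becomes one pattern of pairs, in
-- which exchanging colours is a local operation.
Node : Set
Node = ℕ × ℕ

Level : ℕ → Set
Level k = Vec Node k

_≟ᴺ_ : DecidableEquality Node
_≟ᴺ_ = ≡-dec ℕ._≟_ ℕ._≟_

_⊑_ : Node → Node → Set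
u ⊑ w = proj₁ u ≤ proj₁ w × proj₂ u ≤ proj₂ w

_⊑?_ : ∀ u w → Dec (u ⊑ w)
u ⊑? w = (proj₁ u ℕ.≤? proj₁ w) ×-dec (proj₂ u ℕ.≤? proj₂ w)

module Straight = Interlacing _⊑_
open Straight.Decide _⊑?_ _≟ᴺ_ public
open Straight public using (Zig; Chain)

reds blues : ∀ {k} → Level k → Vec ℕ k
reds  = Vec.map proj₁
blues = Vec.map proj₂

∣_∣ᴺ : Node → ℕ
∣ r , b ∣ᴺ = r ℕ.+ b

∣_∣ᴸ : ∀ {k} → Level k → ℕ
∣ y ∣ᴸ = Vec.sum (Vec.map ∣_∣ᴺ y)

weight : ∀ {k n} → Level k → Vec (Level k) n → Vec ℤ n
weight m []      = []
weight m (u ∷ U) = (+ ∣ u ∣ᴸ ℤ.- + ∣ m ∣ᴸ) ∷ weight u U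

Bounded : ∀ {k} → ℕ → Level k → Set
Bounded M []            = ⊤
Bounded M ((r , b) ∷ y) = (r ≤ M × b ≤ M) × Bounded M y

nodes : ℕ → List Node
nodes M = pairs (range (suc M))

levels : ℕ → (k : ℕ) → List (Level k)
levels M k = vecs (nodes M) k

All-concatMap : {X Y : Set} {P : X → Set} {Q : Y → Set} {f : X → List Y} {xs : List X} →
              (∀ {x} → P x → All Q (f x)) → All P xs → All Q (concatMap f xs)
All-concatMap h []       = []
All-concatMap h (p ∷ ps) = Allₚ.++⁺ (h p) (All-concatMap h ps)

range-bounded : ∀ n → All (_< n) (range n)
range-bounded zero    = []
range-bounded (suc n) = s≤s z≤n ∷ Allₚ.map⁺ (All.map s≤s (range-bounded n))

nodes-bounded : ∀ M → All (λ u → proj₁ u ≤ M × proj₂ u ≤ M) (nodes M)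
nodes-bounded M = All-concatMap (λ p → Allₚ.map⁺ (All.map (λ q → ℕₚ.≤-pred p , ℕₚ.≤-pred q) (range-bounded (suc M)))) (range-bounded (suc M))

levels-bounded : ∀ M k → All (Bounded M) (levels M k)
levels-bounded M zero    = tt ∷ []
levels-bounded M (suc k) = All-concatMap (λ p → Allₚ.map⁺ (All.map (λ q → p , q) (levels-bounded M k))) (nodes-bounded M)

Decreasing≤ : ∀ {k} → Vec ℕ k → Set
Decreasing≤ {k} n = ∀ (i j : Fin k) → i Fin.< j → lookup n j ≤ lookup n i

IL : ∀ {k} → ℕ → Vec ℕ k → Vec ℕ k → Set
IL p []       []       = ⊤
IL p (m ∷ ms) (n ∷ ns) = (m ≤ n × n ≤ p) × IL m ms ns

il? : ∀ {k} p (ms ns : Vec ℕ k) → Dec (IL p ms ns)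
il? p []       []       = yes tt
il? p (m ∷ ms) (n ∷ ns) = between? m p n ×-dec il? m ms ns

diff : ∀ {k} → Vec ℕ k → Vec ℕ k → ℕ
diff []       []       = 0
diff (m ∷ ms) (n ∷ ns) = (n ∸ m) ℕ.+ diff ms ns

upper : ∀ {k} → ℕ → Vec ℕ k → Fin k → ℕ
upper p (m ∷ ms) zero    = p
upper p (m ∷ ms) (suc i) = upper m ms i

upper-suc : ∀ {k} p (m : Vec ℕ (suc k)) i → upper p m (suc i) ≡ lookup m (inject₁ i)
upper-suc p (m ∷ n ∷ ms) zero    = ≡.refl
upper-suc p (m ∷ n ∷ ms) (suc i) = upper-suc m (n ∷ ms) i

hat : ∀ {k} → (Fin k → ℕ) → Vec ℕ k
hat μ = tabulate (λ j → μ j ℕ.+ toℕ j)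

-- Equivalently, the numbers n_j - j decrease weakly. This is what holds at the bottom level, where
-- parts of ν may repeat; any further level interlaces with the one below it and is decreasing.
NearDecreasing : ∀ {k} → Vec ℕ k → Set
NearDecreasing {k} m = ∀ (i j : Fin k) → toℕ j ≡ suc (toℕ i) → lookup m j ≤ suc (lookup m i)

IL⇒Zig : ∀ {k} u (m y : Level k) → IL (proj₁ u) (reds m) (reds y) → IL (proj₂ u) (blues m) (blues y) →
         Straight.Below u y × Zig m y
IL⇒Zig u []       []       _                  _                    = tt , tt
IL⇒Zig u (m ∷ ms) (y ∷ ys) ((a , b) , il) ((a' , b') , il') =
  (b , b') , (a , a') , IL⇒Zig m ms ys il il'

Zig⇒IL : ∀ {k} u (m y : Level k) → Straight.Below u y → Zig m y →
         IL (proj₁ u) (reds m) (reds y) × IL (proj₂ u) (blues m) (blues y)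
Zig⇒IL u []       []       _        _                   = tt , tt
Zig⇒IL u (m ∷ ms) (y ∷ ys) (b , b') ((a , a') , c , z) =
  ((a , b) , proj₁ (Zig⇒IL m ms ys c z)) , ((a' , b') , proj₂ (Zig⇒IL m ms ys c z))

rise : ∀ {k} → Level k → Level k → ℕ
rise m y = diff (reds m) (reds y) ℕ.+ diff (blues m) (blues y)

rise-sum : ∀ {k} (m y : Level k) → Zig m y → ∣ m ∣ᴸ ℕ.+ rise m y ≡ ∣ y ∣ᴸ
rise-sum []               []               z = ≡.refl
rise-sum ((r , b) ∷ ms) ((r' , b') ∷ ys) ((a , a') , c , z) = ≡.trans
  (solve 6 (λ r b s d d' e → ((r :+ b) :+ s) :+ ((d :+ e) :+ d') := ((r :+ d) :+ (b :+ d')) :+ (s :+ e)) ≡.refl r b ∣ ms ∣ᴸ (r' ∸ r) ((b' ∸ b) ℕ.+ diff (blues ms) (blues ys)) (diff (reds ms) (reds ys)))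
  (≡.trans (≡.cong (ℕ._+ (∣ ms ∣ᴸ ℕ.+ diff (reds ms) (reds ys))) (≡.cong₂ ℕ._+_ (ℕₚ.m+[n∸m]≡n a) (≡.trans (≡.sym (ℕₚ.+-assoc b _ _)) (≡.cong (ℕ._+ diff (blues ms) (blues ys)) (ℕₚ.m+[n∸m]≡n a')))))
  (≡.trans (solve 5 (λ r b d s e → (r :+ (b :+ d)) :+ (s :+ e) := (r :+ b) :+ (s :+ (e :+ d))) ≡.refl r' b' (diff (blues ms) (blues ys)) ∣ ms ∣ᴸ (diff (reds ms) (reds ys)))
    (≡.cong (r' ℕ.+ b' ℕ.+_) (rise-sum ms ys z))))
  where open +-*-Solver

zig-below : ∀ {k} (u : Node) (m y : Level k) → Straight.Below u y → Zig m y → ∀ j → lookup y j ⊑ u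
zig-below u (m ∷ ms) (y ∷ ys) p q zero = p
zig-below u (m ∷ ms) (y ∷ ys) (p , p') ((a , a') , c , z) (suc j) with zig-below m ms ys c z j
... | (d , d') = ℕₚ.≤-trans d (ℕₚ.≤-trans a p) , ℕₚ.≤-trans d' (ℕₚ.≤-trans a' p')

zig-decreasing : ∀ {k} (m y : Level k) → Zig m y → ∀ i j → i Fin.< j → lookup y j ⊑ lookup y i
zig-decreasing (m ∷ ms) (y ∷ ys) ((a , a') , c , z) zero (suc j) _ with zig-below m ms ys c z j
... | (d , d') = ℕₚ.≤-trans d a , ℕₚ.≤-trans d' a'
zig-decreasing (m ∷ ms) (y ∷ ys) (_ , c , z) (suc i) (suc j) (s≤s p) = zig-decreasing ms ys z i j p

corner : ∀ {k} → (Fin k → ℕ) → (Fin k → ℕ) → Level k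
corner μ μ' = Vec.zip (hat μ) (hat μ')

Descending : ∀ {k} → Level k → Set
Descending m = ∀ i j → i Fin.< j → lookup m j ⊑ lookup m i

Near : ∀ {k} → Level k → Set
Near m = NearDecreasing (reds m) × NearDecreasing (blues m)

descending⇒near : ∀ {k} (m : Level k) → Descending m → Near m
descending⇒near m d =
  (λ i j p → ≡.subst₂ (λ a b → a ≤ suc b) (≡.sym (Vecₚ.lookup-map j proj₁ m)) (≡.sym (Vecₚ.lookup-map i proj₁ m)) (ℕₚ.m≤n⇒m≤1+n (proj₁ (d i j (ℕₚ.≤-reflexive (≡.sym p)))))) ,
  (λ i j p → ≡.subst₂ (λ a b → a ≤ suc b) (≡.sym (Vecₚ.lookup-map j proj₂ m)) (≡.sym (Vecₚ.lookup-map i proj₂ m)) (ℕₚ.m≤n⇒m≤1+n (proj₂ (d i j (ℕₚ.≤-reflexive (≡.sym p))))))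

bounded-lookup : ∀ {M k} (y : Level k) → Bounded M y → ∀ i → proj₁ (lookup y i) ≤ M × proj₂ (lookup y i) ≤ M
bounded-lookup (_ ∷ y) (p , q) zero    = p
bounded-lookup (_ ∷ y) (p , q) (suc i) = bounded-lookup y q i

bounded-below : ∀ {M k} (y : Level k) → Bounded M y → Straight.Below (M , M) y
bounded-below []      _       = tt
bounded-below (_ ∷ y) (p , _) = p

-- The parameters of row j are stored as nⱼ + j, which turns strict decrease into weak decrease.
module GelfandTsetlin (B : CommutativeRing 0ℓ 0ℓ) (M : ℕ) where
  open CommutativeRing B hiding (zero)
  open Sums B
  open Determinants B
  open CompleteSymmetric B
  open Relation.Binary.Reasoning.Setoid setoid

  pow : Carrier → ℕ → Carrier
  pow x zero    = 1#
  pow x (suc n) = x * pow x n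

  pow-+ : ∀ x m n → pow x (m ℕ.+ n) ≈ pow x m * pow x n
  pow-+ x zero    n = sym (*-identityˡ _)
  pow-+ x (suc m) n = trans (*-congˡ (pow-+ x m n)) (sym (*-assoc _ _ _))

  module _ {v} (x : Carrier) (xs : Vec Carrier v) where
    private
      ρ = completeℤ (x ∷ xs)
      e = completeℤ xs

    complete-peel : ∀ z → ρ z ≈ e z + x * ρ (z ℤ.- + 1)
    complete-peel (+ zero)        = sym (trans (+-congˡ (zeroʳ x)) (+-identityʳ 1#))
    complete-peel (+ suc zero)    = refl
    complete-peel (+ suc (suc r)) = refl
    complete-peel -[1+ r ]        = sym (trans (+-congˡ (zeroʳ x)) (+-identityʳ 0#))

    complete-telescope : ∀ d z → ρ z ≈ ∑< d (λ g → pow x g * e (z ℤ.- + g)) + pow x d * ρ (z ℤ.- + d)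
    complete-telescope zero    z = trans (reflexive (≡.cong ρ (≡.sym (ℤₚ.+-identityʳ z)))) (sym (trans (+-identityˡ _) (*-identityˡ _)))
    complete-telescope (suc d) z = begin
      ρ z                                            ≈⟨ complete-peel z ⟩
      e z + x * ρ (z ℤ.- + 1)                        ≈⟨ +-congˡ (*-congˡ (complete-telescope d (z ℤ.- + 1))) ⟩
      e z + x * (∑< d (λ g → pow x g * e ((z ℤ.- + 1) ℤ.- + g)) + pow x d * ρ ((z ℤ.- + 1) ℤ.- + d))
        ≈⟨ +-congˡ (trans (distribˡ _ _ _) (+-cong (scale d _) (sym (*-assoc _ _ _)))) ⟩
      e z + (∑< d (λ g → x * (pow x g * e ((z ℤ.- + 1) ℤ.- + g))) + (x * pow x d) * ρ ((z ℤ.- + 1) ℤ.- + d))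
        ≈⟨ +-assoc _ _ _ ⟨
      (e z + ∑< d (λ g → x * (pow x g * e ((z ℤ.- + 1) ℤ.- + g)))) + (x * pow x d) * ρ ((z ℤ.- + 1) ℤ.- + d)
        ≈⟨ +-cong (+-cong (trans (sym (*-identityˡ _)) (*-congˡ (reflexive (≡.cong e (≡.sym (ℤₚ.+-identityʳ z))))))
                          (∑<-cong d (λ g _ → trans (sym (*-assoc _ _ _)) (*-congˡ (reflexive (≡.cong e (sub z (+ g))))))))
                  (*-congˡ (reflexive (≡.cong ρ (sub z (+ d))))) ⟩
      ∑< (suc d) (λ g → pow x g * e (z ℤ.- + g)) + pow x (suc d) * ρ (z ℤ.- + suc d) ∎
      where
      sub : ∀ z g → (z ℤ.- + 1) ℤ.- g ≡ z ℤ.- (+ 1 ℤ.+ g)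
      sub = ℤS.solve 2 (λ z g → (z ℤS.:- ℤS.con (+ 1)) ℤS.:- g ℤS.:= z ℤS.:- (ℤS.con (+ 1) ℤS.:+ g)) ≡.refl
      scale : ∀ d F → x * ∑< d F ≈ ∑< d (λ g → x * F g)
      scale zero    F = zeroʳ x
      scale (suc d) F = trans (distribˡ _ _ _) (+-congˡ (scale d _))

    -- The values allowed by interlacing appear as a difference of two h's in one variable more,
    -- that is, as a row minus a multiple of the row before. For lo = hi + 1 the interval is empty
    -- and the two terms on the right agree.
    complete-interval : ∀ c lo hi → lo ≤ suc hi → hi ≤ M →
      ∑ (range (suc M)) (λ n → when (between? lo hi n) (pow x (n ∸ lo)) * e (c ℤ.- + n)) ≈
      ρ (c ℤ.- + lo) - pow x (suc hi ∸ lo) * ρ (c ℤ.- + suc hi)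
    complete-interval c lo hi lo≤ hi≤ = begin
      ∑ (range (suc M)) (λ n → when (between? lo hi n) (pow x (n ∸ lo)) * e (c ℤ.- + n))
        ≈⟨ ∑-cong (range (suc M)) (λ n → trans (*-comm _ _) (trans (when-*ˡ (between? lo hi n) _ _) (when-congʳ (between? lo hi n) (λ _ → *-comm _ _)))) ⟩
      ∑ (range (suc M)) (λ n → when (between? lo hi n) (pow x (n ∸ lo) * e (c ℤ.- + n)))
        ≈⟨ ∑-interval M lo hi _ lo≤ hi≤ ⟩
      ∑< d (λ g → pow x ((lo ℕ.+ g) ∸ lo) * e (c ℤ.- + (lo ℕ.+ g)))
        ≈⟨ ∑<-cong d (λ g _ → *-cong (reflexive (≡.cong (pow x) (ℕₚ.m+n∸m≡n lo g))) (reflexive (≡.cong e (sub c lo g)))) ⟩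
      S
        ≈⟨ +-identityʳ _ ⟨
      S + 0#
        ≈⟨ +-congˡ (-‿inverseʳ _) ⟨
      S + (T - T)
        ≈⟨ +-assoc _ _ _ ⟨
      (S + T) - T
        ≈⟨ +-congʳ (complete-telescope d (c ℤ.- + lo)) ⟨
      ρ (c ℤ.- + lo) - T
        ≈⟨ +-congˡ (-‿cong (*-congˡ (reflexive (≡.cong ρ (≡.trans (≡.sym (sub c lo d)) (≡.cong (λ w → c ℤ.- + w) (ℕₚ.m+[n∸m]≡n lo≤))))))) ⟩
      ρ (c ℤ.- + lo) - pow x d * ρ (c ℤ.- + suc hi) ∎
      where
      d = suc hi ∸ lo
      S = ∑< d (λ g → pow x g * e ((c ℤ.- + lo) ℤ.- + g))
      T = pow x d * ρ ((c ℤ.- + lo) ℤ.- + d)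
      sub : ∀ c lo g → c ℤ.- + (lo ℕ.+ g) ≡ (c ℤ.- + lo) ℤ.- + g
      sub c lo g = ≡.trans (≡.cong (λ w → c ℤ.- w) (ℤₚ.pos-+ lo g)) (ℤS.solve 3 (λ c l g → c ℤS.:- (l ℤS.:+ g) ℤS.:= (c ℤS.:- l) ℤS.:- g) ≡.refl c (+ lo) (+ g))

  -- This is det(h_{μ_i - κ_j}) with κ_j = n_j - j, transposed so that rows belong to the lower
  -- shape, the one that changes from level to level.
  skew : ∀ {v k} → (Fin k → ℕ) → Vec Carrier v → Vec ℕ k → Carrier
  skew μ xs n = Det (λ j i → completeℤ xs (+ (μ i ℕ.+ toℕ j) ℤ.- + lookup n j))

  ∏-interlacing : ∀ x {k} p (m n : Vec ℕ k) →
    ∏ (λ i → when (between? (lookup m i) (upper p m i) (lookup n i)) (pow x (lookup n i ∸ lookup m i))) ≈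
    when (il? p m n) (pow x (diff m n))
  ∏-interlacing x p []       []       = refl
  ∏-interlacing x p (m ∷ ms) (n ∷ ns) = begin
    when (between? m p n) (pow x (n ∸ m)) * ∏ (λ i → when (between? (lookup ms i) (upper m ms i) (lookup ns i)) (pow x (lookup ns i ∸ lookup ms i)))
      ≈⟨ *-congˡ (∏-interlacing x m ms ns) ⟩
    when (between? m p n) (pow x (n ∸ m)) * when (il? m ms ns) (pow x (diff ms ns))
      ≈⟨ when-*ˡ (il? m ms ns) _ _ ⟩
    when (il? m ms ns) (when (between? m p n) (pow x (n ∸ m)) * pow x (diff ms ns))
      ≈⟨ when-congʳ (il? m ms ns) (λ _ → trans (*-comm _ _) (trans (when-*ˡ (between? m p n) _ _) (when-congʳ (between? m p n) (λ _ → trans (*-comm _ _) (sym (pow-+ x (n ∸ m) _)))))) ⟩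
    when (il? m ms ns) (when (between? m p n) (pow x ((n ∸ m) ℕ.+ diff ms ns)))
      ≈⟨ when-comm (il? m ms ns) (between? m p n) ⟩
    when (between? m p n) (when (il? m ms ns) (pow x ((n ∸ m) ℕ.+ diff ms ns)))
      ≈⟨ when-× (between? m p n) (il? m ms ns) ⟨
    when (between? m p n ×-dec il? m ms ns) (pow x ((n ∸ m) ℕ.+ diff ms ns)) ∎

  -- The branching rule by row operations: subtracting a power of x times the previous row turns row
  -- j into a sum over m_j ≤ n ≤ m_{j-1}, and multilinearity then sums over all rows n interlacing
  -- with m.
  skew-step : ∀ {v k} (μ : Fin k → ℕ) → (∀ i → μ i ≤ M) → ∀ x (xs : Vec Carrier v) (m : Vec ℕ k) → (∀ i → lookup m i ≤ M) →
              (∀ i j → toℕ j ≡ suc (toℕ i) → lookup m j ≤ suc (lookup m i)) →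
              skew μ (x ∷ xs) m ≈ ∑ (vecs (range (suc M)) k) (λ n → when (il? M m n) (pow x (diff m n)) * skew μ xs n)
  skew-step {k = zero}  μ μ≤M x xs [] m≤M near = trans (Det-nil _) (sym (trans (+-identityʳ _) (trans (*-identityˡ _) (Det-nil _))))
  skew-step {k = suc k} μ μ≤M x xs m  m≤M near = begin
    skew μ (x ∷ xs) m
      ≈⟨ Det-sub-previous F F' (λ i → pow x (suc (lookup m (inject₁ i)) ∸ lookup m (suc i))) row0 rowsuc ⟨
    Det F'
      ≈⟨ Det-expand-rows (range (suc M)) (λ j n → when (between? (lookup m j) (upper M m j) n) (pow x (n ∸ lookup m j)))
           (λ j n i → completeℤ xs (c i j ℤ.- + n)) id ⟩
    ∑ (vecs (range (suc M)) (suc k)) (λ n → ∏ (λ j → when (between? (lookup m j) (upper M m j) (lookup n j)) (pow x (lookup n j ∸ lookup m j))) * skew μ xs n)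
      ≈⟨ ∑-cong (vecs (range (suc M)) (suc k)) (λ n → *-congʳ (∏-interlacing x M m n)) ⟩
    ∑ (vecs (range (suc M)) (suc k)) (λ n → when (il? M m n) (pow x (diff m n)) * skew μ xs n) ∎
    where
    c : Fin (suc k) → Fin (suc k) → ℤ
    c i j = + (μ i ℕ.+ toℕ j)
    F F' : Matrix (suc k)
    F j i = completeℤ (x ∷ xs) (c i j ℤ.- + lookup m j)
    F' j i = ∑ (range (suc M)) (λ n → when (between? (lookup m j) (upper M m j) n) (pow x (n ∸ lookup m j)) * completeℤ xs (c i j ℤ.- + n))
    -- No row precedes row 0. Its interval may end at M because the correction there contains h of
    -- the negative index μ_i - (M + 1).
    row0 : ∀ i → F' zero i ≈ F zero i
    row0 i = trans (∑-cong (range (suc M)) (λ n → reflexive (≡.cong (λ u → when (between? (lookup m zero) u n) (pow x (n ∸ lookup m zero)) * completeℤ xs (c i zero ℤ.- + n)) (upper-zero m))))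
      (trans (complete-interval x xs (c i zero) (lookup m zero) M (ℕₚ.m≤n⇒m≤1+n (m≤M zero)) ℕₚ.≤-refl)
      (trans (+-congˡ (trans (-‿cong (trans (*-congˡ (reflexive (≡.cong (completeℤ (x ∷ xs)) (negative (μ i ℕ.+ 0) (suc M) (s≤s (≡.subst (_≤ M) (≡.sym (ℕₚ.+-identityʳ (μ i))) (μ≤M i))))))) (zeroʳ _))) -0#≈0#)) (+-identityʳ _)))
      where
      upper-zero : ∀ (m : Vec ℕ (suc k)) → upper M m zero ≡ M
      upper-zero (_ ∷ _) = ≡.refl
    -- The column offset of this row is one more than that of the previous row. The correction at
    -- `suc hi`, with hi the entry of the previous row, is therefore a multiple of that row.
    rowsuc : ∀ j i → F' (suc j) i ≈ F (suc j) i - pow x (suc (lookup m (inject₁ j)) ∸ lookup m (suc j)) * F (inject₁ j) i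
    rowsuc j i = trans (∑-cong (range (suc M)) (λ n → reflexive (≡.cong (λ u → when (between? (lookup m (suc j)) u n) (pow x (n ∸ lookup m (suc j))) * completeℤ xs (c i (suc j) ℤ.- + n)) (upper-suc M m j))))
      (trans (complete-interval x xs (c i (suc j)) (lookup m (suc j)) (lookup m (inject₁ j)) (near (inject₁ j) (suc j) (≡.cong suc (≡.sym (Finₚ.toℕ-inject₁ j)))) (m≤M (inject₁ j)))
      (+-congˡ (-‿cong (*-congˡ (reflexive (≡.cong (completeℤ (x ∷ xs)) (≡.trans (≡.cong (ℤ._- + suc (lookup m (inject₁ j))) (ℤₚ.pos-+ (μ i) (suc (toℕ j))))
         (≡.trans (shift (+ μ i) (+ toℕ j) (+ lookup m (inject₁ j))) (≡.cong (λ w → + (μ i ℕ.+ w) ℤ.- + lookup m (inject₁ j)) (≡.sym (Finₚ.toℕ-inject₁ j)))))))))))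
      where
      shift : ∀ a b c → (a ℤ.+ (+ 1 ℤ.+ b)) ℤ.- (+ 1 ℤ.+ c) ≡ (a ℤ.+ b) ℤ.- c
      shift = ℤS.solve 3 (λ a b c → (a ℤS.:+ (ℤS.con (+ 1) ℤS.:+ b)) ℤS.:- (ℤS.con (+ 1) ℤS.:+ c) ℤS.:= (a ℤS.:+ b) ℤS.:- c) ≡.refl

  δ : ℤ → Carrier
  δ = completeℤ []

  δ-nonzero : ∀ z → ¬ z ≡ + 0 → δ z ≈ 0#
  δ-nonzero (+ zero)  z≢0 = ⊥-elim (z≢0 ≡.refl)
  δ-nonzero (+ suc r) z≢0 = refl
  δ-nonzero -[1+ r ]  z≢0 = refl

  δ-≢ : ∀ a b → ¬ a ≡ b → δ (a ℤ.- b) ≈ 0#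
  δ-≢ a b a≢b = δ-nonzero (a ℤ.- b) (λ e → a≢b (ℤₚ.i-j≡0⇒i≡j a b e))

  δ-≡ : ∀ a b → a ≡ b → δ (a ℤ.- b) ≈ 1#
  δ-≡ a .a ≡.refl = reflexive (≡.cong δ (ℤₚ.+-inverseʳ a))

  -- Compare the first entries. If κ is smaller, column 0 vanishes; if it is larger, row 0 vanishes;
  -- if they agree, strict decrease of κ leaves a single entry in column 0. A repeated value of g
  -- makes both sides zero.
  Det-δ : ∀ {k} (κ g : Fin k → ℤ) → (∀ i j → i Fin.< j → κ j ℤ.< κ i) → (∀ i j → i Fin.< j → g j ℤ.≤ g i) →
          (eq? : Dec (∀ i → κ i ≡ g i)) → Det (λ j i → δ (g i ℤ.- κ j)) ≈ when eq? 1#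
  Det-δ {zero}  κ g κ> g≥ eq? = trans (Det-nil _) (sym (when-yes eq? (λ ())))
  Det-δ {suc k} κ g κ> g≥ eq? with ℤₚ.<-cmp (κ zero) (g zero)
  ... | tri< κ<g _ _ = trans (Det-column-expansion _) (trans (altΣ-zero (λ j → trans (*-congʳ (δ-≢ (g zero) (κ j) (λ e → ℤₚ.<-irrefl (≡.sym e) (below j)))) (zeroˡ _)))
      (sym (when-no eq? (λ e → ℤₚ.<-irrefl (e zero) κ<g))))
    where
    below : ∀ j → κ j ℤ.< g zero
    below zero    = κ<g
    below (suc j) = ℤₚ.<-trans (κ> zero (suc j) (s≤s z≤n)) κ<g
  ... | tri> _ _ g<κ = trans (Det-suc _) (trans (altΣ-zero (λ i → trans (*-congʳ (δ-≢ (g i) (κ zero) (λ e → ℤₚ.<-irrefl e (below i)))) (zeroˡ _)))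
      (sym (when-no eq? (λ e → ℤₚ.<-irrefl (≡.sym (e zero)) g<κ))))
    where
    below : ∀ i → g i ℤ.< κ zero
    below zero    = g<κ
    below (suc i) = ℤₚ.≤-<-trans (g≥ zero (suc i) (s≤s z≤n)) g<κ
  ... | tri≈ _ κ≡g _ = begin
    Det (λ j i → δ (g i ℤ.- κ j))
      ≈⟨ Det-column-expansion _ ⟩
    altΣ (λ j → δ (g zero ℤ.- κ j) * Det (λ a b → δ (g (suc b) ℤ.- κ (punchIn j a))))
      ≈⟨ altΣ-suc _ ⟩
    δ (g zero ℤ.- κ zero) * Det (λ a b → δ (g (suc b) ℤ.- κ (suc a))) - altΣ (λ j → δ (g zero ℤ.- κ (suc j)) * Det (λ a b → δ (g (suc b) ℤ.- κ (punchIn (suc j) a))))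
      ≈⟨ +-cong (trans (*-congʳ (δ-≡ _ _ (≡.sym κ≡g))) (*-identityˡ _)) (trans (-‿cong (altΣ-zero (λ j → trans (*-congʳ (δ-≢ (g zero) (κ (suc j))
           (λ e → ℤₚ.<-irrefl (≡.trans (≡.sym e) (≡.sym κ≡g)) (κ> zero (suc j) (s≤s z≤n))))) (zeroˡ _)))) -0#≈0#) ⟩
    Det (λ a b → δ (g (suc b) ℤ.- κ (suc a))) + 0#
      ≈⟨ +-identityʳ _ ⟩
    Det (λ a b → δ (g (suc b) ℤ.- κ (suc a)))
      ≈⟨ Det-δ (κ ∘ suc) (g ∘ suc) (λ i j p → κ> (suc i) (suc j) (s≤s p)) (λ i j p → g≥ (suc i) (suc j) (s≤s p)) tail? ⟩
    when tail? 1#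
      ≈⟨ when-cong tail? eq? (λ t → λ { zero → κ≡g ; (suc i) → t i }) (λ e i → e (suc i)) (λ _ → refl) ⟩
    when eq? 1# ∎
    where
    tail? : Dec (∀ i → κ (suc i) ≡ g (suc i))
    tail? = Finₚ.all? (λ i → κ (suc i) ℤ.≟ g (suc i))

  skew-[] : ∀ {k} (μ : Fin k → ℕ) → Defs.Decreasing μ → ∀ n → Decreasing≤ n → (eq? : Dec (n ≡ hat μ)) → skew μ [] n ≈ when eq? 1#
  skew-[] {k} μ dec n ndec eq? = begin
    skew μ [] n
      ≈⟨ Det-cong (λ j i → reflexive (≡.cong δ (≡.trans (≡.cong (ℤ._- + lookup n j) (ℤₚ.pos-+ (μ i) (toℕ j))) (shift (+ μ i) (+ toℕ j) (+ lookup n j))))) ⟩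
    Det (λ j i → δ (+ μ i ℤ.- κ j))
      ≈⟨ Det-δ κ (λ i → + μ i) (λ i j p → ℤₚ.+-mono-≤-< (ℤ.+≤+ (ndec i j p)) (ℤₚ.neg-mono-< (ℤ.+<+ p))) (λ i j p → ℤ.+≤+ (dec i j p)) equal? ⟩
    when equal? 1#
      ≈⟨ when-cong equal? eq? to from (λ _ → refl) ⟩
    when eq? 1# ∎
    where
    κ : Fin k → ℤ
    κ j = + lookup n j ℤ.- + toℕ j
    shift : ∀ a b c → (a ℤ.+ b) ℤ.- c ≡ a ℤ.- (c ℤ.- b)
    shift = ℤS.solve 3 (λ a b c → (a ℤS.:+ b) ℤS.:- c ℤS.:= a ℤS.:- (c ℤS.:- b)) ≡.refl
    equal? : Dec (∀ i → κ i ≡ + μ i)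
    equal? = Finₚ.all? (λ i → κ i ℤ.≟ + μ i)
    back : ∀ a b c → a ℤ.- b ≡ c → a ≡ c ℤ.+ b
    back a b .(a ℤ.- b) ≡.refl = ℤS.solve 2 (λ a b → a ℤS.:= (a ℤS.:- b) ℤS.:+ b) ≡.refl a b
    to : (∀ i → κ i ≡ + μ i) → n ≡ hat μ
    to e = ≡.trans (≡.sym (Vecₚ.tabulate∘lookup n)) (Vecₚ.tabulate-cong (λ i → ℤₚ.+-injective (back (+ lookup n i) (+ toℕ i) (+ μ i) (e i))))
    from : n ≡ hat μ → ∀ i → κ i ≡ + μ i
    from ≡.refl i = ≡.trans (≡.cong (λ w → + w ℤ.- + toℕ i) (Vecₚ.lookup∘tabulate _ i))
      (≡.trans (≡.cong (ℤ._- + toℕ i) (ℤₚ.pos-+ (μ i) (toℕ i))) (ℤS.solve 2 (λ a b → (a ℤS.:+ b) ℤS.:- b ℤS.:= a) ≡.refl (+ μ i) (+ toℕ i)))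

  ∑-unzip : ∀ {X : Set} (xs : List X) k (f g : Vec X k → Carrier) →
            ∑ (vecs xs k) f * ∑ (vecs xs k) g ≈ ∑ (vecs (pairs xs) k) (λ y → f (Vec.map proj₁ y) * g (Vec.map proj₂ y))
  ∑-unzip xs zero    f g = trans (*-cong (+-identityʳ _) (+-identityʳ _)) (sym (+-identityʳ _))
  ∑-unzip xs (suc k) f g = begin
    ∑ (vecs xs (suc k)) f * ∑ (vecs xs (suc k)) g
      ≈⟨ *-cong (∑-vecs xs k f) (∑-vecs xs k g) ⟩
    ∑ xs (λ x → ∑ (vecs xs k) (λ v → f (x ∷ v))) * ∑ xs (λ x → ∑ (vecs xs k) (λ v → g (x ∷ v)))
      ≈⟨ trans (∑-*ʳ xs _ _) (∑-cong xs (λ x → ∑-*ˡ xs _ _)) ⟩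
    ∑ xs (λ x → ∑ xs (λ x' → ∑ (vecs xs k) (λ v → f (x ∷ v)) * ∑ (vecs xs k) (λ v → g (x' ∷ v))))
      ≈⟨ ∑-cong xs (λ x → ∑-cong xs (λ x' → ∑-unzip xs k _ _)) ⟩
    ∑ xs (λ x → ∑ xs (λ x' → ∑ (vecs (pairs xs) k) (λ y → f (x ∷ Vec.map proj₁ y) * g (x' ∷ Vec.map proj₂ y))))
      ≈⟨ ∑-pairs xs _ ⟨
    ∑ (pairs xs) (λ p → ∑ (vecs (pairs xs) k) (λ y → f (proj₁ p ∷ Vec.map proj₁ y) * g (proj₂ p ∷ Vec.map proj₂ y)))
      ≈⟨ ∑-vecs (pairs xs) k _ ⟨
    ∑ (vecs (pairs xs) (suc k)) (λ y → f (Vec.map proj₁ y) * g (Vec.map proj₂ y)) ∎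

  ∑-congᴬ : ∀ {X : Set} {P : X → Set} {xs : List X} {f g} → All P xs → (∀ x → P x → f x ≈ g x) → ∑ xs f ≈ ∑ xs g
  ∑-congᴬ []       e = refl
  ∑-congᴬ (p ∷ ps) e = +-cong (e _ p) (∑-congᴬ ps e)

  monomial : ∀ {v k} → Vec Carrier v → Level k → Vec (Level k) v → Carrier
  monomial []       m []      = 1#
  monomial (x ∷ xs) m (u ∷ U) = pow x (rise m u) * monomial xs u U

  module _ {k} (μ μ' : Fin k → ℕ) (μ≤M : ∀ i → μ i ≤ M) (μ'≤M : ∀ i → μ' i ≤ M) (dec : Defs.Decreasing μ) (dec' : Defs.Decreasing μ') where

    skew² : ∀ {v} → Vec Carrier v → Level k → Carrier
    skew² xs m = skew μ xs (reds m) * skew μ' xs (blues m)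

    skew²-step : ∀ {v} x (xs : Vec Carrier v) m → Bounded M m → NearDecreasing (reds m) → NearDecreasing (blues m) →
                 skew² (x ∷ xs) m ≈ ∑ (levels M k) (λ y → when (zig? m y) (pow x (rise m y) * skew² xs y))
    skew²-step x xs m m≤M near near' = begin
      skew² (x ∷ xs) m
        ≈⟨ *-cong (skew-step μ μ≤M x xs (reds m) (λ i → ≡.subst (_≤ M) (≡.sym (Vecₚ.lookup-map i proj₁ m)) (proj₁ (bounded-lookup m m≤M i))) near)
                  (skew-step μ' μ'≤M x xs (blues m) (λ i → ≡.subst (_≤ M) (≡.sym (Vecₚ.lookup-map i proj₂ m)) (proj₂ (bounded-lookup m m≤M i))) near') ⟩
      _ ≈⟨ ∑-unzip (range (suc M)) k _ _ ⟩
      ∑ (levels M k) (λ y → (when (il? M (reds m) (reds y)) (pow x (diff (reds m) (reds y))) * skew μ xs (reds y)) *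
                            (when (il? M (blues m) (blues y)) (pow x (diff (blues m) (blues y))) * skew μ' xs (blues y)))
        ≈⟨ ∑-congᴬ (levels-bounded M k) (λ y y≤M → term y y≤M) ⟩
      ∑ (levels M k) (λ y → when (zig? m y) (pow x (rise m y) * skew² xs y)) ∎
      where
      term : ∀ y → Bounded M y →
        (when (il? M (reds m) (reds y)) (pow x (diff (reds m) (reds y))) * skew μ xs (reds y)) *
        (when (il? M (blues m) (blues y)) (pow x (diff (blues m) (blues y))) * skew μ' xs (blues y)) ≈
        when (zig? m y) (pow x (rise m y) * skew² xs y)
      term y y≤M = begin
        (when P p * S) * (when P' p' * S')           ≈⟨ *-interchange _ _ _ _ ⟩
        (when P p * when P' p') * (S * S')           ≈⟨ *-congʳ (trans (when-*ˡ P' _ _) (when-congʳ P' (λ _ → trans (*-comm _ _) (when-*ˡ P _ _)))) ⟩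
        when P' (when P (p' * p)) * (S * S')         ≈⟨ *-congʳ (when-× P' P) ⟨
        when (P' ×-dec P) (p' * p) * (S * S')        ≈⟨ trans (*-comm _ _) (when-*ˡ (P' ×-dec P) _ _) ⟩
        when (P' ×-dec P) ((S * S') * (p' * p))
          ≈⟨ when-cong (P' ×-dec P) (zig? m y) (λ (a , b) → proj₂ (IL⇒Zig (M , M) m y b a))
               (λ z → let (a , b) = Zig⇒IL (M , M) m y (bounded-below y y≤M) z in b , a)
               (λ _ → trans (*-comm _ _) (*-congʳ (trans (*-comm _ _) (sym (pow-+ x (diff (reds m) (reds y)) _))))) ⟩
        when (zig? m y) (pow x (rise m y) * (S * S')) ∎
        where
        P = il? M (reds m) (reds y)
        P' = il? M (blues m) (blues y)
        p = pow x (diff (reds m) (reds y))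
        p' = pow x (diff (blues m) (blues y))
        S = skew μ xs (reds y)
        S' = skew μ' xs (blues y)

    -- Kept apart from the induction because the bottom level is only `Near`. From the next level on
    -- interlacing gives `Descending`, which the case without variables in `skew²-chain` requires.
    skew²-step′ : ∀ {v} x (xs : Vec Carrier v) m → Bounded M m → Near m →
                  (∀ y → Bounded M y → Descending y → skew² xs y ≈ ∑ (vecs (levels M k) v) (λ U → when (chain? (corner μ μ') y U) (monomial xs y U))) →
                  skew² (x ∷ xs) m ≈ ∑ (vecs (levels M k) (suc v)) (λ U → when (chain? (corner μ μ') m U) (monomial (x ∷ xs) m U))
    skew²-step′ {v} x xs m m≤M (near , near') rec = begin
      skew² (x ∷ xs) m
        ≈⟨ skew²-step x xs m m≤M near near' ⟩
      ∑ (levels M k) (λ y → when (zig? m y) (pow x (rise m y) * skew² xs y))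
        ≈⟨ ∑-congᴬ (levels-bounded M k) (λ y y≤M → when-congʳ (zig? m y) (λ z → *-congˡ (rec y y≤M (zig-decreasing m y z)))) ⟩
      ∑ (levels M k) (λ y → when (zig? m y) (pow x (rise m y) * ∑ (vecs (levels M k) v) (λ U → when (chain? (corner μ μ') y U) (monomial xs y U))))
        ≈⟨ ∑-cong (levels M k) (λ y → trans (when-congʳ (zig? m y) (λ _ → trans (∑-*ˡ (vecs (levels M k) v) _ _) (∑-cong (vecs (levels M k) v) (λ U → when-*ˡ (chain? (corner μ μ') y U) _ _))))
             (trans (when-∑ (zig? m y) (vecs (levels M k) v) _) (∑-cong (vecs (levels M k) v) (λ U → sym (when-× (zig? m y) (chain? (corner μ μ') y U)))))) ⟩
      ∑ (levels M k) (λ y → ∑ (vecs (levels M k) v) (λ U → when (chain? (corner μ μ') m (y ∷ U)) (monomial (x ∷ xs) m (y ∷ U))))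
        ≈⟨ ∑-vecs (levels M k) v _ ⟨
      ∑ (vecs (levels M k) (suc v)) (λ U → when (chain? (corner μ μ') m U) (monomial (x ∷ xs) m U)) ∎

    skew²-chain : ∀ {v} (xs : Vec Carrier v) m → Bounded M m → Descending m →
                  skew² xs m ≈ ∑ (vecs (levels M k) v) (λ U → when (chain? (corner μ μ') m U) (monomial xs m U))
    skew²-chain []       m m≤M d = begin
      skew² [] m
        ≈⟨ *-cong (skew-[] μ dec (reds m) (λ i j p → ≡.subst₂ _≤_ (≡.sym (Vecₚ.lookup-map j proj₁ m)) (≡.sym (Vecₚ.lookup-map i proj₁ m)) (proj₁ (d i j p))) r?)
                  (skew-[] μ' dec' (blues m) (λ i j p → ≡.subst₂ _≤_ (≡.sym (Vecₚ.lookup-map j proj₂ m)) (≡.sym (Vecₚ.lookup-map i proj₂ m)) (proj₂ (d i j p))) b?) ⟩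
      when r? 1# * when b? 1#
        ≈⟨ trans (when-*ˡ b? _ _) (when-congʳ b? (λ _ → *-identityʳ _)) ⟩
      when b? (when r? 1#)
        ≈⟨ when-× b? r? ⟨
      when (b? ×-dec r?) 1#
        ≈⟨ when-cong (b? ×-dec r?) (chain? (corner μ μ') m []) (λ (b , r) → ≡.trans (zipped m) (≡.cong₂ Vec.zip r b)) (λ { ≡.refl → Vecₚ.map-proj₂-zip _ _ , Vecₚ.map-proj₁-zip _ _ }) (λ _ → refl) ⟩
      when (chain? (corner μ μ') m []) 1#
        ≈⟨ +-identityʳ _ ⟨
      ∑ (vecs (levels M k) 0) (λ U → when (chain? (corner μ μ') m U) (monomial [] m U)) ∎
      where
      r? = Vecₚ.≡-dec ℕ._≟_ (reds m) (hat μ)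
      b? = Vecₚ.≡-dec ℕ._≟_ (blues m) (hat μ')
      zipped : ∀ {k} (m : Level k) → m ≡ Vec.zip (reds m) (blues m)
      zipped []      = ≡.refl
      zipped (x ∷ m) = ≡.cong (x ∷_) (zipped m)
    skew²-chain (x ∷ xs) m m≤M d = skew²-step′ x xs m m≤M (descending⇒near m d) (skew²-chain xs)

    skew²-chains : ∀ {v} x (xs : Vec Carrier v) m → Bounded M m → Near m →
                   skew² (x ∷ xs) m ≈ ∑ (vecs (levels M k) (suc v)) (λ U → when (chain? (corner μ μ') m U) (monomial (x ∷ xs) m U))
    skew²-chains x xs m m≤M near = skew²-step′ x xs m m≤M near (skew²-chain xs)

hat-near : ∀ {k} (ν : Fin k → ℕ) → Defs.Decreasing ν → NearDecreasing (hat ν)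
hat-near ν dec i j p = ≡.subst₂ (λ a b → a ≤ suc b) (≡.sym (Vecₚ.lookup∘tabulate _ j)) (≡.sym (Vecₚ.lookup∘tabulate _ i))
  (≡.subst (λ w → ν j ℕ.+ w ≤ suc (ν i ℕ.+ toℕ i)) (≡.sym p)
    (ℕₚ.≤-trans (ℕₚ.≤-reflexive (ℕₚ.+-suc (ν j) (toℕ i))) (s≤s (ℕₚ.+-monoˡ-≤ (toℕ i) (dec i j (ℕₚ.≤-reflexive (≡.sym p)))))))

-- Products of two minors as sums over pairs of patterns

module MinorProducts (R : CommutativeRing 0ℓ 0ℓ) (gen : ℕ → CommutativeRing.Carrier R) (M : ℕ) where
  open CommutativeRing R hiding (zero)
  open Sums R
  open Determinants R
  open CompleteAction R
  open SchurDeterminants R gen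
  open Operators R
  open Relation.Binary.Reasoning.Setoid setoid
  module GT n = GelfandTsetlin (OperatorRing n) M
  module OS n = Sums (OperatorRing n)

  addWeight : ∀ {k n} → Vec ℤ n → Level k → Vec (Level k) n → Vec ℤ n
  addWeight []      m []      = []
  addWeight (a ∷ α) m (u ∷ U) = (a ℤ.+ + rise m u) ∷ addWeight α u U

  pow-wk : ∀ {n} (x : Expr n) d → GT.pow (suc n) (wk x) d ≡ wk (GT.pow n x d)
  pow-wk x zero    = ≡.refl
  pow-wk x (suc d) = ≡.cong (wk x ⊗_) (pow-wk x d)

  monomial-wk : ∀ {n v k} (xs : Vec (Expr n) v) (m : Level k) U → GT.monomial (suc n) (Vec.map wk xs) m U ≡ wk (GT.monomial n xs m U)
  monomial-wk []       m []      = ≡.refl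
  monomial-wk (x ∷ xs) m (u ∷ U) = ≡.cong₂ _⊗_ (pow-wk x (rise m u)) (monomial-wk xs u U)

  act-pow : ∀ {n} d t a (α : Vec ℤ n) → act (GT.pow (suc n) (var zero) d) t (a ∷ α) ≈ t ((a ℤ.+ + d) ∷ α)
  act-pow zero    t a α = reflexive (≡.cong (λ z → t (z ∷ α)) (≡.sym (ℤₚ.+-identityʳ a)))
  act-pow (suc d) t a α = trans (act-pow d t (a ℤ.+ + 1) α) (reflexive (≡.cong (λ z → t (z ∷ α)) (ℤₚ.+-assoc a (+ 1) (+ d))))

  act-monomial : ∀ {n k} (m : Level k) U t (α : Vec ℤ n) → act (GT.monomial n (vars n) m U) t α ≈ t (addWeight α m U)
  act-monomial {zero}  m []      t []      = refl
  act-monomial {suc n} m (u ∷ U) t (a ∷ α) = begin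
    act (GT.pow (suc n) (var zero) (rise m u)) (act (GT.monomial (suc n) (Vec.map wk (vars n)) u U) t) (a ∷ α)
      ≈⟨ act-pow (rise m u) _ a α ⟩
    act (GT.monomial (suc n) (Vec.map wk (vars n)) u U) t ((a ℤ.+ + rise m u) ∷ α)
      ≈⟨ reflexive (≡.cong (λ e → act e t ((a ℤ.+ + rise m u) ∷ α)) (monomial-wk (vars n) u U)) ⟩
    act (wk (GT.monomial n (vars n) u U)) t ((a ℤ.+ + rise m u) ∷ α)
      ≈⟨ act-wk (GT.monomial n (vars n) u U) t _ α ⟩
    act (GT.monomial n (vars n) u U) (λ β → t ((a ℤ.+ + rise m u) ∷ β)) α
      ≈⟨ act-monomial u U _ α ⟩
    t (addWeight (a ∷ α) m (u ∷ U)) ∎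

  addWeight-chain : ∀ {n k top} (m : Level k) (U : Vec (Level k) n) → Chain top m U → addWeight (zeros n) m U ≡ weight m U
  addWeight-chain m []      c       = ≡.refl
  addWeight-chain m (u ∷ U) (z , c) = ≡.cong₂ _∷_ (≡.trans (ℤₚ.+-identityˡ _) (diff≡ {∣ m ∣ᴸ} (rise-sum m u z))) (addWeight-chain u U c)
    where
    diff≡ : ∀ {a b c} → a ℕ.+ b ≡ c → + b ≡ + c ℤ.- + a
    diff≡ {a} {b} ≡.refl = ≡.sym (≡.trans (≡.cong (ℤ._- + a) (ℤₚ.pos-+ a b)) (ℤS.solve 2 (λ a b → (a ℤS.:+ b) ℤS.:- a ℤS.:= b) ≡.refl (+ a) (+ b)))

  act-∑ : ∀ {n} {X : Set} (xs : List X) (f : X → Expr n) t α → act (OS.∑ n xs f) t α ≈ ∑ xs (λ x → act (f x) t α)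
  act-∑ []       f t α = refl
  act-∑ (x ∷ xs) f t α = +-congˡ (act-∑ xs f t α)

  act-when : ∀ {n} {P : Set} (p? : Dec P) (e : Expr n) t α → act (OS.when n p? e) t α ≈ when p? (act e t α)
  act-when (yes _) e t α = refl
  act-when (no _)  e t α = refl

  chains : ∀ {k} n → Level k → Level k → Carrier
  chains {k} n bot top = ∑ (vecs (levels M k) n) (λ U → when (chain? top bot U) (s (weight bot U)))

  -- Both minors are replaced by determinants of operators and expanded over patterns in the ring of
  -- operators. Each monomial, applied to `s` at 0, moves the index to the joint content. Size at
  -- least one supplies the first variable, which makes the levels above the bottom decreasing.
  Det-product : ∀ {k} (μ ν μ' ν' : Fin (suc k) → ℕ) →
    Defs.Decreasing μ → Defs.Decreasing ν → Defs.Decreasing μ' → Defs.Decreasing ν' →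
    (∀ i → μ i ≤ M) → (∀ i → μ' i ≤ M) → Bounded M (corner ν ν') →
    Det (λ a b → h (+ μ a ℤ.- + ν b)) * Det (λ a b → h (+ μ' a ℤ.- + ν' b)) ≈ chains (suc k ℕ.+ suc k) (corner ν ν') (corner μ μ')
  Det-product {k} μ ν μ' ν' dμ dν dμ' dν' μ≤ μ'≤ ν≤ = begin
    Det (λ a b → h (+ μ a ℤ.- + ν b)) * Det (λ a b → h (+ μ' a ℤ.- + ν' b))
      ≈⟨ *-cong (Det-transpose _) (Det-transpose _) ⟩
    Det (λ j i → h (+ μ i ℤ.- + ν j)) * Det (λ j i → h (+ μ' i ℤ.- + ν' j))
      ≈⟨ *-cong (Det-cong (λ j i → reflexive (≡.cong h (entry μ ν j i)))) (Det-cong (λ j i → reflexive (≡.cong h (entry μ' ν' j i)))) ⟩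
    Det (λ j i → h (Z μ (hat ν) j i)) * Det (λ j i → h (Z μ' (hat ν') j i))
      ≈⟨ Evaluation.represents-Det² R gen N (suc k) ≡.refl (Z μ (hat ν)) (Z μ' (hat ν')) ⟨
    act (GT.skew N μ (vars N) (hat ν) ⊗ GT.skew N μ' (vars N) (hat ν')) s (zeros N)
      ≈⟨ reflexive (≡.cong₂ (λ a b → act (GT.skew N μ (vars N) a ⊗ GT.skew N μ' (vars N) b) s (zeros N)) (Vecₚ.map-proj₁-zip (hat ν) (hat ν')) (Vecₚ.map-proj₂-zip (hat ν) (hat ν'))) ⟨
    act (GT.skew N μ (vars N) (reds (corner ν ν')) ⊗ GT.skew N μ' (vars N) (blues (corner ν ν'))) s (zeros N)
      ≈⟨ at (GT.skew²-chains N μ μ' μ≤ μ'≤ dμ dμ' (var zero) (Vec.map wk (vars (k ℕ.+ suc k))) (corner ν ν') ν≤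
            (≡.subst NearDecreasing (≡.sym (Vecₚ.map-proj₁-zip (hat ν) (hat ν'))) (hat-near ν dν) , ≡.subst NearDecreasing (≡.sym (Vecₚ.map-proj₂-zip (hat ν) (hat ν'))) (hat-near ν' dν')))
            s (zeros N) ⟩
    act (OS.∑ N Us (λ U → OS.when N (chain? (corner μ μ') (corner ν ν') U) (GT.monomial N (vars N) (corner ν ν') U))) s (zeros N)
      ≈⟨ trans (act-∑ Us _ s (zeros N)) (∑-cong Us (λ U → trans (act-when (chain? (corner μ μ') (corner ν ν') U) _ s (zeros N))
           (when-congʳ (chain? (corner μ μ') (corner ν ν') U) (λ c → trans (act-monomial (corner ν ν') U s (zeros N)) (reflexive (≡.cong s (addWeight-chain (corner ν ν') U c))))))) ⟩
    chains N (corner ν ν') (corner μ μ') ∎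
    where
    N = suc k ℕ.+ suc k
    Us = vecs (levels M (suc k)) N
    Z : (Fin (suc k) → ℕ) → Vec ℕ (suc k) → Fin (suc k) → Fin (suc k) → ℤ
    Z μ n j i = + (μ i ℕ.+ toℕ j) ℤ.- + lookup n j
    entry : ∀ μ ν j i → + μ i ℤ.- + ν j ≡ Z μ (hat ν) j i
    entry μ ν j i = ≡.sym (≡.trans (≡.cong₂ ℤ._-_ (ℤₚ.pos-+ (μ i) (toℕ j)) (≡.trans (≡.cong +_ (Vecₚ.lookup∘tabulate (λ j → ν j ℕ.+ toℕ j) j)) (ℤₚ.pos-+ (ν j) (toℕ j))))
      (ℤS.solve 3 (λ a b c → (a ℤS.:+ c) ℤS.:- (b ℤS.:+ c) ℤS.:= a ℤS.:- b) ≡.refl (+ μ i) (+ ν j) (+ toℕ j)))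

-- Exchanging colours

-- The Boolean is the decision whether the colours of the node are exchanged.
LNode : Set
LNode = Node × Bool

_≟ᴸ_ : DecidableEquality LNode
_≟ᴸ_ = ≡-dec _≟ᴺ_ Bool._≟_

Labels : ℕ → Set
Labels k = Vec Bool k

swapᴺ : Bool → Node → Node
swapᴺ false u       = u
swapᴺ true  (r , b) = b , r

swapᴸ : ∀ {k} → Labels k → Level k → Level k
swapᴸ = zipWith swapᴺ

swapᵁ : ∀ {k n} → Vec (Labels k) n → Vec (Level k) n → Vec (Level k) n
swapᵁ = zipWith swapᴸ

label : ∀ {k n} → Vec (Level k) n → Vec (Labels k) n → Vec (Vec LNode k) n
label = zipWith zip

_⊑²_ : LNode → LNode → Set
(u , f) ⊑² (w , h) = u ⊑ w × swapᴺ f u ⊑ swapᴺ h w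

-- The half of ⊑² that matters: a swap need never be applied to nodes in which red does not exceed blue (see trim).
_⊑⁺_ : LNode → LNode → Set
(u , f) ⊑⁺ (w , h) = proj₂ w < proj₁ u → f ≡ h

_⊑²?_ : ∀ x y → Dec (x ⊑² y)
(u , f) ⊑²? (w , h) = (u ⊑? w) ×-dec (swapᴺ f u ⊑? swapᴺ h w)

_⊑⁺?_ : ∀ x y → Dec (x ⊑⁺ y)
(u , f) ⊑⁺? (w , h) = (proj₂ w ℕ.<? proj₁ u) →-dec (f Bool.≟ h)

module Double = Interlacing _⊑²_
module DoubleDec = Double.Decide _⊑²?_ _≟ᴸ_
module Plus = Interlacing _⊑⁺_
module PlusDec = Plus.Decide _⊑⁺?_ _≟ᴸ_

swapᴺ-involutive : ∀ f u → swapᴺ f (swapᴺ f u) ≡ u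
swapᴺ-involutive false u = ≡.refl
swapᴺ-involutive true  u = ≡.refl

swapᴸ-involutive : ∀ {k} (f : Labels k) u → swapᴸ f (swapᴸ f u) ≡ u
swapᴸ-involutive []      []      = ≡.refl
swapᴸ-involutive (f ∷ fs) (u ∷ us) = ≡.cong₂ _∷_ (swapᴺ-involutive f u) (swapᴸ-involutive fs us)

swapᵁ-involutive : ∀ {k n} (F : Vec (Labels k) n) U → swapᵁ F (swapᵁ F U) ≡ U
swapᵁ-involutive []      []      = ≡.refl
swapᵁ-involutive (f ∷ F) (u ∷ U) = ≡.cong₂ _∷_ (swapᴸ-involutive f u) (swapᵁ-involutive F U)

∣swapᴸ∣ : ∀ {k} (f : Labels k) y → ∣ swapᴸ f y ∣ᴸ ≡ ∣ y ∣ᴸ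
∣swapᴸ∣ []           []            = ≡.refl
∣swapᴸ∣ (false ∷ f)  (u ∷ y)       = ≡.cong (∣ u ∣ᴺ ℕ.+_) (∣swapᴸ∣ f y)
∣swapᴸ∣ (true ∷ f)   ((r , b) ∷ y) = ≡.cong₂ ℕ._+_ (ℕₚ.+-comm b r) (∣swapᴸ∣ f y)

weight-swap : ∀ {k n} (f : Labels k) m (F : Vec (Labels k) n) U → weight (swapᴸ f m) (swapᵁ F U) ≡ weight m U
weight-swap f m []       []      = ≡.refl
weight-swap f m (f' ∷ F) (u ∷ U) = ≡.cong₂ _∷_ (≡.cong₂ (λ a b → + a ℤ.- + b) (∣swapᴸ∣ f' u) (∣swapᴸ∣ f m)) (weight-swap f' u F U)

zip-injective : ∀ {X Y : Set} {k} {x x' : Vec X k} {y y' : Vec Y k} → zip x y ≡ zip x' y' → x ≡ x' × y ≡ y'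
zip-injective {x = x} {x'} {y} {y'} e =
  ≡.trans (≡.sym (Vecₚ.map-proj₁-zip x y)) (≡.trans (≡.cong (Vec.map proj₁) e) (Vecₚ.map-proj₁-zip x' y')) ,
  ≡.trans (≡.sym (Vecₚ.map-proj₂-zip x y)) (≡.trans (≡.cong (Vec.map proj₂) e) (Vecₚ.map-proj₂-zip x' y'))

-- The condition on an edge only depends on whether the two labels agree, so it is stable under composing swaps.
edge-forward : ∀ u w f h f' h' → (u , f) ⊑² (w , h) → (u , f') ⊑² (w , h') → (swapᴺ f u , f') ⊑² (swapᴺ h w , h')
edge-forward u w false false f'    h'    (a , b) (_ , d) = a , d
edge-forward u w false true  false false (a , b) (_ , d) = b , b
edge-forward u w false true  false true  (a , b) (_ , d) = b , a
edge-forward u w false true  true  false ((a , a') , b) _ = b , (a' , a)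
edge-forward u w false true  true  true  (a , (b , b')) (_ , d) = (b , b') , (b' , b)
edge-forward u w true  false false false (a , b) (_ , d) = b , b
edge-forward u w true  false false true  ((a , a') , b) _ = b , (a' , a)
edge-forward u w true  false true  false (a , b) (_ , d) = b , a
edge-forward u w true  false true  true  (a , (b , b')) (_ , d) = (b , b') , (b' , b)
edge-forward u w true  true  false false (a , b) (_ , d) = b , b
edge-forward u w true  true  false true  ((a , a') , b) (_ , (d , d')) = b , (d' , d)
edge-forward u w true  true  true  false (a , b) (_ , (d , d')) = b , (d' , d)
edge-forward u w true  true  true  true  (a , b) (_ , d) = b , a

edge-backward : ∀ u w f h f' h' → (u , f) ⊑² (w , h) → (swapᴺ f u , f') ⊑² (swapᴺ h w , h') → (u , f') ⊑² (w , h')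
edge-backward u w f h f' h' (a , b) q = ≡.subst₂ (λ x y → (x , f') ⊑² (y , h')) (swapᴺ-involutive f u) (swapᴺ-involutive h w)
  (edge-forward (swapᴺ f u) (swapᴺ h w) f h f' h' (b , ≡.subst₂ _⊑_ (≡.sym (swapᴺ-involutive f u)) (≡.sym (swapᴺ-involutive h w)) a) q)

zig-forward : ∀ {k} (x y : Level k) f g f' g' → Double.Zig (zip x f) (zip y g) → Double.Zig (zip x f') (zip y g') →
              Double.Zig (zip (swapᴸ f x) f') (zip (swapᴸ g y) g')
zig-forward [] [] [] [] [] [] _ _ = tt
zig-forward (x ∷ []) (y ∷ []) (f ∷ []) (g ∷ []) (f' ∷ []) (g' ∷ []) (p , _) (q , _) = edge-forward x y f g f' g' p q , tt , tt
zig-forward (x ∷ xs@(_ ∷ _)) (y ∷ ys@(y₁ ∷ _)) (f ∷ fs@(_ ∷ _)) (g ∷ gs@(g₁ ∷ _)) (f' ∷ fs'@(_ ∷ _)) (g' ∷ gs'@(g₁' ∷ _)) (p , r , t) (q , r' , t') =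
  edge-forward x y f g f' g' p q , edge-forward y₁ x g₁ f g₁' f' r r' , zig-forward xs ys fs gs fs' gs' t t'

zig-backward : ∀ {k} (x y : Level k) f g f' g' → Double.Zig (zip x f) (zip y g) → Double.Zig (zip (swapᴸ f x) f') (zip (swapᴸ g y) g') →
               Double.Zig (zip x f') (zip y g')
zig-backward [] [] [] [] [] [] _ _ = tt
zig-backward (x ∷ []) (y ∷ []) (f ∷ []) (g ∷ []) (f' ∷ []) (g' ∷ []) (p , _) (q , _) = edge-backward x y f g f' g' p q , tt , tt
zig-backward (x ∷ xs@(_ ∷ _)) (y ∷ ys@(y₁ ∷ _)) (f ∷ fs@(_ ∷ _)) (g ∷ gs@(g₁ ∷ _)) (f' ∷ fs'@(_ ∷ _)) (g' ∷ gs'@(g₁' ∷ _)) (p , r , t) (q , r' , t') =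
  edge-backward x y f g f' g' p q , edge-backward y₁ x g₁ f g₁' f' r r' , zig-backward xs ys fs gs fs' gs' t t'

module _ {k : ℕ} where
  -- Since every edge is checked with `⊑²`, both `U` and its exchange by `F` are patterns, the
  -- latter between the exchanged boundary levels. The labels of the boundary levels are prescribed.
  Valid : ∀ {n} → Level k → Labels k → Level k → Labels k → Vec (Labels k) n → Vec (Level k) n → Set
  Valid top gt m g F U = Double.Chain (zip top gt) (zip m g) (label U F)

  valid? : ∀ {n} top gt m g F (U : Vec (Level k) n) → Dec (Valid top gt m g F U)
  valid? top gt m g F U = DoubleDec.chain? (zip top gt) (zip m g) (label U F)

  -- An exchange that is admissible stays admissible after any other admissible exchange. With F' =
  -- F this makes the exchange by F invertible on the patterns admitting it; for other F' it feeds
  -- the inclusion-exclusion.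
  valid-forward : ∀ {n} {top gt} m f f' (U : Vec (Level k) n) F F' → Valid top gt m f F U → Valid top gt m f' F' U →
                  Valid (swapᴸ gt top) gt (swapᴸ f m) f' F' (swapᵁ F U)
  valid-forward m f f' []      []      []        p q with zip-injective p | zip-injective q
  ... | ≡.refl , ≡.refl | _ , ≡.refl = ≡.refl
  valid-forward m f f' (u ∷ U) (g ∷ F) (g' ∷ F') (p , P) (q , Q) = zig-forward m u f g f' g' p q , valid-forward u g g' U F F' P Q

  valid-backward : ∀ {n} {top gt} m f f' (U : Vec (Level k) n) F F' → Valid top gt m f F U →
                   Valid (swapᴸ gt top) gt (swapᴸ f m) f' F' (swapᵁ F U) → Valid top gt m f' F' U
  valid-backward m f f' []      []      []        p q with zip-injective p | zip-injective q
  ... | ≡.refl , ≡.refl | _ , ≡.refl = ≡.refl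
  valid-backward m f f' (u ∷ U) (g ∷ F) (g' ∷ F') (p , P) (q , Q) = zig-backward m u f g f' g' p q , valid-backward u g g' U F F' P Q

  zig-straight : ∀ {k} (x y : Level k) f g → Double.Zig (zip x f) (zip y g) → Zig x y
  zig-straight [] [] [] [] _ = tt
  zig-straight (x ∷ []) (y ∷ []) (f ∷ []) (g ∷ []) ((p , _) , _) = p , tt , tt
  zig-straight (x ∷ xs@(_ ∷ _)) (y ∷ ys@(_ ∷ _)) (f ∷ fs@(_ ∷ _)) (g ∷ gs@(_ ∷ _)) ((p , _) , (r , _) , t) = p , r , zig-straight xs ys fs gs t

  valid⇒chain : ∀ {n} {top gt} m f (U : Vec (Level k) n) F → Valid top gt m f F U → Chain top m U
  valid⇒chain m f []      []      p       = proj₁ (zip-injective p)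
  valid⇒chain m f (u ∷ U) (g ∷ F) (p , P) = zig-straight m u f g p , valid⇒chain u g U F P

sign : Node → Bool
sign (r , b) = ⌊ r ℕ.<? b ⌋

signs : ∀ {k} → Level k → Labels k
signs = Vec.map sign

-- Sorting sends (r , b) to (max , min), and both functions are monotone.
sort-mono : ∀ u w → u ⊑ w → swapᴺ (sign u) u ⊑ swapᴺ (sign w) w
sort-mono (r , b) (r' , b') (p , q) with r ℕ.<? b | r' ℕ.<? b'
... | yes c | yes d = q , p
... | yes c | no d  = ℕₚ.≤-trans q (ℕₚ.≮⇒≥ d) , ℕₚ.≤-trans (ℕₚ.<⇒≤ c) q
... | no c  | yes d = ℕₚ.≤-trans p (ℕₚ.<⇒≤ d) , ℕₚ.≤-trans (ℕₚ.≮⇒≥ c) p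
... | no c  | no d  = p , q

zig-sort : ∀ {k} (x y : Level k) → Zig x y → Double.Zig (zip x (signs x)) (zip y (signs y))
zig-sort [] [] _ = tt
zig-sort (x ∷ []) (y ∷ []) (p , _) = (p , sort-mono x y p) , tt , tt
zig-sort (x ∷ xs@(_ ∷ _)) (y ∷ ys@(y₁ ∷ _)) (p , r , t) = (p , sort-mono x y p) , (r , sort-mono y₁ x r) , zig-sort xs ys t

-- Sorting all nodes is admissible for every pattern, so each pair with the given boundary can be
-- carried to the sorted boundary.
chain-sort : ∀ {k n} {top} (m : Level k) (U : Vec (Level k) n) → Chain top m U → Valid top (signs top) m (signs m) (Vec.map signs U) U
chain-sort m []      ≡.refl  = ≡.refl
chain-sort m (u ∷ U) (p , P) = zig-sort m u p , chain-sort u U P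

booleans : List Bool
booleans = true ∷ false ∷ []

labelings : (k n : ℕ) → List (Vec (Labels k) n)
labelings k n = vecs (vecs booleans k) n

∈-concatMap : {X Y : Set} {h : X → List Y} {xs : List X} {x : X} {y : Y} → x ∈ xs → y ∈ h x → y ∈ concatMap h xs
∈-concatMap {h = h} (here ≡.refl) q = ∈ₚ.∈-++⁺ˡ q
∈-concatMap {h = h} {x' ∷ _} (there p) q = ∈ₚ.∈-++⁺ʳ (h x') (∈-concatMap p q)

∈-vecs : {X : Set} {xs : List X} → (∀ x → x ∈ xs) → ∀ {n} (v : Vec X n) → v ∈ vecs xs n
∈-vecs all []      = here ≡.refl
∈-vecs all (x ∷ v) = ∈-concatMap (all x) (∈ₚ.∈-map⁺ (x ∷_) (∈-vecs all v))

∈-booleans : ∀ b → b ∈ booleans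
∈-booleans true  = here ≡.refl
∈-booleans false = there (here ≡.refl)

∈-labelings : ∀ {k n} (F : Vec (Labels k) n) → F ∈ labelings k n
∈-labelings = ∈-vecs (∈-vecs ∈-booleans)

sorted : ∀ {k} → Level k → Level k
sorted m = swapᴸ (signs m) m

Unswappable : ∀ {k n} → Level k → Level k → Vec (Level k) n → Set
Unswappable {k} {n} bot top U = Chain (sorted top) (sorted bot) U ×
  ¬ Any (λ F → Valid (sorted top) (signs top) (sorted bot) (signs bot) F U) (labelings k n)

unswappable? : ∀ {k n} (bot top : Level k) (U : Vec (Level k) n) → Dec (Unswappable bot top U)
unswappable? {k} {n} bot top U = chain? (sorted top) (sorted bot) U ×-dec
  ¬? (any? (λ F → valid? (sorted top) (signs top) (sorted bot) (signs bot) F U) (labelings k n))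

Cuttable : ∀ {k n} → Level k → Labels k → Level k → Labels k → Vec (Labels k) n → Vec (Level k) n → Set
Cuttable top gt m g F U = Plus.Chain (zip top gt) (zip m g) (label U F)

edge-cut : ∀ x y → x ⊑² y → x ⊑⁺ y
edge-cut (u , false) (w , false) _             c = ≡.refl
edge-cut (u , true)  (w , true)  _             c = ≡.refl
edge-cut (u , false) (w , true)  (_ , (p , _)) c = ⊥-elim (ℕₚ.<⇒≱ c p)
edge-cut (u , true)  (w , false) (_ , (_ , p)) c = ⊥-elim (ℕₚ.<⇒≱ c p)

zig-cut : ∀ {k} (x y : Vec LNode k) → Double.Zig x y → Plus.Zig x y
zig-cut [] [] _ = tt
zig-cut (x ∷ []) (y ∷ []) (p , _) = edge-cut x y p , tt , tt
zig-cut (x ∷ xs@(_ ∷ _)) (y ∷ ys@(y₁ ∷ _)) (p , r , t) = edge-cut x y p , edge-cut y₁ x r , zig-cut xs ys t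

chain-cut : ∀ {k n top} (x : Vec LNode k) (U : Vec (Vec LNode k) n) → Double.Chain top x U → Plus.Chain top x U
chain-cut x []      p       = p
chain-cut x (u ∷ U) (p , P) = zig-cut x u p , chain-cut u U P

positive : Node → Bool
positive (r , b) = ⌊ b ℕ.<? r ⌋

trim : Bool → Node → Bool
trim f u = f ∧ positive u

-- If exactly one end stays exchanged, the red of u must not exceed the blue of w, nor the blue of u
-- the red of w. The first holds by `⊑⁺`, or because the label of one end was trimmed there and red
-- is at most blue at it; the second because red exceeds blue at the exchanged end.
edge-trim : ∀ u w f h → u ⊑ w → (u , f) ⊑⁺ (w , h) → (u , trim f u) ⊑² (w , trim h w)
edge-trim (r , b) (r' , b') false false p       c = p , p
edge-trim (r , b) (r' , b') false true  (p , q) c with b' ℕ.<? r'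
... | no _  = (p , q) , (p , q)
... | yes d = (p , q) , (ℕₚ.≮⇒≥ (λ e → case (c e)) , ℕₚ.≤-trans q (ℕₚ.<⇒≤ d))
  where
  case : false ≡ true → ⊥
  case ()
edge-trim (r , b) (r' , b') true  false (p , q) c with b ℕ.<? r
... | no _  = (p , q) , (p , q)
... | yes d = (p , q) , (ℕₚ.≤-trans (ℕₚ.<⇒≤ d) p , ℕₚ.≮⇒≥ (λ e → case (c e)))
  where
  case : true ≡ false → ⊥
  case ()
edge-trim (r , b) (r' , b') true  true  (p , q) c with b ℕ.<? r | b' ℕ.<? r'
... | yes _ | yes _ = (p , q) , (q , p)
... | no _  | no _  = (p , q) , (p , q)
... | yes d | no e  = (p , q) , (ℕₚ.≤-trans (ℕₚ.<⇒≤ d) p , ℕₚ.≤-trans p (ℕₚ.≮⇒≥ e))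
... | no d  | yes e = (p , q) , (ℕₚ.≤-trans (ℕₚ.≮⇒≥ d) q , ℕₚ.≤-trans q (ℕₚ.<⇒≤ e))

trimᴸ : ∀ {k} → Labels k → Level k → Labels k
trimᴸ = zipWith trim

zig-trim : ∀ {k} (x y : Level k) f g → Zig x y → Plus.Zig (zip x f) (zip y g) → Double.Zig (zip x (trimᴸ f x)) (zip y (trimᴸ g y))
zig-trim [] [] [] [] _ _ = tt
zig-trim (x ∷ []) (y ∷ []) (f ∷ []) (g ∷ []) (p , _) (q , _) = edge-trim x y f g p q , tt , tt
zig-trim (x ∷ xs@(_ ∷ _)) (y ∷ ys@(y₁ ∷ _)) (f ∷ fs@(_ ∷ _)) (g ∷ gs@(g₁ ∷ _)) (p , r , t) (q , r' , t') =
  edge-trim x y f g p q , edge-trim y₁ x g₁ f r r' , zig-trim xs ys fs gs t t'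

chain-trim : ∀ {k n} {top : Level k} {gt} → trimᴸ gt top ≡ gt → ∀ m f (U : Vec (Level k) n) F → Chain top m U → Cuttable top gt m f F U →
             Valid top gt m (trimᴸ f m) (zipWith trimᴸ F U) U
chain-trim e m f []      []      ≡.refl  q with zip-injective q
... | _ , ≡.refl = ≡.cong (zip m) e
chain-trim e m f (u ∷ U) (g ∷ F) (p , P) (q , Q) = zig-trim m u f g p q , chain-trim e u g U F P Q

-- The prescribed labels survive trimming: a boundary node that was exchanged by sorting has red
-- strictly above blue afterwards.
trim-signs : ∀ {k} (m : Level k) → trimᴸ (signs m) (sorted m) ≡ signs m
trim-signs []            = ≡.refl
trim-signs ((r , b) ∷ m) = ≡.cong₂ _∷_ node (trim-signs m)
  where
  node : trim (sign (r , b)) (swapᴺ (sign (r , b)) (r , b)) ≡ sign (r , b)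
  node with r ℕ.<? b
  ... | no _  = ≡.refl
  ... | yes p with r ℕ.<? b
  ...   | yes _ = ≡.refl
  ...   | no q  = ⊥-elim (q p)

Uncuttable : ∀ {k n} → Level k → Level k → Vec (Level k) n → Set
Uncuttable {k} {n} bot top U = ¬ ∃ λ F → Cuttable (sorted top) (signs top) (sorted bot) (signs bot) F U

unswappable⇒uncuttable : ∀ {k n} (bot top : Level k) (U : Vec (Level k) n) → Unswappable bot top U → Uncuttable bot top U
unswappable⇒uncuttable bot top U (c , ¬v) (F , q) = ¬v (lose (∈-labelings _)
  (≡.subst (λ g → Valid (sorted top) (signs top) (sorted bot) g (zipWith trimᴸ F U) U) (trim-signs bot)
    (chain-trim (trim-signs top) (sorted bot) (signs bot) U F c q)))

uncuttable⇒unswappable : ∀ {k n} (bot top : Level k) (U : Vec (Level k) n) → Chain (sorted top) (sorted bot) U → Uncuttable bot top U → Unswappable bot top U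
uncuttable⇒unswappable bot top U c ¬q = c , λ a → let (F , _ , v) = find a in ¬q (F , chain-cut _ _ v)

module SwapBijection (R : CommutativeRing 0ℓ 0ℓ) (gen : ℕ → CommutativeRing.Carrier R) (M : ℕ) {k : ℕ} (n : ℕ) where
  open CommutativeRing R hiding (zero)
  open Sums R
  open SchurDeterminants R gen
  open MinorProducts R gen M
  open Relation.Binary.Reasoning.Setoid setoid

  ∑-zipWith : ∀ {X Y : Set} (xs : List X) (_∙_ : Y → X → X) → (∀ y (Φ : X → Carrier) → ∑ xs (λ x → Φ (y ∙ x)) ≈ ∑ xs Φ) →
              ∀ {n} (v : Vec Y n) (Φ : Vec X n → Carrier) → ∑ (vecs xs n) (λ w → Φ (zipWith _∙_ v w)) ≈ ∑ (vecs xs n) Φ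
  ∑-zipWith xs _∙_ inv []      Φ = refl
  ∑-zipWith xs _∙_ inv {suc n} (y ∷ v) Φ = begin
    ∑ (vecs xs (suc n)) (λ w → Φ (zipWith _∙_ (y ∷ v) w))             ≈⟨ ∑-vecs xs n _ ⟩
    ∑ xs (λ x → ∑ (vecs xs n) (λ w → Φ ((y ∙ x) ∷ zipWith _∙_ v w)))  ≈⟨ ∑-cong xs (λ x → ∑-zipWith xs _∙_ inv v (λ w → Φ ((y ∙ x) ∷ w))) ⟩
    ∑ xs (λ x → ∑ (vecs xs n) (λ w → Φ ((y ∙ x) ∷ w)))                ≈⟨ inv y (λ x → ∑ (vecs xs n) (λ w → Φ (x ∷ w))) ⟩
    ∑ xs (λ x → ∑ (vecs xs n) (λ w → Φ (x ∷ w)))                      ≈⟨ ∑-vecs xs n Φ ⟨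
    ∑ (vecs xs (suc n)) Φ                                             ∎

  ∑-swapᴺ : ∀ f (Φ : Node → Carrier) → ∑ (nodes M) (λ u → Φ (swapᴺ f u)) ≈ ∑ (nodes M) Φ
  ∑-swapᴺ false Φ = refl
  ∑-swapᴺ true  Φ = trans (∑-pairs (range (suc M)) _) (trans (∑-swap (range (suc M)) (range (suc M)) _) (sym (∑-pairs (range (suc M)) _)))

  Us : List (Vec (Level k) n)
  Us = vecs (levels M k) n

  ∑-swapᵁ : ∀ F (Φ : Vec (Level k) n → Carrier) → ∑ Us (λ U → Φ (swapᵁ F U)) ≈ ∑ Us Φ
  ∑-swapᵁ = ∑-zipWith (levels M k) swapᴸ (∑-zipWith (nodes M) swapᴺ ∑-swapᴺ)

  module _ (bot top : Level k) where
    g₀ gₙ : Labels k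
    g₀ = signs bot
    gₙ = signs top
    bot' top' : Level k
    bot' = sorted bot
    top' = sorted top

    valid : ∀ F (V : Vec (Level k) n) → Dec (Valid top gₙ bot g₀ F V)
    valid F V = valid? top gₙ bot g₀ F V
    valid' : ∀ F (V : Vec (Level k) n) → Dec (Valid top' gₙ bot' g₀ F V)
    valid' F V = valid? top' gₙ bot' g₀ F V

    ∑-valid : ∀ (Q Q' : Vec (Level k) n → Set) (Q? : ∀ V → Dec (Q V)) (Q'? : ∀ U → Dec (Q' U)) F →
              (∀ U → Valid top gₙ bot g₀ F U → Q U → Q' (swapᵁ F U)) → (∀ U → Valid top gₙ bot g₀ F U → Q' (swapᵁ F U) → Q U) →
              ∑ Us (λ V → when (valid F V ×-dec Q? V) (s (weight bot V))) ≈
              ∑ Us (λ U → when (valid' F U ×-dec Q'? U) (s (weight bot' U)))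
    ∑-valid Q Q' Q? Q'? F to from = trans (∑-cong Us (λ V → when-cong (valid F V ×-dec Q? V) (valid' F (swapᵁ F V) ×-dec Q'? (swapᵁ F V))
        (λ (p , q) → valid-forward bot g₀ g₀ V F F p p , to V p q)
        (λ (p , q) → let p' = back V p in p' , from V p' q)
        (λ _ → reflexive (≡.cong s (≡.sym (weight-swap g₀ bot F V))))))
      (∑-swapᵁ F (λ U → when (valid' F U ×-dec Q'? U) (s (weight bot' U))))
      where
      back : ∀ V → Valid top' gₙ bot' g₀ F (swapᵁ F V) → Valid top gₙ bot g₀ F V
      back V p = ≡.subst₂ (λ a b → Valid a gₙ b g₀ F V) (swapᴸ-involutive gₙ top) (swapᴸ-involutive g₀ bot)
        (≡.subst (Valid (swapᴸ gₙ top') gₙ (swapᴸ g₀ bot') g₀ F) (swapᵁ-involutive F V) (valid-forward bot' g₀ g₀ (swapᵁ F V) F F p p))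

    -- Induction over the list by inclusion-exclusion for two conditions. The conjunction is
    -- transported by the exchange by `F`, which by `valid-forward` and `valid-backward` respects
    -- whether some further exchange in the list is admissible.
    ∑-any-valid : ∀ (Fs : List (Vec (Labels k) n)) →
                  ∑ Us (λ V → when (any? (λ F → valid F V) Fs) (s (weight bot V))) ≈
                  ∑ Us (λ U → when (any? (λ F → valid' F U) Fs) (s (weight bot' U)))
    ∑-any-valid []       = ∑-cong Us (λ U → when-cong {Any (λ F → Valid top gₙ bot g₀ F U) []} {Any (λ F → Valid top' gₙ bot' g₀ F U) []} (any? (λ F → valid F U) []) (any? (λ F → valid' F U) []) (λ ()) (λ ()) {s (weight bot U)} {s (weight bot' U)} (λ ()))
    ∑-any-valid (F ∷ Fs) = begin
      ∑ Us (λ V → when (any? (λ F → valid F V) (F ∷ Fs)) (s (weight bot V)))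
        ≈⟨ ∑-cong Us (λ V → split (λ F → valid F V) _) ⟩
      ∑ Us (λ V → (when (valid F V) (s (weight bot V)) + when (any? (λ F → valid F V) Fs) (s (weight bot V))) - when (valid F V ×-dec any? (λ F → valid F V) Fs) (s (weight bot V)))
        ≈⟨ spread _ _ _ ⟩
      _ ≈⟨ +-cong (+-cong single (∑-any-valid Fs)) (-‿cong both) ⟩
      _ ≈⟨ spread _ _ _ ⟨
      ∑ Us (λ V → (when (valid' F V) (s (weight bot' V)) + when (any? (λ F → valid' F V) Fs) (s (weight bot' V))) - when (valid' F V ×-dec any? (λ F → valid' F V) Fs) (s (weight bot' V)))
        ≈⟨ ∑-cong Us (λ V → split (λ F → valid' F V) _) ⟨
      ∑ Us (λ U → when (any? (λ F → valid' F U) (F ∷ Fs)) (s (weight bot' U))) ∎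
      where
      split : ∀ {P : Vec (Labels k) n → Set} (P? : ∀ F → Dec (P F)) x →
              when (any? P? (F ∷ Fs)) x ≈ (when (P? F) x + when (any? P? Fs) x) - when (P? F ×-dec any? P? Fs) x
      split P? x = trans (when-cong (any? P? (F ∷ Fs)) (P? F ⊎-dec any? P? Fs) Any.toSum Any.fromSum (λ _ → refl)) (when-⊎ (P? F) (any? P? Fs) x)
      spread : ∀ (f g h : Vec (Level k) n → Carrier) → ∑ Us (λ V → (f V + g V) - h V) ≈ (∑ Us f + ∑ Us g) - ∑ Us h
      spread f g h = trans (∑-+ Us _ _) (+-cong (∑-+ Us f g) (∑-neg Us h))
      single : ∑ Us (λ V → when (valid F V) (s (weight bot V))) ≈ ∑ Us (λ V → when (valid' F V) (s (weight bot' V)))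
      single = trans (∑-cong Us (λ V → when-cong (valid F V) (valid F V ×-dec yes tt) (λ p → p , tt) proj₁ (λ _ → refl)))
        (trans (∑-valid (λ _ → ⊤) (λ _ → ⊤) (λ _ → yes tt) (λ _ → yes tt) F (λ _ _ _ → tt) (λ _ _ _ → tt))
        (∑-cong Us (λ V → when-cong (valid' F V ×-dec yes tt) (valid' F V) proj₁ (λ p → p , tt) (λ _ → refl))))
      both : ∑ Us (λ V → when (valid F V ×-dec any? (λ F → valid F V) Fs) (s (weight bot V))) ≈
             ∑ Us (λ V → when (valid' F V ×-dec any? (λ F → valid' F V) Fs) (s (weight bot' V)))
      both = ∑-valid _ _ (λ V → any? (λ F → valid F V) Fs) (λ V → any? (λ F → valid' F V) Fs) F
        (λ U p → Any.map (λ {F'} q → valid-forward bot g₀ g₀ U F F' p q)) (λ U p → Any.map (λ {F'} q → valid-backward bot g₀ g₀ U F F' p q))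

    -- Every pair in the subtracted sum admits an exchange, namely sorting. By `∑-any-valid` that
    -- sum equals the part of the first one over pairs that admit an exchange, and the other pairs
    -- remain.
    chains-difference : chains n bot' top' - chains n bot top ≈ ∑ Us (λ U → when (unswappable? bot top U) (s (weight bot' U)))
    chains-difference = begin
      chains n bot' top' - chains n bot top
        ≈⟨ +-cong (trans (∑-cong Us (λ U → when-split (chain? top' bot' U) (any' U) _)) (∑-+ Us _ _)) (-‿cong source) ⟩
      (∑ Us (λ U → when (chain? top' bot' U ×-dec any' U) (s (weight bot' U))) + D) - S
        ≈⟨ +-congʳ (+-congʳ (∑-cong Us (λ U → when-cong (chain? top' bot' U ×-dec any' U) (any' U) proj₂
             (λ a → (let (F , _ , v) = find a in valid⇒chain bot' g₀ U F v) , a) (λ _ → refl)))) ⟩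
      (S + D) - S
        ≈⟨ trans (+-congʳ (+-comm S D)) (trans (+-assoc D S (- S)) (trans (+-congˡ (-‿inverseʳ S)) (+-identityʳ D))) ⟩
      D ∎
      where
      any' : ∀ U → Dec (Any (λ F → Valid top' gₙ bot' g₀ F U) (labelings k n))
      any' U = any? (λ F → valid' F U) (labelings k n)
      D = ∑ Us (λ U → when (unswappable? bot top U) (s (weight bot' U)))
      S = ∑ Us (λ U → when (any' U) (s (weight bot' U)))
      source : chains n bot top ≈ S
      source = trans (∑-cong Us (λ V → when-cong (chain? top bot V) (any? (λ F → valid F V) (labelings k n))
          (λ c → lose (∈-labelings (Vec.map signs V)) (chain-sort bot V c))
          (λ a → let (F , _ , v) = find a in valid⇒chain bot g₀ V F v) (λ _ → refl)))
        (∑-any-valid (labelings k n))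

-- Cancellation within a level

-- A row ranges over an interval; its bit with the previous row is either constant on the
-- box or cuts out a sub-box with the same centre.
data Link (lo hi : ℕ) (X : ℕ → ℕ → Bool) (lo' hi' : ℕ) : Set where
  constant : ∀ b → (∀ y y' → lo ≤ y → y ≤ hi → lo' ≤ y' → y' ≤ hi' → X y y' ≡ b) → Link lo hi X lo' hi'
  subBox   : ∀ l u → lo ≤ l → u ≤ hi' → l ℕ.+ u ≡ lo ℕ.+ hi' →
             (∀ y y' → lo ≤ y → y ≤ hi → lo' ≤ y' → y' ≤ hi' → X y y' ≡ true → l ≤ y × y' ≤ u) →
             (∀ y y' → lo ≤ y → y ≤ hi → lo' ≤ y' → y' ≤ hi' → l ≤ y → y' ≤ u → X y y' ≡ true) → Link lo hi X lo' hi'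

-- The bit links a row with the one before it and takes the value of the earlier row first.
data Row : Set where
  row : (bit : ℕ → ℕ → Bool) (lo hi : ℕ) → Row

Linked : ℕ → ℕ → ℕ → List Row → Set
Linked M lo hi []                   = ⊤
Linked M lo hi (row X lo' hi' ∷ rs) = Link lo hi X lo' hi' × hi' ≤ M × Linked M lo' hi' rs

centre : ℕ → ℕ → List Row → ℕ
centre lo hi []                   = lo ℕ.+ hi
centre lo hi (row X lo' hi' ∷ rs) = (lo ℕ.+ hi) ℕ.+ centre lo' hi' rs

-- The centre condition of `subBox` mentions the lower end of the first interval and the upper end
-- of the second. It survives lowering the upper end of the first, and this is all that passing to a
-- sub-box does to the next link.
link-shrink : ∀ {lo hi hi₁ X lo' hi'} → hi₁ ≤ hi → Link lo hi X lo' hi' → Link lo hi₁ X lo' hi'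
link-shrink le (constant b e) = constant b (λ y y' p q → e y y' p (ℕₚ.≤-trans q le))
link-shrink le (subBox l u p q r e e') = subBox l u p q r (λ y y' p q → e y y' p (ℕₚ.≤-trans q le)) (λ y y' p q → e' y y' p (ℕₚ.≤-trans q le))

linked-shrink : ∀ {M lo hi hi₁} rs → hi₁ ≤ hi → Linked M lo hi rs → Linked M lo hi₁ rs
linked-shrink []       le _       = tt
linked-shrink (row _ _ _ ∷ rs) le (p , q) = link-shrink le p , q

centre-hi : ∀ lo hi hi' rs d → hi' ℕ.+ d ≡ hi → centre lo hi' rs ℕ.+ d ≡ centre lo hi rs
centre-hi lo hi hi' []                d ≡.refl = ℕₚ.+-assoc lo hi' d
centre-hi lo hi hi' (row _ lo₁ hi₁ ∷ rs) d ≡.refl = solve 4 (λ a b c d → ((a :+ b) :+ c) :+ d := (a :+ (b :+ d)) :+ c) ≡.refl lo hi' (centre lo₁ hi₁ rs) d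
  where open +-*-Solver

module RowSums (R : CommutativeRing 0ℓ 0ℓ) (M : ℕ) where
  open CommutativeRing R hiding (zero)
  open Sums R
  open Relation.Binary.Reasoning.Setoid setoid

  Graded : Set
  Graded = List Bool → ℕ → Carrier

  interval : ℕ → ℕ → (ℕ → Carrier) → Carrier
  interval lo hi F = ∑ (range (suc M)) (λ y → when (between? lo hi y) (F y))

  interval-cong : ∀ lo hi {F F'} → (∀ y → lo ≤ y → y ≤ hi → F y ≈ F' y) → interval lo hi F ≈ interval lo hi F'
  interval-cong lo hi e = ∑-cong (range (suc M)) (λ y → when-congʳ (between? lo hi y) (λ (p , q) → e y p q))

  interval-+ : ∀ lo hi F F' → interval lo hi (λ y → F y + F' y) ≈ interval lo hi F + interval lo hi F'
  interval-+ lo hi F F' = trans (∑-cong (range (suc M)) (λ y → when-+ (between? lo hi y) _ _)) (∑-+ (range (suc M)) _ _)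

  interval-swap : ∀ lo hi lo' hi' (F : ℕ → ℕ → Carrier) →
                  interval lo hi (λ y → interval lo' hi' (F y)) ≈ interval lo' hi' (λ y' → interval lo hi (λ y → F y y'))
  interval-swap lo hi lo' hi' F = begin
    interval lo hi (λ y → interval lo' hi' (F y))
      ≈⟨ ∑-cong (range (suc M)) (λ y → when-∑ (between? lo hi y) (range (suc M)) _) ⟩
    ∑ (range (suc M)) (λ y → ∑ (range (suc M)) (λ y' → when (between? lo hi y) (when (between? lo' hi' y') (F y y'))))
      ≈⟨ ∑-swap (range (suc M)) (range (suc M)) _ ⟩
    ∑ (range (suc M)) (λ y' → ∑ (range (suc M)) (λ y → when (between? lo hi y) (when (between? lo' hi' y') (F y y'))))
      ≈⟨ ∑-cong (range (suc M)) (λ y' → trans (when-∑ (between? lo' hi' y') (range (suc M)) _) (∑-cong (range (suc M)) (λ y → when-comm (between? lo' hi' y') (between? lo hi y)))) ⟨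
    interval lo' hi' (λ y' → interval lo hi (λ y → F y y')) ∎

  interval-alternating : ∀ lo hi {F} → hi ≤ M → Alternating (lo ℕ.+ hi) F → interval lo hi F ≈ 0#
  interval-alternating lo hi = ∑-alternating M lo hi

  -- Summing over shifts from lo to hi moves the centre by lo + hi. A shift paired with itself
  -- contributes F(a + z) + F(a + z'), which cancels; for z = z' the sum is itself alternating.
  alternating-interval : ∀ lo hi {K F} → hi ≤ M → Alternating ((lo ℕ.+ hi) ℕ.+ K) F → Alternating K (λ z → interval lo hi (λ y → F (y ℕ.+ z)))
  alternating-interval lo hi {K} {F} hi≤M A = mkAlt
      (λ z z' e → trans (sym (interval-+ lo hi _ _)) (interval-alternating lo hi hi≤M (mkAlt
        (λ a b p → trans (+-interchange _ _ _ _) (trans (+-congˡ (+-comm _ _)) (trans (+-interchange _ _ _ _) (trans (+-cong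
            (anti A (a ℕ.+ z) (b ℕ.+ z') (eq a b z z' p e)) (trans (+-comm _ _) (anti A (a ℕ.+ z') (b ℕ.+ z) (eq a b z' z p (≡.trans (ℕₚ.+-comm z' z) e)))))
            (+-identityˡ 0#)))))
        (λ a p → anti A (a ℕ.+ z) (a ℕ.+ z') (eq a a z z' p e)))))
      (λ z e → interval-alternating lo hi hi≤M (mkAlt
        (λ a b p → anti A (a ℕ.+ z) (b ℕ.+ z) (eq a b z z p e))
        (λ a p → fixed A (a ℕ.+ z) (eq a a z z p e))))
    where
    eq : ∀ a b z z' → a ℕ.+ b ≡ lo ℕ.+ hi → z ℕ.+ z' ≡ K → (a ℕ.+ z) ℕ.+ (b ℕ.+ z') ≡ (lo ℕ.+ hi) ℕ.+ K
    eq a b z z' p q = ≡.trans (solve 4 (λ a b c d → (a :+ c) :+ (b :+ d) := (a :+ b) :+ (c :+ d)) ≡.refl a b z z') (≡.cong₂ ℕ._+_ p q)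
      where open +-*-Solver

  rowSum : ℕ → List Row → Graded → Carrier
  rowSum y []                   G = G [] y
  rowSum y (row X lo' hi' ∷ rs) G = interval lo' hi' (λ y' → rowSum y' rs (λ bs z → G (X y y' ∷ bs) (y ℕ.+ z)))

  rowSum-cong : ∀ y rs {G G'} → (∀ bs z → G bs z ≈ G' bs z) → rowSum y rs G ≈ rowSum y rs G'
  rowSum-cong y []                 e = e [] y
  rowSum-cong y (row X lo hi ∷ rs) e = interval-cong lo hi (λ y' _ _ → rowSum-cong y' rs (λ bs z → e _ _))

  rowSum-+ : ∀ y rs G G' → rowSum y rs (λ bs z → G bs z + G' bs z) ≈ rowSum y rs G + rowSum y rs G'
  rowSum-+ y []                 G G' = refl
  rowSum-+ y (row X lo hi ∷ rs) G G' = trans (interval-cong lo hi (λ y' _ _ → rowSum-+ y' rs _ _)) (interval-+ lo hi _ _)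

  rowSum-interval : ∀ y rs lo hi (G : ℕ → Graded) → interval lo hi (λ x → rowSum y rs (G x)) ≈ rowSum y rs (λ bs z → interval lo hi (λ x → G x bs z))
  rowSum-interval y []                   lo hi G = refl
  rowSum-interval y (row X lo' hi' ∷ rs) lo hi G = trans (interval-swap lo hi lo' hi' _) (interval-cong lo' hi' (λ y' _ _ → rowSum-interval y' rs lo hi _))

  -- If the first bit is constant, the first row is free and is summed into `G`, which stays
  -- alternating. If it cuts out a sub-box, `G` is its value for `false` on the whole box plus the
  -- difference of its values for `true` and `false` on the sub-box. In both parts the bit is
  -- constant, and both boxes have the same centre.
  rows-zero : ∀ lo hi rs {G : Graded} → hi ≤ M → Linked M lo hi rs → (∀ bs → Alternating (centre lo hi rs) (G bs)) →
              interval lo hi (λ y → rowSum y rs G) ≈ 0#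
  rows-zero lo hi [] hi≤M _ A = interval-alternating lo hi hi≤M (A [])
  rows-zero lo hi (row X lo' hi' ∷ rs) {G} hi≤M (link , hi'≤M , L) A = go link
    where
    unlinked : ∀ lo hi lo' hi' → hi ≤ M → hi' ≤ M → Linked M lo' hi' rs → (H : Graded) →
               (∀ bs → Alternating ((lo ℕ.+ hi) ℕ.+ centre lo' hi' rs) (H bs)) →
               interval lo hi (λ y → interval lo' hi' (λ y' → rowSum y' rs (λ bs z → H bs (y ℕ.+ z)))) ≈ 0#
    unlinked lo hi lo' hi' hi≤M hi'≤M L H A = trans (interval-swap lo hi lo' hi' _) (trans
      (interval-cong lo' hi' (λ y' _ _ → rowSum-interval y' rs lo hi (λ y bs z → H bs (y ℕ.+ z))))
      (rows-zero lo' hi' rs hi'≤M L (λ bs → alternating-interval lo hi hi≤M (A bs))))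
    const-case : ∀ b → interval lo hi (λ y → interval lo' hi' (λ y' → rowSum y' rs (λ bs z → G (b ∷ bs) (y ℕ.+ z)))) ≈ 0#
    const-case b = unlinked lo hi lo' hi' hi≤M hi'≤M L (λ bs → G (b ∷ bs)) (λ bs → A (b ∷ bs))
    D : Graded
    D bs z = G (true ∷ bs) z - G (false ∷ bs) z
    D-alternating : ∀ {K} → (∀ bs → Alternating K (G bs)) → ∀ bs → Alternating K (D bs)
    D-alternating A bs = mkAlt
      (λ a b e → trans (+-interchange _ _ _ _) (trans (+-cong (anti (A (true ∷ bs)) a b e)
         (trans (-‿+-comm _ _) (trans (-‿cong (anti (A (false ∷ bs)) a b e)) -0#≈0#))) (+-identityˡ 0#)))
      (λ a e → trans (+-cong (fixed (A (true ∷ bs)) a e) (trans (-‿cong (fixed (A (false ∷ bs)) a e)) -0#≈0#)) (+-identityˡ 0#))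
    go : Link lo hi X lo' hi' → interval lo hi (λ y → rowSum y (row X lo' hi' ∷ rs) G) ≈ 0#
    go (constant b e) = trans (interval-cong lo hi (λ y p q → interval-cong lo' hi' (λ y' p' q' →
      reflexive (≡.cong (λ x → rowSum y' rs (λ bs z → G (x ∷ bs) (y ℕ.+ z))) (e y y' p q p' q'))))) (const-case b)
    go (subBox l u lo≤l u≤hi' mid to from) = begin
      interval lo hi (λ y → interval lo' hi' (λ y' → rowSum y' rs (λ bs z → G (X y y' ∷ bs) (y ℕ.+ z))))
        ≈⟨ interval-cong lo hi (λ y p q → trans (interval-cong lo' hi' (λ y' p' q' → split y y' p q p' q')) (interval-+ lo' hi' _ _)) ⟩
      interval lo hi (λ y → interval lo' hi' (λ y' → rowSum y' rs (λ bs z → G (false ∷ bs) (y ℕ.+ z))) + interval lo' hi' (λ y' → when (l ℕ.≤? y) (when (y' ℕ.≤? u) (T y y'))))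
        ≈⟨ interval-+ lo hi _ _ ⟩
      _ + interval lo hi (λ y → interval lo' hi' (λ y' → when (l ℕ.≤? y) (when (y' ℕ.≤? u) (T y y'))))
        ≈⟨ +-cong (const-case false) (trans restrict (unlinked l hi lo' u hi≤M (ℕₚ.≤-trans u≤hi' hi'≤M) (linked-shrink rs u≤hi' L) D
             (D-alternating (λ bs → ≡.subst (λ K → Alternating K (G bs)) same (A bs))))) ⟩
      0# + 0#
        ≈⟨ +-identityˡ 0# ⟩
      0# ∎
      where
      T : ℕ → ℕ → Carrier
      T y y' = rowSum y' rs (λ bs z → D bs (y ℕ.+ z))
      add-back : ∀ a b → b ≈ a + (b - a)
      add-back a b = sym (trans (+-comm a (b - a)) (trans (+-assoc b (- a) a) (trans (+-congˡ (-‿inverseˡ a)) (+-identityʳ b))))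
      split : ∀ y y' → lo ≤ y → y ≤ hi → lo' ≤ y' → y' ≤ hi' →
              rowSum y' rs (λ bs z → G (X y y' ∷ bs) (y ℕ.+ z)) ≈ rowSum y' rs (λ bs z → G (false ∷ bs) (y ℕ.+ z)) + when (l ℕ.≤? y) (when (y' ℕ.≤? u) (T y y'))
      split y y' p q p' q' with X y y' in eq
      ... | true  = trans (rowSum-cong y' rs (λ bs z → add-back (G (false ∷ bs) (y ℕ.+ z)) (G (true ∷ bs) (y ℕ.+ z))))
                    (trans (rowSum-+ y' rs _ _) (+-congˡ (sym (trans (when-yes (l ℕ.≤? y) (proj₁ (to y y' p q p' q' eq))) (when-yes (y' ℕ.≤? u) (proj₂ (to y y' p q p' q' eq)))))))
      ... | false = trans (sym (+-identityʳ _)) (+-congˡ (sym (when-zero (l ℕ.≤? y) (λ c → when-no (y' ℕ.≤? u) (λ d → case (≡.trans (≡.sym eq) (from y y' p q p' q' c d)))))))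
        where
        case : ¬ false ≡ true
        case ()
      restrict : interval lo hi (λ y → interval lo' hi' (λ y' → when (l ℕ.≤? y) (when (y' ℕ.≤? u) (T y y')))) ≈ interval l hi (λ y → interval lo' u (T y))
      restrict = ∑-cong (range (suc M)) (λ y → begin
        when (between? lo hi y) (interval lo' hi' (λ y' → when (l ℕ.≤? y) (when (y' ℕ.≤? u) (T y y'))))
          ≈⟨ when-congʳ (between? lo hi y) (λ _ → trans (∑-cong (range (suc M)) (λ y' → when-comm (between? lo' hi' y') (l ℕ.≤? y)))
               (trans (sym (when-∑ (l ℕ.≤? y) (range (suc M)) _)) (when-congʳ (l ℕ.≤? y) (λ _ → inner y)))) ⟩
        when (between? lo hi y) (when (l ℕ.≤? y) (interval lo' u (T y)))
          ≈⟨ when-× (between? lo hi y) (l ℕ.≤? y) ⟨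
        when (between? lo hi y ×-dec (l ℕ.≤? y)) (interval lo' u (T y))
          ≈⟨ when-cong (between? lo hi y ×-dec (l ℕ.≤? y)) (between? l hi y) (λ ((_ , q) , c) → c , q) (λ (c , q) → (ℕₚ.≤-trans lo≤l c , q) , c) (λ _ → refl) ⟩
        when (between? l hi y) (interval lo' u (T y)) ∎)
        where
        inner : ∀ y → ∑ (range (suc M)) (λ y' → when (between? lo' hi' y') (when (y' ℕ.≤? u) (T y y'))) ≈ interval lo' u (T y)
        inner y = ∑-cong (range (suc M)) (λ y' → trans (sym (when-× (between? lo' hi' y') (y' ℕ.≤? u)))
          (when-cong (between? lo' hi' y' ×-dec (y' ℕ.≤? u)) (between? lo' u y') (λ ((p , _) , c) → p , c) (λ (p , c) → (p , ℕₚ.≤-trans c u≤hi') , c) (λ _ → refl)))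
      -- The sub-box raises the first lower end from lo to l and lowers the second upper end from
      -- hi' to u by the same amount, since l + u = lo + hi'.
      same : (lo ℕ.+ hi) ℕ.+ centre lo' hi' rs ≡ (l ℕ.+ hi) ℕ.+ centre lo' u rs
      same = ≡.trans (≡.cong ((lo ℕ.+ hi) ℕ.+_) (≡.sym (centre-hi lo' hi' u rs d (ℕₚ.m+[n∸m]≡n u≤hi'))))
        (≡.trans (solve 4 (λ lo hi c d → (lo :+ hi) :+ (c :+ d) := ((lo :+ d) :+ hi) :+ c) ≡.refl lo hi (centre lo' u rs) d)
          (≡.cong (λ w → (w ℕ.+ hi) ℕ.+ centre lo' u rs) lo+d≡l))
        where
        open +-*-Solver
        d = hi' ℕ.∸ u
        lo+d≡l : lo ℕ.+ d ≡ l
        lo+d≡l = ℕₚ.+-cancelʳ-≡ u (lo ℕ.+ d) l (≡.trans (ℕₚ.+-assoc lo d u) (≡.trans (≡.cong (lo ℕ.+_) (ℕₚ.m∸n+n≡m u≤hi')) (≡.sym mid)))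

-- Between consecutive nodes of a level lie one node of the level below and one of the level above.
gapsFrom : {X : Set} → ∀ {k} → X → Vec X k → Vec X k → Vec (X × X) (suc k)
gapsFrom P []       []       = (P , P) ∷ []
gapsFrom P (p ∷ ps) (q ∷ qs) = (P , q) ∷ gapsFrom p ps qs

-- The outermost gaps contain one node each, the first of the upper and the last of the lower level.
-- That node is doubled so that all gaps are pairs.
gaps : {X : Set} → ∀ {k} → Vec X (suc k) → Vec X (suc k) → Vec (X × X) (suc (suc k))
gaps p (q ∷ qs) = gapsFrom q p (q ∷ qs)

module InGaps {X : Set} (E : X → X → Set) where
  private module I = Interlacing E

  Between : ∀ {k} → Vec (X × X) (suc k) → Vec X k → Set
  Between (g ∷ [])      []       = ⊤
  Between (g ∷ g' ∷ gs) (y ∷ ys) = ((E y (proj₁ g) × E y (proj₂ g)) × (E (proj₁ g') y × E (proj₂ g') y)) × Between (g' ∷ gs) ys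

  zig⇒betweenFrom : ∀ {k} P (p y q : Vec X k) → I.Below P y → I.Zig p y → I.Zig y q → Between (gapsFrom P p q) y
  zig⇒betweenFrom P []            []            []            _ _ _ = tt
  zig⇒betweenFrom P (p ∷ [])      (y ∷ [])      (q ∷ [])      a (b , _) (c , _) = ((a , c) , (b , b)) , tt
  zig⇒betweenFrom P (p ∷ ps@(_ ∷ _)) (y ∷ ys@(_ ∷ _)) (q ∷ qs@(_ ∷ _)) a (b , b' , z) (c , c' , w) =
    ((a , c) , (b , c')) , zig⇒betweenFrom p ps ys qs b' z w

  betweenFrom⇒zig : ∀ {k} P (p y q : Vec X k) → Between (gapsFrom P p q) y → I.Below P y × I.Zig p y × I.Zig y q
  betweenFrom⇒zig P []            []            []            _ = tt , tt , tt
  betweenFrom⇒zig P (p ∷ [])      (y ∷ [])      (q ∷ [])      (((a , c) , (b , _)) , _) = a , (b , tt , tt) , (c , tt , tt)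
  betweenFrom⇒zig P (p ∷ ps@(_ ∷ _)) (y ∷ ys@(_ ∷ _)) (q ∷ qs@(_ ∷ _)) (((a , c) , (b , c')) , B) with betweenFrom⇒zig p ps ys qs B
  ... | b' , z , w = a , (b , b' , z) , (c , c' , w)

  zig⇒between : ∀ {k} (p y q : Vec X (suc k)) → I.Zig p y → I.Zig y q → Between (gaps p q) y
  zig⇒between p (y ∷ ys) (q ∷ qs) z w = zig⇒betweenFrom q p (y ∷ ys) (q ∷ qs) (proj₁ w) z w

  between⇒zig : ∀ {k} (p y q : Vec X (suc k)) → Between (gaps p q) y → I.Zig p y × I.Zig y q
  between⇒zig p y (q ∷ qs) B = proj₂ (betweenFrom⇒zig q p y (q ∷ qs) B)

-- Connectivity through a level

Gap LGap : Set
Gap  = Node × Node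
LGap = LNode × LNode

hiᴿ loᴿ hiᴮ loᴮ : Gap → ℕ
hiᴿ (P , Q) = proj₁ P ⊔ proj₁ Q
loᴿ (P , Q) = proj₁ P ⊓ proj₁ Q
hiᴮ (P , Q) = proj₂ P ⊔ proj₂ Q
loᴮ (P , Q) = proj₂ P ⊓ proj₂ Q

-- These two kinds of bits carry all the information on connectivity through a level.
oddBit : (A B : ℕ) → ℕ → ℕ → Bool
oddBit A B r b = ⌊ b ℕ.<? A ⌋ ∧ ⌊ B ℕ.<? r ⌋

evenBit : (A B : ℕ) → ℕ → ℕ → Bool
evenBit A B b r = ⌊ B ℕ.≤? b ⌋ ∧ ⌊ r ℕ.≤? A ⌋

mutual
  -- An odd bit is true when its node ties a node of the gap after it to a node of the gap before
  -- it. An even bit is false when one of the two nodes around a gap is tied to both nodes of the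
  -- gap, so that these must share a label. Tied means that `⊑⁺` forces equal labels.
  bits : ∀ {k} → Vec Gap (suc k) → Level k → List Bool
  bits (g ∷ [])      []             = []
  bits (g ∷ g' ∷ gs) ((r , b) ∷ ys) = oddBit (hiᴿ g') (loᴮ g) r b ∷ bitsBelow b (g' ∷ gs) ys

  bitsBelow : ∀ {k} → ℕ → Vec Gap (suc k) → Level k → List Bool
  bitsBelow b (g ∷ [])      []       = []
  bitsBelow b (g ∷ g' ∷ gs) (y ∷ ys) = evenBit (hiᴮ g) (loᴿ g) b (proj₁ y) ∷ bits (g ∷ g' ∷ gs) (y ∷ ys)

strip : LGap → Gap
strip (x , y) = proj₁ x , proj₁ y

strips : ∀ {k} → Vec LGap k → Vec Gap k
strips = Vec.map strip

-- A node tied to anything in the gap below it is tied to the larger red there, and a node tied to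
-- anything in the gap above it is tied to the smaller blue there. These two nodes carry the
-- decisive labels.
redMax blueMin : LGap → Bool
redMax  ((P , f) , (Q , h)) = if ⌊ proj₁ Q ℕ.≤? proj₁ P ⌋ then f else h
blueMin ((P , f) , (Q , h)) = if ⌊ proj₂ P ℕ.≤? proj₂ Q ⌋ then f else h

SameLabel : LGap → Set
SameLabel (x , y) = proj₂ x ≡ proj₂ y

mutual
  Compatible : ∀ {k} → Vec LGap (suc k) → List Bool → Set
  Compatible (g ∷ [])      bs       = ⊤
  Compatible (g ∷ g' ∷ gs) []       = ⊤
  Compatible (g ∷ g' ∷ gs) (x ∷ bs) = (x ≡ true → redMax g' ≡ blueMin g) × CompatibleBelow (g' ∷ gs) bs

  CompatibleBelow : ∀ {k} → Vec LGap (suc k) → List Bool → Set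
  CompatibleBelow (g ∷ [])      bs       = ⊤
  CompatibleBelow (g ∷ g' ∷ gs) []       = ⊤
  CompatibleBelow (g ∷ g' ∷ gs) (x ∷ bs) = (x ≡ false → SameLabel g) × Compatible (g ∷ g' ∷ gs) bs

mutual
  compatible? : ∀ {k} (gs : Vec LGap (suc k)) bs → Dec (Compatible gs bs)
  compatible? (g ∷ [])      bs       = yes tt
  compatible? (g ∷ g' ∷ gs) []       = yes tt
  compatible? (g ∷ g' ∷ gs) (x ∷ bs) = ((x Bool.≟ true) →-dec (redMax g' Bool.≟ blueMin g)) ×-dec compatibleBelow? (g' ∷ gs) bs

  compatibleBelow? : ∀ {k} (gs : Vec LGap (suc k)) bs → Dec (CompatibleBelow gs bs)
  compatibleBelow? (g ∷ [])      bs       = yes tt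
  compatibleBelow? (g ∷ g' ∷ gs) []       = yes tt
  compatibleBelow? (g ∷ g' ∷ gs) (x ∷ bs) = ((x Bool.≟ false) →-dec (proj₂ (proj₁ g) Bool.≟ proj₂ (proj₂ g))) ×-dec compatible? (g ∷ g' ∷ gs) bs

AboveGap BelowGap : LNode → LGap → Set
AboveGap y g = (proj₁ g ⊑⁺ y) × (proj₂ g ⊑⁺ y)
BelowGap y g = (y ⊑⁺ proj₁ g) × (y ⊑⁺ proj₂ g)

above-redMax : ∀ r b f g → AboveGap ((r , b) , f) g → b < hiᴿ (strip g) → redMax g ≡ f
above-redMax r b f ((P , _) , (Q , _)) (p , q) lt with proj₁ Q ℕ.≤? proj₁ P
... | yes le = p (≡.subst (b <_) (ℕₚ.m≥n⇒m⊔n≡m le) lt)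
... | no ¬le = q (≡.subst (b <_) (ℕₚ.m≤n⇒m⊔n≡n (ℕₚ.<⇒≤ (ℕₚ.≰⇒> ¬le))) lt)

below-blueMin : ∀ r b f g → BelowGap ((r , b) , f) g → loᴮ (strip g) < r → f ≡ blueMin g
below-blueMin r b f ((P , _) , (Q , _)) (p , q) lt with proj₂ P ℕ.≤? proj₂ Q
... | yes le = p (≡.subst (_< r) (ℕₚ.m≤n⇒m⊓n≡m le) lt)
... | no ¬le = q (≡.subst (_< r) (ℕₚ.m≥n⇒m⊓n≡n (ℕₚ.<⇒≤ (ℕₚ.≰⇒> ¬le))) lt)

above-same : ∀ r b f g → AboveGap ((r , b) , f) g → b < loᴿ (strip g) → SameLabel g
above-same r b f ((P , _) , (Q , _)) (p , q) lt =
  ≡.trans (p (ℕₚ.<-≤-trans lt (ℕₚ.m⊓n≤m (proj₁ P) (proj₁ Q)))) (≡.sym (q (ℕₚ.<-≤-trans lt (ℕₚ.m⊓n≤n (proj₁ P) (proj₁ Q)))))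

below-same : ∀ r b f g → BelowGap ((r , b) , f) g → hiᴮ (strip g) < r → SameLabel g
below-same r b f ((P , _) , (Q , _)) (p , q) lt =
  ≡.trans (≡.sym (p (ℕₚ.≤-<-trans (ℕₚ.m≤m⊔n (proj₂ P) (proj₂ Q)) lt))) (q (ℕₚ.≤-<-trans (ℕₚ.m≤n⊔m (proj₂ P) (proj₂ Q)) lt))

oddBit-true : ∀ A B r b → oddBit A B r b ≡ true → b < A × B < r
oddBit-true A B r b e with b ℕ.<? A | B ℕ.<? r
... | yes p | yes q = p , q
oddBit-true A B r b () | yes p | no q
oddBit-true A B r b () | no p  | _

oddBit-true⁻¹ : ∀ A B r b → b < A → B < r → oddBit A B r b ≡ true
oddBit-true⁻¹ A B r b p q with b ℕ.<? A | B ℕ.<? r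
... | yes _ | yes _ = ≡.refl
... | yes _ | no ¬q = ⊥-elim (¬q q)
... | no ¬p | _     = ⊥-elim (¬p p)

evenBit-true : ∀ A B b r → evenBit A B b r ≡ true → B ≤ b × r ≤ A
evenBit-true A B b r e with B ℕ.≤? b | r ℕ.≤? A
... | yes p | yes q = p , q
evenBit-true A B b r () | yes p | no q
evenBit-true A B b r () | no p  | _

evenBit-true⁻¹ : ∀ A B b r → B ≤ b → r ≤ A → evenBit A B b r ≡ true
evenBit-true⁻¹ A B b r p q with B ℕ.≤? b | r ℕ.≤? A
... | yes _ | yes _ = ≡.refl
... | yes _ | no ¬q = ⊥-elim (¬q q)
... | no ¬p | _     = ⊥-elim (¬p p)

open InGaps

mutual
  between⇒compatible : ∀ {k} (gs : Vec LGap (suc k)) (y : Level k) f → Between _⊑⁺_ gs (zip y f) → Compatible gs (bits (strips gs) y)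
  between⇒compatible (g ∷ [])      []             []       _ = tt
  between⇒compatible (g ∷ g' ∷ gs) ((r , b) ∷ ys) (f ∷ fs) ((bel , abo) , B) =
    (λ e → let (p , q) = oddBit-true _ _ r b e in ≡.trans (above-redMax r b f g' abo p) (below-blueMin r b f g bel q)) ,
    between⇒compatibleBelow r b f (g' ∷ gs) ys fs abo B

  between⇒compatibleBelow : ∀ {k} r b f (gs : Vec LGap (suc k)) (y : Level k) fs → AboveGap ((r , b) , f) (Vec.head gs) → Between _⊑⁺_ gs (zip y fs) →
                            CompatibleBelow gs (bitsBelow b (strips gs) y)
  between⇒compatibleBelow r b f (g ∷ [])      []       []       abo _ = tt
  between⇒compatibleBelow r b f (g ∷ g' ∷ gs) ((r' , b') ∷ ys) (f' ∷ fs) abo B@((bel , _) , _) =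
    even , between⇒compatible (g ∷ g' ∷ gs) ((r' , b') ∷ ys) (f' ∷ fs) B
    where
    even : evenBit (hiᴮ (strip g)) (loᴿ (strip g)) b r' ≡ false → SameLabel g
    even e with loᴿ (strip g) ℕ.≤? b | r' ℕ.≤? hiᴮ (strip g)
    even () | yes _ | yes _
    ... | yes _ | no ¬q = below-same r' b' f' g bel (ℕₚ.≰⇒> ¬q)
    ... | no ¬p | _     = above-same r b f g abo (ℕₚ.≰⇒> ¬p)

redMax-above : ∀ r b g → (b < loᴿ (strip g) → SameLabel g) → AboveGap ((r , b) , redMax g) g
redMax-above r b ((P , f) , (Q , h)) same with proj₁ Q ℕ.≤? proj₁ P
... | yes le = (λ _ → ≡.refl) , (λ lt → ≡.sym (same (≡.subst (b <_) (≡.sym (ℕₚ.m≥n⇒m⊓n≡n le)) lt)))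
... | no ¬le = (λ lt → same (≡.subst (b <_) (≡.sym (ℕₚ.m≤n⇒m⊓n≡m (ℕₚ.<⇒≤ (ℕₚ.≰⇒> ¬le)))) lt)) , (λ _ → ≡.refl)

blueMin-below : ∀ r b g → (hiᴮ (strip g) < r → SameLabel g) → BelowGap ((r , b) , blueMin g) g
blueMin-below r b ((P , f) , (Q , h)) same with proj₂ P ℕ.≤? proj₂ Q
... | yes le = (λ _ → ≡.refl) , (λ lt → same (≡.subst (_< r) (≡.sym (ℕₚ.m≤n⇒m⊔n≡n le)) lt))
... | no ¬le = (λ lt → ≡.sym (same (≡.subst (_< r) (≡.sym (ℕₚ.m≥n⇒m⊔n≡m (ℕₚ.<⇒≤ (ℕₚ.≰⇒> ¬le)))) lt))) , (λ _ → ≡.refl)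

-- A tie to the gap below forces `redMax g'`, a tie to the gap above `blueMin g`, and when both
-- occur the odd bit makes them agree. If a tie reaches both nodes of a gap, U or L provides their
-- common label.
chooseLabel : ∀ r b g g' → (oddBit (hiᴿ (strip g')) (loᴮ (strip g)) r b ≡ true → redMax g' ≡ blueMin g) →
              (hiᴮ (strip g) < r → SameLabel g) → (b < loᴿ (strip g') → SameLabel g') →
              ∃ λ f → BelowGap ((r , b) , f) g × AboveGap ((r , b) , f) g'
chooseLabel r b g g' odd U L with b ℕ.<? hiᴿ (strip g') | loᴮ (strip g) ℕ.<? r
... | yes p | yes q = redMax g' , ≡.subst (λ f → BelowGap ((r , b) , f) g) (≡.sym (odd ≡.refl)) (blueMin-below r b g U) , redMax-above r b g' L
... | yes p | no ¬q = redMax g' , ((λ lt → ⊥-elim (¬q (ℕₚ.≤-<-trans (ℕₚ.m⊓n≤m _ _) lt))) , (λ lt → ⊥-elim (¬q (ℕₚ.≤-<-trans (ℕₚ.m⊓n≤n _ _) lt)))) , redMax-above r b g' L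
... | no ¬p | _     = blueMin g , blueMin-below r b g U , ((λ lt → ⊥-elim (¬p (ℕₚ.<-≤-trans lt (ℕₚ.m≤m⊔n _ _)))) , (λ lt → ⊥-elim (¬p (ℕₚ.<-≤-trans lt (ℕₚ.m≤n⊔m _ _)))))

HeadSame : ∀ {k} → Vec LGap (suc k) → Level k → Set
HeadSame gs      []             = ⊤
HeadSame (g ∷ _) ((r , b) ∷ ys) = hiᴮ (strip g) < r → SameLabel g

-- The nodes of one level are not tied to each other, so their labels are chosen independently. The
-- even bit of an inner gap gives the required equality on both of its sides; at the outermost gaps
-- the hypotheses on head and last do.
compatible⇒between : ∀ {k} (gs : Vec LGap (suc k)) (y : Level k) → HeadSame gs y → SameLabel (Vec.last gs) →
                     Compatible gs (bits (strips gs) y) → ∃ λ f → Between _⊑⁺_ gs (zip y f)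
compatible⇒between (g ∷ [])           []                   _ _    _          = [] , tt
compatible⇒between (g ∷ g' ∷ [])      ((r , b) ∷ [])       U last (odd , _)  with chooseLabel r b g g' odd U (λ _ → last)
... | f , bel , abo = f ∷ [] , (bel , abo) , tt
compatible⇒between (g ∷ g' ∷ g'' ∷ gs) ((r , b) ∷ (r' , b') ∷ ys) U last (odd , even , C) with
    chooseLabel r b g g' odd U (λ lt → even (low lt)) | compatible⇒between (g' ∷ g'' ∷ gs) ((r' , b') ∷ ys) (λ lt → even (high lt)) last C
  where
  low : b < loᴿ (strip g') → evenBit (hiᴮ (strip g')) (loᴿ (strip g')) b r' ≡ false
  low lt with loᴿ (strip g') ℕ.≤? b
  ... | yes le = ⊥-elim (ℕₚ.<⇒≱ lt le)
  ... | no _   = ≡.refl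
  high : hiᴮ (strip g') < r' → evenBit (hiᴮ (strip g')) (loᴿ (strip g')) b r' ≡ false
  high lt with loᴿ (strip g') ℕ.≤? b | r' ℕ.≤? hiᴮ (strip g')
  ... | _     | yes le = ⊥-elim (ℕₚ.<⇒≱ lt le)
  ... | yes _ | no _   = ≡.refl
  ... | no _  | no _   = ≡.refl
... | f , bel , abo | fs , B = f ∷ fs , (bel , abo) , B

strips-gapsFrom : ∀ {k} P (p q : Vec LNode k) → strips (gapsFrom P p q) ≡ gapsFrom (proj₁ P) (Vec.map proj₁ p) (Vec.map proj₁ q)
strips-gapsFrom P []       []       = ≡.refl
strips-gapsFrom P (p ∷ ps) (q ∷ qs) = ≡.cong ((proj₁ P , proj₁ q) ∷_) (strips-gapsFrom p ps qs)

strips-gaps : ∀ {k} (p q : Vec LNode (suc k)) → strips (gaps p q) ≡ gaps (Vec.map proj₁ p) (Vec.map proj₁ q)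
strips-gaps p (q ∷ qs) = strips-gapsFrom q p (q ∷ qs)

gaps-last : ∀ {k} P (p q : Vec LNode k) → SameLabel (Vec.last (gapsFrom P p q))
gaps-last P []            []       = ≡.refl
gaps-last P (p ∷ [])      (q ∷ []) = ≡.refl
gaps-last P (p ∷ p' ∷ ps) (q ∷ q' ∷ qs) = gaps-last p (p' ∷ ps) (q' ∷ qs)

gaps-head : ∀ {k} (p q : Vec LNode (suc k)) (y : Level (suc k)) → HeadSame (gaps p q) y
gaps-head (p ∷ ps) (q ∷ qs) ((r , b) ∷ ys) _ = ≡.refl

-- Whether the labels of the two neighbouring levels extend to the level y is decided by the bits of y alone.
cut⇒compatible : ∀ {k} (p q : Vec LNode (suc k)) (y : Level (suc k)) f → Plus.Zig p (zip y f) → Plus.Zig (zip y f) q →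
                 Compatible (gaps p q) (bits (gaps (Vec.map proj₁ p) (Vec.map proj₁ q)) y)
cut⇒compatible p q y f a b = ≡.subst (λ gs → Compatible (gaps p q) (bits gs y)) (strips-gaps p q)
  (between⇒compatible (gaps p q) y f (zig⇒between _⊑⁺_ p (zip y f) q a b))

compatible⇒cut : ∀ {k} (p q : Vec LNode (suc k)) (y : Level (suc k)) → Compatible (gaps p q) (bits (gaps (Vec.map proj₁ p) (Vec.map proj₁ q)) y) →
                 ∃ λ f → Plus.Zig p (zip y f) × Plus.Zig (zip y f) q
compatible⇒cut p q@(q₀ ∷ qs) y C with compatible⇒between (gaps p q) y (gaps-head p q y) (gaps-last q₀ p q)
    (≡.subst (λ gs → Compatible (gaps p q) (bits gs y)) (≡.sym (strips-gaps p q)) C)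
... | f , B = f , between⇒zig _⊑⁺_ p (zip y f) q B

-- Boxes of possible values below a cut

open import Data.Nat using (_+_)

-- The values sharing with v the part at or above t: everything up to t if the row starts at or below t, else v alone.
rangeLo : (A t v : ℕ) → ℕ
rangeLo A t v with A ℕ.≤? t
... | yes _ = A
... | no _  = v

rangeHi : (A B t v : ℕ) → ℕ
rangeHi A B t v with A ℕ.≤? t
... | yes _ = B ⊓ t
... | no _  = v

-- The hypothesis `settled` rules out A ≤ t < v. There v alone would have its part at or above t,
-- and the formula of `range-centre` would fail unless A = t.
range-iff : ∀ A B t v → A ≤ v → v ≤ B → (A ≤ t → v ≤ t) → ∀ y →
            ((A ≤ y × y ≤ B) × y ⊔ t ≡ v ⊔ t → rangeLo A t v ≤ y × y ≤ rangeHi A B t v) ×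
            (rangeLo A t v ≤ y × y ≤ rangeHi A B t v → (A ≤ y × y ≤ B) × y ⊔ t ≡ v ⊔ t)
range-iff A B t v A≤v v≤B settled y with A ℕ.≤? t
... | yes A≤t = (λ ((p , q) , e) → p , ℕₚ.⊓-glb q (ℕₚ.≤-trans (ℕₚ.m≤m⊔n y t) (ℕₚ.≤-reflexive (≡.trans e (ℕₚ.m≤n⇒m⊔n≡n (settled A≤t)))))) ,
                (λ (p , q) → (p , ℕₚ.≤-trans q (ℕₚ.m⊓n≤m B t)) , ≡.trans (ℕₚ.m≤n⇒m⊔n≡n (ℕₚ.≤-trans q (ℕₚ.m⊓n≤n B t))) (≡.sym (ℕₚ.m≤n⇒m⊔n≡n (settled A≤t))))
... | no A≰t = (λ ((p , q) , e) → let y≡v = ≡.trans (≡.sym (up y p)) (≡.trans e (up v A≤v)) in ℕₚ.≤-reflexive (≡.sym y≡v) , ℕₚ.≤-reflexive y≡v) ,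
               (λ (p , q) → let y≡v = ℕₚ.≤-antisym q p in (ℕₚ.≤-trans A≤v p , ℕₚ.≤-trans q v≤B) , ≡.cong (_⊔ t) y≡v)
  where
  up : ∀ y → A ≤ y → y ⊔ t ≡ y
  up y p = ℕₚ.m≥n⇒m⊔n≡m (ℕₚ.≤-trans (ℕₚ.<⇒≤ (ℕₚ.≰⇒> A≰t)) p)

rangeHi≤ : ∀ A B t v M → v ≤ B → B ≤ M → rangeHi A B t v ≤ M
rangeHi≤ A B t v M v≤B B≤M with A ℕ.≤? t
... | yes _ = ℕₚ.≤-trans (ℕₚ.m⊓n≤m B t) B≤M
... | no _  = ℕₚ.≤-trans v≤B B≤M

range-centre : ∀ A B t v → A ≤ v → v ≤ B → (A ≤ t → v ≤ t) →
               (rangeLo A t v + rangeHi A B t v) + ((A ⊔ t) + (B ⊔ t)) ≡ (A + B) + ((v ⊔ t) + (v ⊔ t))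
range-centre A B t v A≤v v≤B settled with A ℕ.≤? t
... | yes A≤t rewrite ℕₚ.m≤n⇒m⊔n≡n A≤t | ℕₚ.m≤n⇒m⊔n≡n (settled A≤t) = ≡.trans
      (solve 4 (λ a m t x → (a :+ m) :+ (t :+ x) := (a :+ t) :+ (m :+ x)) ≡.refl A (B ⊓ t) t (B ⊔ t))
      (≡.trans (≡.cong ((A + t) ℕ.+_) (⊓+⊔ B t)) (solve 3 (λ a b t → (a :+ t) :+ (b :+ t) := (a :+ b) :+ (t :+ t)) ≡.refl A B t))
  where
  open +-*-Solver
  ⊓+⊔ : ∀ m n → (m ⊓ n) + (m ⊔ n) ≡ m + n
  ⊓+⊔ m n with ℕₚ.≤-total m n
  ... | inj₁ le = ≡.cong₂ _+_ (ℕₚ.m≤n⇒m⊓n≡m le) (ℕₚ.m≤n⇒m⊔n≡n le)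
  ... | inj₂ ge = ≡.trans (≡.cong₂ _+_ (ℕₚ.m≥n⇒m⊓n≡n ge) (ℕₚ.m≥n⇒m⊔n≡m ge)) (ℕₚ.+-comm n m)
... | no A≰t = ≡.trans (≡.cong ((v + v) ℕ.+_) (≡.cong₂ _+_ (up A t≤A) (up B (ℕₚ.≤-trans t≤A (ℕₚ.≤-trans A≤v v≤B)))))
    (≡.trans (ℕₚ.+-comm (v + v) (A + B)) (≡.cong ((A + B) ℕ.+_) (≡.sym (≡.cong₂ _+_ (up v (ℕₚ.≤-trans t≤A A≤v)) (up v (ℕₚ.≤-trans t≤A A≤v))))))
  where
  t≤A : t ≤ A
  t≤A = ℕₚ.<⇒≤ (ℕₚ.≰⇒> A≰t)
  up : ∀ y → t ≤ y → y ⊔ t ≡ y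
  up y p = ℕₚ.m≥n⇒m⊔n≡m p

not-true : ∀ {b} → ¬ b ≡ true → b ≡ false
not-true {false} _ = ≡.refl
not-true {true}  e = ⊥-elim (e ≡.refl)

-- If the blue interval is truncated, then r ≤ t ≤ t' + 1 ≤ Bᵇ and the bit is false. Otherwise the
-- ends Aʳ and Bᵇ of the box are the thresholds of the bit, and Bᵇ < r, b < Aʳ describes the sub-box
-- with l + u = (Bᵇ + 1) + (Aʳ - 1). A row frozen beyond the cut leaves the bit constant.
odd-link : ∀ {Aʳ Bʳ vʳ Aᵇ Bᵇ vᵇ t t'} → Aʳ ≤ vʳ → Aᵇ ≤ vᵇ → vᵇ ≤ Bᵇ → t' ≤ t → t ≤ suc t' →
           Link (rangeLo Aʳ t vʳ) (rangeHi Aʳ Bʳ t vʳ) (oddBit Aʳ Bᵇ) (rangeLo Aᵇ t' vᵇ) (rangeHi Aᵇ Bᵇ t' vᵇ)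
odd-link {Aʳ} {Bʳ} {vʳ} {Aᵇ} {Bᵇ} {vᵇ} {t} {t'} a₁ a₂ b₂ t'≤t t≤t' with Aʳ ℕ.≤? t | Aᵇ ℕ.≤? t'
... | no r> | no b> = constant (oddBit Aʳ Bᵇ vʳ vᵇ) (λ r b p q p' q' → ≡.cong₂ (oddBit Aʳ Bᵇ) (ℕₚ.≤-antisym q p) (ℕₚ.≤-antisym q' p'))
... | yes r≤ | no b> = constant false (λ r b p q p' q' → not-true (λ e → ℕₚ.<⇒≱ (proj₁ (oddBit-true Aʳ Bᵇ r b e))
        (ℕₚ.≤-trans r≤ (ℕₚ.≤-trans t≤t' (ℕₚ.≤-trans (ℕₚ.≰⇒> b>) (ℕₚ.≤-trans a₂ p'))))))
... | no r> | yes b≤ with Bᵇ ℕ.<? vʳ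
...   | yes lt = constant true (λ r b p q p' q' → oddBit-true⁻¹ Aʳ Bᵇ r b (ℕₚ.≤-<-trans (ℕₚ.≤-trans q' (ℕₚ.m⊓n≤n Bᵇ t')) (ℕₚ.≤-<-trans t'≤t (ℕₚ.≰⇒> r>))) (ℕₚ.<-≤-trans lt p))
...   | no ¬lt = constant false (λ r b p q p' q' → not-true (λ e → ¬lt (ℕₚ.<-≤-trans (proj₂ (oddBit-true Aʳ Bᵇ r b e)) q)))
odd-link {Aʳ} {Bʳ} {vʳ} {Aᵇ} {Bᵇ} {vᵇ} {t} {t'} a₁ a₂ b₂ t'≤t t≤t' | yes r≤ | yes b≤ with Bᵇ ℕ.≤? t'
... | no trunc = constant false (λ r b p q p' q' → not-true (λ e → ℕₚ.<⇒≱ (proj₂ (oddBit-true Aʳ Bᵇ r b e)) (ℕₚ.≤-trans (ℕₚ.≤-trans q (ℕₚ.m⊓n≤n Bʳ t)) (ℕₚ.≤-trans t≤t' (ℕₚ.≰⇒> trunc)))))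
... | yes B≤t' rewrite ℕₚ.m≤n⇒m⊓n≡m B≤t' with Bᵇ ℕ.<? Aʳ
...   | yes sep = constant true (λ r b p q p' q' → oddBit-true⁻¹ Aʳ Bᵇ r b (ℕₚ.≤-<-trans q' sep) (ℕₚ.<-≤-trans sep p))
...   | no ¬sep = meeting Aʳ (ℕₚ.≮⇒≥ ¬sep)
  where
  meeting : ∀ A → A ≤ Bᵇ → Link A (Bʳ ⊓ t) (oddBit A Bᵇ) Aᵇ Bᵇ
  -- No blue value lies below 0; the upper end A - 1 of the sub-box would not be a natural number.
  meeting zero    A≤B = constant false (λ r b p q p' q' → not-true (λ e → ⊥-elim (ℕₚ.n≮0 (proj₁ (oddBit-true 0 Bᵇ r b e)))))
  meeting (suc A) A≤B = subBox (suc Bᵇ) A (ℕₚ.m≤n⇒m≤1+n A≤B) (ℕₚ.<⇒≤ A≤B) (≡.cong suc (ℕₚ.+-comm Bᵇ A))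
    (λ r b _ _ _ _ e → let (p , q) = oddBit-true (suc A) Bᵇ r b e in q , ℕₚ.≤-pred p)
    (λ r b _ _ _ _ p q → oddBit-true⁻¹ (suc A) Bᵇ r b (s≤s q) p)

-- The thresholds are again ends of the box, now with weak inequalities, so that l = Bʳ and u = Aᵇ.
-- A truncated red interval makes the bit false through b ≤ t' ≤ t < Bʳ.
even-link : ∀ {Aᵇ Bᵇ vᵇ Aʳ Bʳ vʳ t t'} → Aʳ ≤ vʳ → t' ≤ t → t ≤ suc t' →
            Link (rangeLo Aᵇ t' vᵇ) (rangeHi Aᵇ Bᵇ t' vᵇ) (evenBit Aᵇ Bʳ) (rangeLo Aʳ t vʳ) (rangeHi Aʳ Bʳ t vʳ)
even-link {Aᵇ} {Bᵇ} {vᵇ} {Aʳ} {Bʳ} {vʳ} {t} {t'} a₁ t'≤t t≤t' with Aᵇ ℕ.≤? t' | Aʳ ℕ.≤? t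
... | no b> | no r> = constant (evenBit Aᵇ Bʳ vᵇ vʳ) (λ b r p q p' q' → ≡.cong₂ (evenBit Aᵇ Bʳ) (ℕₚ.≤-antisym q p) (ℕₚ.≤-antisym q' p'))
... | yes b≤ | no r> = constant false (λ b r p q p' q' → not-true (λ e → r> (ℕₚ.≤-trans a₁ (ℕₚ.≤-trans p' (ℕₚ.≤-trans (proj₂ (evenBit-true Aᵇ Bʳ b r e)) (ℕₚ.≤-trans b≤ t'≤t))))))
... | no b> | yes r≤ with Bʳ ℕ.≤? vᵇ
...   | yes le = constant true (λ b r p q p' q' → evenBit-true⁻¹ Aᵇ Bʳ b r (ℕₚ.≤-trans le p) (ℕₚ.≤-trans (ℕₚ.≤-trans q' (ℕₚ.m⊓n≤n Bʳ t)) (ℕₚ.≤-trans t≤t' (ℕₚ.≰⇒> b>))))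
...   | no ¬le = constant false (λ b r p q p' q' → not-true (λ e → ¬le (ℕₚ.≤-trans (proj₁ (evenBit-true Aᵇ Bʳ b r e)) q)))
even-link {Aᵇ} {Bᵇ} {vᵇ} {Aʳ} {Bʳ} {vʳ} {t} {t'} a₁ t'≤t t≤t' | yes b≤ | yes r≤ with Bʳ ℕ.≤? t
... | no trunc = constant false (λ b r p q p' q' → not-true (λ e → trunc (ℕₚ.≤-trans (proj₁ (evenBit-true Aᵇ Bʳ b r e)) (ℕₚ.≤-trans (ℕₚ.≤-trans q (ℕₚ.m⊓n≤n Bᵇ t')) t'≤t))))
... | yes B≤t rewrite ℕₚ.m≤n⇒m⊓n≡m B≤t with Bʳ ℕ.≤? Aᵇ
...   | yes sep = constant true (λ b r p q p' q' → evenBit-true⁻¹ Aᵇ Bʳ b r (ℕₚ.≤-trans sep p) (ℕₚ.≤-trans q' sep))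
...   | no ¬sep = subBox Bʳ Aᵇ (ℕₚ.<⇒≤ (ℕₚ.≰⇒> ¬sep)) (ℕₚ.<⇒≤ (ℕₚ.≰⇒> ¬sep)) (ℕₚ.+-comm Bʳ Aᵇ)
    (λ b r _ _ _ _ e → evenBit-true Aᵇ Bʳ b r e) (λ b r _ _ _ _ p q → evenBit-true⁻¹ Aᵇ Bʳ b r p q)

Fits : Gap → Node → Gap → Set
Fits g (r , b) g' = ((hiᴿ g' ≤ r × r ≤ loᴿ g) × (hiᴮ g' ≤ b × b ≤ loᴮ g))

FitsAll : ∀ {k} → Vec Gap (suc k) → Level k → Set
FitsAll (g ∷ [])      []       = ⊤
FitsAll (g ∷ g' ∷ gs) (y ∷ ys) = Fits g y g' × FitsAll (g' ∷ gs) ys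

between⇒fits : ∀ {k} (gs : Vec Gap (suc k)) y → InGaps.Between _⊑_ gs y → FitsAll gs y
between⇒fits (g ∷ [])      []       _ = tt
between⇒fits (g ∷ g' ∷ gs) (y ∷ ys) ((((a , a') , (b , b')) , ((c , c') , (d , d'))) , B) =
  ((ℕₚ.⊔-lub c d , ℕₚ.⊓-glb a b) , (ℕₚ.⊔-lub c' d' , ℕₚ.⊓-glb a' b')) , between⇒fits (g' ∷ gs) ys B

fits⇒between : ∀ {k} (gs : Vec Gap (suc k)) y → FitsAll gs y → InGaps.Between _⊑_ gs y
fits⇒between (g ∷ [])      []       _ = tt
fits⇒between (g ∷ g' ∷ gs) (y ∷ ys) (((c , a) , (d , b)) , B) =
  (((ℕₚ.≤-trans a (ℕₚ.m⊓n≤m _ _) , ℕₚ.≤-trans b (ℕₚ.m⊓n≤m _ _)) , (ℕₚ.≤-trans a (ℕₚ.m⊓n≤n _ _) , ℕₚ.≤-trans b (ℕₚ.m⊓n≤n _ _))) ,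
   ((ℕₚ.≤-trans (ℕₚ.m≤m⊔n _ _) c , ℕₚ.≤-trans (ℕₚ.m≤m⊔n _ _) d) , (ℕₚ.≤-trans (ℕₚ.m≤n⊔m _ _) c , ℕₚ.≤-trans (ℕₚ.m≤n⊔m _ _) d))) , fits⇒between (g' ∷ gs) ys B

fits? : ∀ {k} (gs : Vec Gap (suc k)) y → Dec (FitsAll gs y)
fits? (g ∷ [])      []             = yes tt
fits? (g ∷ g' ∷ gs) ((r , b) ∷ ys) = (between? (hiᴿ g') (loᴿ g) r ×-dec between? (hiᴮ g') (loᴮ g) b) ×-dec fits? (g' ∷ gs) ys

GapsBounded : ∀ {k} → ℕ → Vec Gap (suc k) → Set
GapsBounded {zero}  M (g ∷ [])      = ⊤
GapsBounded {suc k} M (g ∷ g' ∷ gs) = (loᴿ g ≤ M × loᴮ g ≤ M) × GapsBounded M (g' ∷ gs)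

ends : ∀ {k} → (ℕ → ℕ) → (ℕ → ℕ) → Vec Gap (suc k) → ℕ
ends φ ψ (g ∷ [])      = 0
ends φ ψ (g ∷ g' ∷ gs) = ((φ (hiᴿ g') + φ (loᴿ g)) + (ψ (hiᴮ g') + ψ (loᴮ g))) + ends φ ψ (g' ∷ gs)

mapᴺ : (ℕ → ℕ) → (ℕ → ℕ) → Node → Node
mapᴺ φ ψ (r , b) = φ r , ψ b

-- Raising the entries to the cut forgets the unread columns, those up to t in red and up to t' in
-- blue. Differences between the sums of consecutive cut levels give the content read so far.
cutᴺ : (t t' : ℕ) → Node → Node
cutᴺ t t' = mapᴺ (_⊔ t) (_⊔ t')

cut : ∀ (t t' : ℕ) {k} → Level k → Level k
cut t t' = Vec.map (cutᴺ t t')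

-- In each column blue is read before red, so the cuts that occur are (t' , t') and (t' + 1 , t').
-- This is what the two inequalities say.
module Cutting (t t' : ℕ) (t'≤t : t' ≤ t) (t≤t' : t ≤ suc t') where

  Settledᴺ : Node → Gap → Set
  Settledᴺ (r , b) g' = (hiᴿ g' ≤ t → r ≤ t) × (hiᴮ g' ≤ t' → b ≤ t')

  Settled : ∀ {k} → Vec Gap (suc k) → Level k → Set
  Settled (g ∷ [])      []       = ⊤
  Settled (g ∷ g' ∷ gs) (y ∷ ys) = Settledᴺ y g' × Settled (g' ∷ gs) ys

  redLo redHi blueLo blueHi : Gap → Node → Gap → ℕ
  redLo  g y g' = rangeLo (hiᴿ g') t (proj₁ y)
  redHi  g y g' = rangeHi (hiᴿ g') (loᴿ g) t (proj₁ y)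
  blueLo g y g' = rangeLo (hiᴮ g') t' (proj₂ y)
  blueHi g y g' = rangeHi (hiᴮ g') (loᴮ g) t' (proj₂ y)

  blueRow : Gap → Node → Gap → Row
  blueRow g y g' = row (oddBit (hiᴿ g') (loᴮ g)) (blueLo g y g') (blueHi g y g')

  rowsBelow : ∀ {k} → Vec Gap (suc k) → Level k → List Row
  rowsBelow (g ∷ [])      []       = []
  rowsBelow (g ∷ g' ∷ gs) (y ∷ ys) = row (evenBit (hiᴮ g) (loᴿ g)) (redLo g y g') (redHi g y g') ∷ blueRow g y g' ∷ rowsBelow (g' ∷ gs) ys

  linked : ∀ {k} M g y g' (gs : Vec Gap k) (ys : Level k) → GapsBounded M (g ∷ g' ∷ gs) → Fits g y g' → FitsAll (g' ∷ gs) ys →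
           Linked M (redLo g y g') (redHi g y g') (blueRow g y g' ∷ rowsBelow (g' ∷ gs) ys)
  linked M g y g' []         []        ((_ , bb) , _) ((ar , br) , (ab , bl)) _ =
    odd-link ar ab bl t'≤t t≤t' , rangeHi≤ (hiᴮ g') (loᴮ g) t' _ M bl bb , tt
  linked M g y g' (g'' ∷ gs) (y' ∷ ys) ((_ , bb) , B@((b'r , b'b) , _)) ((ar , br) , (ab , bl)) (F@((ar' , br') , _) , Fs) =
    odd-link ar ab bl t'≤t t≤t' , rangeHi≤ (hiᴮ g') (loᴮ g) t' _ M bl bb ,
    even-link {Aᵇ = hiᴮ g'} ar' t'≤t t≤t' , rangeHi≤ (hiᴿ g'') (loᴿ g') t _ M br' b'r , linked M g' y' g'' gs ys B F Fs

  -- The sum of `range-centre` over all rows. It expresses the centre of the box through the uncut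
  -- ends and through the cut content, for which the violation gives an equation.
  centre-below : ∀ {k} lo hi (gs : Vec Gap (suc k)) ys → FitsAll gs ys → Settled gs ys →
                 centre lo hi (rowsBelow gs ys) + ends (_⊔ t) (_⊔ t') gs ≡ (lo + hi) + (ends id id gs + (∣ cut t t' ys ∣ᴸ + ∣ cut t t' ys ∣ᴸ))
  centre-below lo hi (g ∷ [])      []             _ _ = ≡.refl
  centre-below lo hi (g ∷ g' ∷ gs) ((r , b) ∷ ys) (((ar , br) , (ab , bb)) , F) ((sr , sb) , S) =
    arith (lo + hi) (redLo g (r , b) g' + redHi g (r , b) g') _ (centre (blueLo g (r , b) g') (blueHi g (r , b) g') (rowsBelow (g' ∷ gs) ys)) _
      (ends (_⊔ t) (_⊔ t') (g' ∷ gs)) (hiᴿ g' + loᴿ g) (r ⊔ t) (blueLo g (r , b) g' + blueHi g (r , b) g') (ends id id (g' ∷ gs)) ∣ cut t t' ys ∣ᴸ (hiᴮ g' + loᴮ g) (b ⊔ t')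
      (range-centre (hiᴿ g') (loᴿ g) t r ar br sr) (centre-below (blueLo g (r , b) g') (blueHi g (r , b) g') (g' ∷ gs) ys F S)
      (range-centre (hiᴮ g') (loᴮ g) t' b ab bb sb)
    where
    open +-*-Solver
    arith : ∀ L R E C E' T A x B I Y A' z → R + E ≡ A + (x + x) → C + T ≡ B + (I + (Y + Y)) → B + E' ≡ A' + (z + z) →
            (L + (R + C)) + ((E + E') + T) ≡ L + (((A + A') + I) + (((x + z) + Y) + ((x + z) + Y)))
    arith L R E C E' T A x B I Y A' z h ih h' = ≡.trans
      (solve 6 (λ L R E C E' T → (L :+ (R :+ C)) :+ ((E :+ E') :+ T) := L :+ ((R :+ E) :+ ((C :+ T) :+ E'))) ≡.refl L R E C E' T)
      (≡.cong (L ℕ.+_) (≡.trans (≡.cong₂ (λ u w → u + (w + E')) h ih) (≡.trans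
        (solve 6 (λ A x B I Y E' → (A :+ (x :+ x)) :+ ((B :+ (I :+ (Y :+ Y))) :+ E') := (A :+ (x :+ x)) :+ ((B :+ E') :+ (I :+ (Y :+ Y)))) ≡.refl A x B I Y E')
        (≡.trans (≡.cong (λ w → (A + (x + x)) + (w + (I + (Y + Y)))) h')
          (solve 6 (λ A x A' z I Y → (A :+ (x :+ x)) :+ ((A' :+ (z :+ z)) :+ (I :+ (Y :+ Y))) := ((A :+ A') :+ I) :+ (((x :+ z) :+ Y) :+ ((x :+ z) :+ Y))) ≡.refl A x A' z I Y)))))

ends-gapsFrom : ∀ φ ψ {k} P (p q : Level k) →
  (φ (hiᴿ (Vec.head (gapsFrom P p q))) + ψ (hiᴮ (Vec.head (gapsFrom P p q)))) + ends φ ψ (gapsFrom P p q) ≡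
  (φ (proj₁ P) + ψ (proj₂ P)) + (∣ Vec.map (mapᴺ φ ψ) p ∣ᴸ + ∣ Vec.map (mapᴺ φ ψ) q ∣ᴸ)
ends-gapsFrom φ ψ P []       []       = ≡.cong (_+ 0) (≡.cong₂ (λ x y → φ x + ψ y) (ℕₚ.⊔-idem (proj₁ P)) (ℕₚ.⊔-idem (proj₂ P)))
ends-gapsFrom φ ψ P (p ∷ ps) (q ∷ qs) = arith (φ (proj₁ P ⊔ proj₁ q)) (φ (proj₁ P ⊓ proj₁ q)) (ψ (proj₂ P ⊔ proj₂ q)) (ψ (proj₂ P ⊓ proj₂ q))
    (φ (proj₁ P)) (ψ (proj₂ P)) (φ (proj₁ q)) (ψ (proj₂ q)) _ _ (φ (proj₁ p)) (ψ (proj₂ p)) ∣ Vec.map (mapᴺ φ ψ) ps ∣ᴸ ∣ Vec.map (mapᴺ φ ψ) qs ∣ᴸ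
    (pick φ (proj₁ P) (proj₁ q)) (pick ψ (proj₂ P) (proj₂ q)) (split φ ψ (gapsFrom p ps qs)) (ends-gapsFrom φ ψ p ps qs)
  where
  open +-*-Solver
  pick : ∀ (φ : ℕ → ℕ) a b → φ (a ⊔ b) + φ (a ⊓ b) ≡ φ a + φ b
  pick φ a b with ℕₚ.≤-total a b
  ... | inj₁ le = ≡.trans (≡.cong₂ (λ x y → φ x + φ y) (ℕₚ.m≤n⇒m⊔n≡n le) (ℕₚ.m≤n⇒m⊓n≡m le)) (ℕₚ.+-comm (φ b) (φ a))
  ... | inj₂ ge = ≡.cong₂ (λ x y → φ x + φ y) (ℕₚ.m≥n⇒m⊔n≡m ge) (ℕₚ.m≥n⇒m⊓n≡n ge)
  split : ∀ φ ψ {k} (gs : Vec Gap (suc k)) {g} →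
          ends φ ψ (g ∷ gs) ≡ (φ (loᴿ g) + ψ (loᴮ g)) + ((φ (hiᴿ (Vec.head gs)) + ψ (hiᴮ (Vec.head gs))) + ends φ ψ gs)
  split φ ψ (g' ∷ gs) {g} = solve 5 (λ a b c d e → ((a :+ b) :+ (c :+ d)) :+ e := (b :+ d) :+ ((a :+ c) :+ e)) ≡.refl
    (φ (hiᴿ g')) (φ (loᴿ g)) (ψ (hiᴮ g')) (ψ (loᴮ g)) (ends φ ψ (g' ∷ gs))
  arith : ∀ H L H' L' a b c d E T x y u w → H + L ≡ a + c → H' + L' ≡ b + d → E ≡ (L + L') + T → T ≡ (x + y) + (u + w) →
          (H + H') + E ≡ (a + b) + (((x + y) + u) + ((c + d) + w))
  arith H L H' L' a b c d E T x y u w e e' ≡.refl ≡.refl = ≡.trans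
    (solve 8 (λ H L H' L' x y u w → (H :+ H') :+ ((L :+ L') :+ ((x :+ y) :+ (u :+ w))) := ((H :+ L) :+ (H' :+ L')) :+ ((x :+ y) :+ (u :+ w))) ≡.refl H L H' L' x y u w)
    (≡.trans (≡.cong₂ (λ m n → (m + n) + ((x + y) + (u + w))) e e')
      (solve 8 (λ a b c d x y u w → ((a :+ c) :+ (b :+ d)) :+ ((x :+ y) :+ (u :+ w)) := (a :+ b) :+ (((x :+ y) :+ u) :+ ((c :+ d) :+ w))) ≡.refl a b c d x y u w))

-- An inner gap bounds one row by its maximum and one by its minimum, which together contribute its
-- two nodes. An outermost gap bounds a single row, so its doubled node is counted once.
ends-gaps : ∀ φ ψ {k} (p q : Level (suc k)) → ends φ ψ (gaps p q) ≡ ∣ Vec.map (mapᴺ φ ψ) p ∣ᴸ + ∣ Vec.map (mapᴺ φ ψ) q ∣ᴸ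
ends-gaps φ ψ (p ∷ ps) (q ∷ qs) = ℕₚ.+-cancelˡ-≡ (φ (proj₁ q) + ψ (proj₂ q)) _ _ (≡.trans
  (≡.cong (_+ ends φ ψ (gaps (p ∷ ps) (q ∷ qs))) (≡.sym (≡.cong₂ (λ x y → φ x + ψ y) (ℕₚ.⊔-idem (proj₁ q)) (ℕₚ.⊔-idem (proj₂ q)))))
  (ends-gapsFrom φ ψ q (p ∷ ps) (q ∷ qs)))

-- The first violation of the partition condition

Triple : Set
Triple = ℕ × ℕ × ℕ

redTriples blueTriples : ∀ {k} → Vec Gap (suc k) → Level k → List Triple
redTriples (g ∷ [])      []             = []
redTriples (g ∷ g' ∷ gs) ((r , b) ∷ ys) = (hiᴿ g' , r , loᴿ g) ∷ redTriples (g' ∷ gs) ys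
blueTriples (g ∷ [])      []             = []
blueTriples (g ∷ g' ∷ gs) ((r , b) ∷ ys) = (hiᴮ g' , b , loᴮ g) ∷ blueTriples (g' ∷ gs) ys

endsOf valuesOf : ℕ → List Triple → ℕ
endsOf t []                 = 0
endsOf t ((A , v , B) ∷ ts) = ((A ⊔ t) + (B ⊔ t)) + endsOf t ts
valuesOf t []                 = 0
valuesOf t ((A , v , B) ∷ ts) = (v ⊔ t) + valuesOf t ts

Under : ℕ → List Triple → Set
Under m []                 = ⊤
Under m ((A , v , B) ∷ ts) = B ≤ m

Stacked : List Triple → Set
Stacked []                 = ⊤
Stacked ((A , v , B) ∷ ts) = (A ≤ v × v ≤ B) × Under A ts × Stacked ts

SettledAt : ℕ → List Triple → Set
SettledAt t []                 = ⊤
SettledAt t ((A , v , B) ∷ ts) = (A ≤ t → v ≤ t) × SettledAt t ts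

-- Lowering the cut by one changes twice the values minus the ends by -1, 0 or 1, and only the value +1 is compatible with an unsettled row.
data Step (t : ℕ) (ts : List Triple) : Set where
  up   : (valuesOf (suc t) ts + valuesOf (suc t) ts) + endsOf t ts + 1 ≡ (valuesOf t ts + valuesOf t ts) + endsOf (suc t) ts + 0 → Step t ts
  down : SettledAt t ts → (valuesOf (suc t) ts + valuesOf (suc t) ts) + endsOf t ts + 0 ≡ (valuesOf t ts + valuesOf t ts) + endsOf (suc t) ts + 1 → Step t ts
  flat : SettledAt t ts → (valuesOf (suc t) ts + valuesOf (suc t) ts) + endsOf t ts + 0 ≡ (valuesOf t ts + valuesOf t ts) + endsOf (suc t) ts + 0 → Step t ts

module Stepping (t : ℕ) where
  open +-*-Solver

  low₀ : ∀ {x} → x ≤ t → x ⊔ t ≡ t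
  low₀ p = ℕₚ.m≤n⇒m⊔n≡n p
  low₁ : ∀ {x} → x ≤ t → x ⊔ suc t ≡ suc t
  low₁ p = ℕₚ.m≤n⇒m⊔n≡n (ℕₚ.m≤n⇒m≤1+n p)
  high₀ : ∀ {x} → t < x → x ⊔ t ≡ x
  high₀ p = ℕₚ.m≥n⇒m⊔n≡m (ℕₚ.<⇒≤ p)
  high₁ : ∀ {x} → t < x → x ⊔ suc t ≡ x
  high₁ p = ℕₚ.m≥n⇒m⊔n≡m p

  combine : ∀ v₁ v₀ a₁ a₀ V₁ V₀ S₁ S₀ {e f e' f'} → (v₁ + v₁) + a₀ + e ≡ (v₀ + v₀) + a₁ + f → (V₁ + V₁) + S₀ + e' ≡ (V₀ + V₀) + S₁ + f' →
            ((v₁ + V₁) + (v₁ + V₁)) + (a₀ + S₀) + (e + e') ≡ ((v₀ + V₀) + (v₀ + V₀)) + (a₁ + S₁) + (f + f')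
  combine v₁ v₀ a₁ a₀ V₁ V₀ S₁ S₀ {e} {f} {e'} {f'} p q = ≡.trans (shape v₁ V₁ a₀ S₀ e e') (≡.trans (≡.cong₂ _+_ p q) (≡.sym (shape v₀ V₀ a₁ S₁ f f')))
    where
    shape : ∀ v V a S e e' → ((v + V) + (v + V)) + (a + S) + (e + e') ≡ ((v + v) + a + e) + ((V + V) + S + e')
    shape = solve 6 (λ v V a S e e' → ((v :+ V) :+ (v :+ V)) :+ (a :+ S) :+ (e :+ e') := ((v :+ v) :+ a :+ e) :+ ((V :+ V) :+ S :+ e')) ≡.refl

  RowEq : Triple → ℕ → ℕ → Set
  RowEq (A , v , B) e f = ((v ⊔ suc t) + (v ⊔ suc t)) + ((A ⊔ t) + (B ⊔ t)) + e ≡ ((v ⊔ t) + (v ⊔ t)) + ((A ⊔ suc t) + (B ⊔ suc t)) + f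

  row-high : ∀ {A v B} → A ≤ v → v ≤ B → t < A → RowEq (A , v , B) 0 0
  row-high p q lt rewrite high₀ lt | high₁ lt | high₀ (ℕₚ.<-≤-trans lt p) | high₁ (ℕₚ.<-≤-trans lt p)
    | high₀ (ℕₚ.<-≤-trans lt (ℕₚ.≤-trans p q)) | high₁ (ℕₚ.<-≤-trans lt (ℕₚ.≤-trans p q)) = ≡.refl

  row-low : ∀ {A v B} → A ≤ v → v ≤ B → B ≤ t → RowEq (A , v , B) 0 0
  row-low p q le rewrite low₀ le | low₁ le | low₀ (ℕₚ.≤-trans q le) | low₁ (ℕₚ.≤-trans q le) | low₀ (ℕₚ.≤-trans p (ℕₚ.≤-trans q le)) | low₁ (ℕₚ.≤-trans p (ℕₚ.≤-trans q le)) =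
    solve 1 (λ t → (((con 1 :+ t) :+ (con 1 :+ t)) :+ (t :+ t)) :+ con 0 := ((t :+ t) :+ ((con 1 :+ t) :+ (con 1 :+ t))) :+ con 0) ≡.refl t

  row-down : ∀ {A v B} → A ≤ v → v ≤ t → t < B → RowEq (A , v , B) 0 1
  row-down {B = B} p le lt rewrite low₀ le | low₁ le | low₀ (ℕₚ.≤-trans p le) | low₁ (ℕₚ.≤-trans p le) | high₀ lt | high₁ lt =
    solve 2 (λ t B → (((con 1 :+ t) :+ (con 1 :+ t)) :+ (t :+ B)) :+ con 0 := ((t :+ t) :+ ((con 1 :+ t) :+ B)) :+ con 1) ≡.refl t B

  row-up : ∀ {A v B} → v ≤ B → A ≤ t → t < v → RowEq (A , v , B) 1 0
  row-up {v = v} {B} q le lt rewrite low₀ le | low₁ le | high₀ lt | high₁ lt | high₀ (ℕₚ.<-≤-trans lt q) | high₁ (ℕₚ.<-≤-trans lt q) =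
    solve 3 (λ t v B → ((v :+ v) :+ (t :+ B)) :+ con 1 := ((v :+ v) :+ ((con 1 :+ t) :+ B)) :+ con 0) ≡.refl t v B

  below-flat : ∀ ts m → m ≤ t → Under m ts → Stacked ts →
               SettledAt t ts × (valuesOf (suc t) ts + valuesOf (suc t) ts) + endsOf t ts + 0 ≡ (valuesOf t ts + valuesOf t ts) + endsOf (suc t) ts + 0
  below-flat []                 m m≤t u s = tt , ≡.refl
  below-flat ((A , v , B) ∷ ts) m m≤t u ((p , q) , u' , s) with below-flat ts A (ℕₚ.≤-trans p (ℕₚ.≤-trans q (ℕₚ.≤-trans u m≤t))) u' s
  ... | S , E = ((λ _ → ℕₚ.≤-trans q (ℕₚ.≤-trans u m≤t)) , S) ,
                combine (v ⊔ suc t) (v ⊔ t) _ _ (valuesOf (suc t) ts) (valuesOf t ts) _ _ (row-low p q (ℕₚ.≤-trans u m≤t)) E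

  -- The intervals are stacked, so at most one row has A ≤ t < B. Rows entirely above or entirely
  -- below t balance out. The exceptional row alone decides: it gives `down` when v ≤ t and `up`
  -- when v > t.
  step : ∀ ts → Stacked ts → Step t ts
  step []                 _ = flat tt ≡.refl
  step ((A , v , B) ∷ ts) ((p , q) , u , s) with A ℕ.≤? t
  ... | no A≰t with step ts s
  ...   | up e     = up (combine (v ⊔ suc t) (v ⊔ t) _ _ (valuesOf (suc t) ts) (valuesOf t ts) _ _ (row-high p q (ℕₚ.≰⇒> A≰t)) e)
  ...   | down S e = down ((λ le → ⊥-elim (A≰t le)) , S) (combine (v ⊔ suc t) (v ⊔ t) _ _ (valuesOf (suc t) ts) (valuesOf t ts) _ _ (row-high p q (ℕₚ.≰⇒> A≰t)) e)
  ...   | flat S e = flat ((λ le → ⊥-elim (A≰t le)) , S) (combine (v ⊔ suc t) (v ⊔ t) _ _ (valuesOf (suc t) ts) (valuesOf t ts) _ _ (row-high p q (ℕₚ.≰⇒> A≰t)) e)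
  step ((A , v , B) ∷ ts) ((p , q) , u , s) | yes A≤t with below-flat ts A A≤t u s | v ℕ.≤? t | B ℕ.≤? t
  ... | S , e | yes v≤t | yes B≤t = flat ((λ _ → v≤t) , S) (combine (v ⊔ suc t) (v ⊔ t) _ _ (valuesOf (suc t) ts) (valuesOf t ts) _ _ (row-low p q B≤t) e)
  ... | S , e | yes v≤t | no B≰t  = down ((λ _ → v≤t) , S) (combine (v ⊔ suc t) (v ⊔ t) _ _ (valuesOf (suc t) ts) (valuesOf t ts) _ _ (row-down p v≤t (ℕₚ.≰⇒> B≰t)) e)
  ... | S , e | no v≰t  | _       = up (combine (v ⊔ suc t) (v ⊔ t) _ _ (valuesOf (suc t) ts) (valuesOf t ts) _ _ (row-up q A≤t (ℕₚ.≰⇒> v≰t)) e)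

-- X is the colour whose column was read last, Z the other one.
first-violation : ∀ tx tz xs zs → Step tx xs → Step tz zs →
  let X₁ = valuesOf (suc tx) xs + valuesOf (suc tx) xs ; X₀ = valuesOf tx xs + valuesOf tx xs
      Z₁ = valuesOf (suc tz) zs + valuesOf (suc tz) zs ; Z₀ = valuesOf tz zs + valuesOf tz zs in
  X₀ + Z₀ < endsOf tx xs + endsOf tz zs → endsOf (suc tx) xs + endsOf tz zs ≤ X₁ + Z₀ → endsOf (suc tx) xs + endsOf (suc tz) zs ≤ X₁ + Z₁ →
  SettledAt tx xs × SettledAt tz zs × endsOf tx xs + endsOf tz zs ≡ suc (X₀ + Z₀)
first-violation tx tz xs zs sx sz = go sx sz
  where
  open +-*-Solver
  impossible : ∀ {a b c} → a < b → b + c ≡ a + 0 → ⊥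
  impossible {a} {b} {c} lt e = ℕₚ.<⇒≱ lt (ℕₚ.≤-trans (ℕₚ.m≤m+n b c) (ℕₚ.≤-reflexive (≡.trans e (ℕₚ.+-identityʳ a))))
  strict : ∀ X₁ X₀ Z S₁ S₀ T → X₀ + Z < S₀ + T → S₁ + T ≤ X₁ + Z → X₀ + S₁ < X₁ + S₀
  strict X₁ X₀ Z S₁ S₀ T p q = ℕₚ.+-cancelʳ-< (Z + T) (X₀ + S₁) (X₁ + S₀) (≡.subst₂ _<_
    (solve 4 (λ a z s t → (a :+ z) :+ (s :+ t) := (a :+ s) :+ (z :+ t)) ≡.refl X₀ Z S₁ T)
    (solve 4 (λ s t a z → (s :+ t) :+ (a :+ z) := (a :+ s) :+ (z :+ t)) ≡.refl S₀ T X₁ Z) (ℕₚ.+-mono-<-≤ p q))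
  exact-≤ : ∀ X₁ X₀ Z S₁ S₀ T → S₁ + T ≤ X₁ + Z → X₁ + S₀ + 0 ≡ X₀ + S₁ + 1 → S₀ + T ≤ suc (X₀ + Z)
  exact-≤ X₁ X₀ Z S₁ S₀ T q e = ℕₚ.+-cancelˡ-≤ X₁ (S₀ + T) (suc (X₀ + Z)) (≡.subst₂ _≤_
    (≡.trans (solve 3 (λ a s t → ((a :+ s) :+ con 1) :+ t := ((a :+ s) :+ con 1) :+ t) ≡.refl X₀ S₁ T) (≡.trans (≡.cong (_+ T) (≡.sym e)) (solve 3 (λ a s t → ((a :+ s) :+ con 0) :+ t := a :+ (s :+ t)) ≡.refl X₁ S₀ T)))
    (solve 3 (λ a z x → (x :+ con 1) :+ (a :+ z) := a :+ (con 1 :+ (x :+ z))) ≡.refl X₁ Z X₀)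
    (≡.subst (_≤ (X₀ + 1) + (X₁ + Z)) (solve 3 (λ a s t → (a :+ con 1) :+ (s :+ t) := ((a :+ s) :+ con 1) :+ t) ≡.refl X₀ S₁ T) (ℕₚ.+-monoʳ-≤ (X₀ + 1) q)))
  tight : ∀ X₁ X₀ Z S₁ S₀ T → X₀ + Z < S₀ + T → X₁ + S₀ + 0 ≡ X₀ + S₁ + 1 → X₁ + Z ≤ S₁ + T
  tight X₁ X₀ Z S₁ S₀ T p e = ℕₚ.+-cancelˡ-≤ (X₀ + 1) (X₁ + Z) (S₁ + T) (≡.subst₂ _≤_
    (solve 3 (λ a x z → a :+ (con 1 :+ (x :+ z)) := (x :+ con 1) :+ (a :+ z)) ≡.refl X₁ X₀ Z)
    (≡.trans (solve 3 (λ a s t → a :+ (s :+ t) := ((a :+ s) :+ con 0) :+ t) ≡.refl X₁ S₀ T) (≡.trans (≡.cong (_+ T) e) (solve 3 (λ a s t → ((a :+ s) :+ con 1) :+ t := (a :+ con 1) :+ (s :+ t)) ≡.refl X₀ S₁ T)))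
    (ℕₚ.+-monoʳ-≤ X₁ p))
  no-up : ∀ X₁ Z₁ Z₀ S₁ T₁ T₀ → S₁ + T₁ ≤ X₁ + Z₁ → X₁ + Z₀ ≤ S₁ + T₀ → Z₁ + T₀ + 1 ≡ Z₀ + T₁ + 0 → ⊥
  no-up X₁ Z₁ Z₀ S₁ T₁ T₀ p q e = ℕₚ.1+n≰n (≡.subst (_≤ Z₁ + T₀) (≡.trans (≡.sym (ℕₚ.+-identityʳ _)) (≡.trans (≡.sym e) (ℕₚ.+-comm (Z₁ + T₀) 1)))
    (ℕₚ.+-cancelʳ-≤ (S₁ + X₁) (Z₀ + T₁) (Z₁ + T₀) (≡.subst₂ _≤_
      (solve 4 (λ s t x z → (s :+ t) :+ (x :+ z) := (z :+ t) :+ (s :+ x)) ≡.refl S₁ T₁ X₁ Z₀)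
      (solve 4 (λ x z s t → (x :+ z) :+ (s :+ t) := (z :+ t) :+ (s :+ x)) ≡.refl X₁ Z₁ S₁ T₀) (ℕₚ.+-mono-≤ p q))))
  Y : ℕ → List Triple → ℕ
  Y t ts = valuesOf t ts + valuesOf t ts
  X₁ = Y (suc tx) xs
  X₀ = Y tx xs
  Z₁ = Y (suc tz) zs
  Z₀ = Y tz zs
  S₁ = endsOf (suc tx) xs
  S₀ = endsOf tx xs
  T₁ = endsOf (suc tz) zs
  T₀ = endsOf tz zs
  -- Let D be twice the values minus the ends. It is nonnegative at the two earlier cuts and
  -- negative now, so reading X lowered it from 0 to -1. Had reading Z raised it, D would have been
  -- -1 one cut earlier.
  go : Step tx xs → Step tz zs → X₀ + Z₀ < S₀ + T₀ → S₁ + T₀ ≤ X₁ + Z₀ → S₁ + T₁ ≤ X₁ + Z₁ →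
       SettledAt tx xs × SettledAt tz zs × S₀ + T₀ ≡ suc (X₀ + Z₀)
  go (up e)     _ viol ok₁ ok₂ = ⊥-elim (impossible (strict X₁ X₀ Z₀ S₁ S₀ T₀ viol ok₁) e)
  go (flat _ e) _ viol ok₁ ok₂ = ⊥-elim (impossible (strict X₁ X₀ Z₀ S₁ S₀ T₀ viol ok₁) e)
  go (down S e) (up e')     viol ok₁ ok₂ = ⊥-elim (no-up X₁ Z₁ Z₀ S₁ T₁ T₀ ok₂ (tight X₁ X₀ Z₀ S₁ S₀ T₀ viol e) e')
  go (down S e) (down S' _) viol ok₁ ok₂ = S , S' , ℕₚ.≤-antisym (exact-≤ X₁ X₀ Z₀ S₁ S₀ T₀ ok₁ e) viol
  go (down S e) (flat S' _) viol ok₁ ok₂ = S , S' , ℕₚ.≤-antisym (exact-≤ X₁ X₀ Z₀ S₁ S₀ T₀ ok₁ e) viol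

red-stacked : ∀ {k} (gs : Vec Gap (suc k)) y → FitsAll gs y → Stacked (redTriples gs y)
red-stacked (g ∷ [])      []             _ = tt
red-stacked (g ∷ g' ∷ [])      ((r , b) ∷ [])             ((F , _) , _) = F , tt , tt
red-stacked (g ∷ g' ∷ g'' ∷ gs) ((r , b) ∷ (r' , b') ∷ ys) ((F , _) , Fs) = F , ℕₚ.m⊓n≤m⊔n (proj₁ (proj₁ g')) (proj₁ (proj₂ g')) , red-stacked (g' ∷ g'' ∷ gs) ((r' , b') ∷ ys) Fs

blue-stacked : ∀ {k} (gs : Vec Gap (suc k)) y → FitsAll gs y → Stacked (blueTriples gs y)
blue-stacked (g ∷ [])      []             _ = tt
blue-stacked (g ∷ g' ∷ [])      ((r , b) ∷ [])             ((_ , F) , _) = F , tt , tt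
blue-stacked (g ∷ g' ∷ g'' ∷ gs) ((r , b) ∷ (r' , b') ∷ ys) ((_ , F) , Fs) = F , ℕₚ.m⊓n≤m⊔n (proj₂ (proj₁ g')) (proj₂ (proj₂ g')) , blue-stacked (g' ∷ g'' ∷ gs) ((r' , b') ∷ ys) Fs

ends-triples : ∀ {k} t t' (gs : Vec Gap (suc k)) y → ends (_⊔ t) (_⊔ t') gs ≡ endsOf t (redTriples gs y) + endsOf t' (blueTriples gs y)
ends-triples t t' (g ∷ [])      []             = ≡.refl
ends-triples t t' (g ∷ g' ∷ gs) ((r , b) ∷ ys) = ≡.trans (≡.cong (_ ℕ.+_) (ends-triples t t' (g' ∷ gs) ys))
  (solve 4 (λ a b c d → (a :+ b) :+ (c :+ d) := (a :+ c) :+ (b :+ d)) ≡.refl ((hiᴿ g' ⊔ t) + (loᴿ g ⊔ t)) ((hiᴮ g' ⊔ t') + (loᴮ g ⊔ t')) (endsOf t (redTriples (g' ∷ gs) ys)) (endsOf t' (blueTriples (g' ∷ gs) ys)))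
  where open +-*-Solver

cut-triples : ∀ {k} t t' (gs : Vec Gap (suc k)) y → ∣ cut t t' y ∣ᴸ ≡ valuesOf t (redTriples gs y) + valuesOf t' (blueTriples gs y)
cut-triples t t' (g ∷ [])      []             = ≡.refl
cut-triples t t' (g ∷ g' ∷ gs) ((r , b) ∷ ys) = ≡.trans (≡.cong (_ ℕ.+_) (cut-triples t t' (g' ∷ gs) ys))
  (solve 4 (λ a b c d → (a :+ b) :+ (c :+ d) := (a :+ c) :+ (b :+ d)) ≡.refl (r ⊔ t) (b ⊔ t') (valuesOf t (redTriples (g' ∷ gs) ys)) (valuesOf t' (blueTriples (g' ∷ gs) ys)))
  where open +-*-Solver

-- The prefix content of a word cut at (t , t') fails to be a partition in the letters on the two sides of level y.
Violates : ∀ {k} → ℕ → ℕ → Level k → Level k → Level k → Set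
Violates t t' p y q = ∣ cut t t' y ∣ᴸ + ∣ cut t t' y ∣ᴸ < ∣ cut t t' p ∣ᴸ + ∣ cut t t' q ∣ᴸ

module _ (t t' : ℕ) (t'≤t : t' ≤ t) (t≤t' : t ≤ suc t') where
  open Cutting t t' t'≤t t≤t'

  settle : ∀ {k} (gs : Vec Gap (suc k)) y → SettledAt t (redTriples gs y) → SettledAt t' (blueTriples gs y) → Settled gs y
  settle (g ∷ [])      []             _        _        = tt
  settle (g ∷ g' ∷ gs) ((r , b) ∷ ys) (s , ss) (u , us) = (s , u) , settle (g' ∷ gs) ys ss us

  -- The cut before (t , t') is (t + 1 , t') if red was read last and (t , t' + 1) if blue was. In
  -- both cases (t + 1 , t' + 1) lies one more reading back, and the two alternatives are the two
  -- assignments of colours in `first-violation`.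
  violation-settled : ∀ {k} (p y q : Level (suc k)) → FitsAll (gaps p q) y → Violates t t' p y q →
    (¬ Violates (suc t) t' p y q ⊎ ¬ Violates t (suc t') p y q) → ¬ Violates (suc t) (suc t') p y q →
    Settled (gaps p q) y × ∣ cut t t' p ∣ᴸ + ∣ cut t t' q ∣ᴸ ≡ suc (∣ cut t t' y ∣ᴸ + ∣ cut t t' y ∣ᴸ)
  violation-settled p y q F viol (inj₁ ok₁) ok₂ =
      let (a , b , e) = first-violation t t' rs bs (Stepping.step t rs (red-stacked gs y F)) (Stepping.step t' bs (blue-stacked gs y F))
                          (≡.subst₂ _<_ (values t t') (endsEq t t') viol) (≡.subst₂ _≤_ (endsEq (suc t) t') (values (suc t) t') (ℕₚ.≮⇒≥ ok₁))
                          (≡.subst₂ _≤_ (endsEq (suc t) (suc t')) (values (suc t) (suc t')) (ℕₚ.≮⇒≥ ok₂))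
      in settle gs y a b , ≡.trans (endsEq t t') (≡.trans e (≡.cong suc (≡.sym (values t t'))))
    where
    gs = gaps p q
    rs = redTriples gs y
    bs = blueTriples gs y
    endsEq : ∀ t t' → ∣ cut t t' p ∣ᴸ + ∣ cut t t' q ∣ᴸ ≡ endsOf t rs + endsOf t' bs
    endsEq t t' = ≡.trans (≡.sym (ends-gaps (_⊔ t) (_⊔ t') p q)) (ends-triples t t' gs y)
    values : ∀ t t' → ∣ cut t t' y ∣ᴸ + ∣ cut t t' y ∣ᴸ ≡ (valuesOf t rs + valuesOf t rs) + (valuesOf t' bs + valuesOf t' bs)
    values t t' = ≡.trans (≡.cong (λ x → x + x) (cut-triples t t' gs y)) (solve 2 (λ a b → (a :+ b) :+ (a :+ b) := (a :+ a) :+ (b :+ b)) ≡.refl (valuesOf t rs) (valuesOf t' bs))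
      where open +-*-Solver
  violation-settled p y q F viol (inj₂ ok₁) ok₂ =
      let (b , a , e) = first-violation t' t bs rs (Stepping.step t' bs (blue-stacked gs y F)) (Stepping.step t rs (red-stacked gs y F))
                          (≡.subst₂ _<_ (values t t') (endsEq t t') viol) (≡.subst₂ _≤_ (endsEq t (suc t')) (values t (suc t')) (ℕₚ.≮⇒≥ ok₁))
                          (≡.subst₂ _≤_ (endsEq (suc t) (suc t')) (values (suc t) (suc t')) (ℕₚ.≮⇒≥ ok₂))
      in settle gs y a b , ≡.trans (endsEq t t') (≡.trans e (≡.cong suc (≡.sym (values t t'))))
    where
    gs = gaps p q
    rs = redTriples gs y
    bs = blueTriples gs y
    endsEq : ∀ t t' → ∣ cut t t' p ∣ᴸ + ∣ cut t t' q ∣ᴸ ≡ endsOf t' bs + endsOf t rs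
    endsEq t t' = ≡.trans (≡.sym (ends-gaps (_⊔ t) (_⊔ t') p q)) (≡.trans (ends-triples t t' gs y) (ℕₚ.+-comm (endsOf t rs) (endsOf t' bs)))
    values : ∀ t t' → ∣ cut t t' y ∣ᴸ + ∣ cut t t' y ∣ᴸ ≡ (valuesOf t' bs + valuesOf t' bs) + (valuesOf t rs + valuesOf t rs)
    values t t' = ≡.trans (≡.cong (λ x → x + x) (cut-triples t t' gs y)) (solve 2 (λ a b → (a :+ b) :+ (a :+ b) := (b :+ b) :+ (a :+ a)) ≡.refl (valuesOf t rs) (valuesOf t' bs))
      where open +-*-Solver

  -- The violation has deficit exactly 1. Inserted into `centre-below`, this puts the sum of all
  -- interval ends one below the sum of the two neighbouring levels, which is where the shifted
  -- antisymmetry of `s` has its centre.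
  centre-gaps : ∀ {k} g y g' (gs : Vec Gap k) ys → Fits g y g' → FitsAll (g' ∷ gs) ys → Settled (g ∷ g' ∷ gs) (y ∷ ys) →
    ends (_⊔ t) (_⊔ t') (g ∷ g' ∷ gs) ≡ suc (∣ cut t t' (y ∷ ys) ∣ᴸ + ∣ cut t t' (y ∷ ys) ∣ᴸ) →
    suc (centre (redLo g y g') (redHi g y g') (blueRow g y g' ∷ rowsBelow (g' ∷ gs) ys)) ≡ ends id id (g ∷ g' ∷ gs)
  centre-gaps g y g' gs ys F Fs S e = ℕₚ.+-cancelʳ-≡ (∣ cut t t' (y ∷ ys) ∣ᴸ + ∣ cut t t' (y ∷ ys) ∣ᴸ) _ _ (≡.trans
    (≡.sym (ℕₚ.+-suc C _)) (≡.trans (≡.cong (C ℕ.+_) (≡.sym e)) (centre-below 0 0 (g ∷ g' ∷ gs) (y ∷ ys) (F , Fs) S)))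
    where
    C = centre (redLo g y g') (redHi g y g') (blueRow g y g' ∷ rowsBelow (g' ∷ gs) ys)

  module _ (R : CommutativeRing 0ℓ 0ℓ) (M : ℕ) where
    open CommutativeRing R hiding (zero; _+_)
    open Sums R
    open RowSums R M
    open Relation.Binary.Reasoning.Setoid setoid

    Same : ∀ {k} → Vec Gap (suc k) → Level k → Level k → Set
    Same gs y₀ y = FitsAll gs y × cut t t' y ≡ cut t t' y₀

    same? : ∀ {k} (gs : Vec Gap (suc k)) y₀ y → Dec (Same gs y₀ y)
    same? gs y₀ y = fits? gs y ×-dec Vecₚ.≡-dec _≟ᴺ_ (cut t t' y) (cut t t' y₀)

    ∑-node : ∀ {k} g g' (gs : Vec Gap k) y₀ ys₀ → Fits g y₀ g' → Settledᴺ y₀ g' → (Φ : Level (suc k) → Carrier) →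
      ∑ (levels M (suc k)) (λ y → when (same? (g ∷ g' ∷ gs) (y₀ ∷ ys₀) y) (Φ y)) ≈
      interval (redLo g y₀ g') (redHi g y₀ g') (λ r → interval (blueLo g y₀ g') (blueHi g y₀ g') (λ b →
        ∑ (levels M k) (λ ys → when (same? (g' ∷ gs) ys₀ ys) (Φ ((r , b) ∷ ys)))))
    ∑-node {k} g g' gs y₀ ys₀ ((ar , br) , (ab , bb)) (sr , sb) Φ = begin
      ∑ (levels M (suc k)) (λ y → when (same? (g ∷ g' ∷ gs) (y₀ ∷ ys₀) y) (Φ y))
        ≈⟨ trans (∑-vecs (nodes M) k _) (∑-pairs (range (suc M)) _) ⟩
      ∑ (range (suc M)) (λ r → ∑ (range (suc M)) (λ b → ∑ (levels M k) (λ ys → when (same? (g ∷ g' ∷ gs) (y₀ ∷ ys₀) ((r , b) ∷ ys)) (Φ ((r , b) ∷ ys)))))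
        ≈⟨ ∑-cong (range (suc M)) (λ r → ∑-cong (range (suc M)) (λ b → ∑-cong (levels M k) (λ ys → split r b ys))) ⟩
      ∑ (range (suc M)) (λ r → ∑ (range (suc M)) (λ b → ∑ (levels M k) (λ ys → when (br? r) (when (bb? b) (when (same? (g' ∷ gs) ys₀ ys) (Φ ((r , b) ∷ ys)))))))
        ≈⟨ ∑-cong (range (suc M)) (λ r → trans (∑-cong (range (suc M)) (λ b → trans (sym (when-∑ (br? r) (levels M k) _)) (when-congʳ (br? r) (λ _ → sym (when-∑ (bb? b) (levels M k) _)))))
             (sym (when-∑ (br? r) (range (suc M)) _))) ⟩
      interval (redLo g y₀ g') (redHi g y₀ g') (λ r → interval (blueLo g y₀ g') (blueHi g y₀ g') (λ b →
        ∑ (levels M k) (λ ys → when (same? (g' ∷ gs) ys₀ ys) (Φ ((r , b) ∷ ys))))) ∎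
      where
      br? = λ r → between? (redLo g y₀ g') (redHi g y₀ g') r
      bb? = λ b → between? (blueLo g y₀ g') (blueHi g y₀ g') b
      iffr = range-iff (hiᴿ g') (loᴿ g) t (proj₁ y₀) ar br sr
      iffb = range-iff (hiᴮ g') (loᴮ g) t' (proj₂ y₀) ab bb sb
      split : ∀ r b ys → when (same? (g ∷ g' ∷ gs) (y₀ ∷ ys₀) ((r , b) ∷ ys)) (Φ ((r , b) ∷ ys)) ≈
                         when (br? r) (when (bb? b) (when (same? (g' ∷ gs) ys₀ ys) (Φ ((r , b) ∷ ys))))
      split r b ys = trans (when-cong (same? (g ∷ g' ∷ gs) (y₀ ∷ ys₀) ((r , b) ∷ ys)) (br? r ×-dec (bb? b ×-dec same? (g' ∷ gs) ys₀ ys))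
          (λ (((fr , fb) , fs) , e) → let (e₀ , es) = Vecₚ.∷-injective e in
             proj₁ (iffr r) (fr , ≡.cong proj₁ e₀) , proj₁ (iffb b) (fb , ≡.cong proj₂ e₀) , fs , es)
          (λ (pr , pb , fs , es) → let (fr , er) = proj₂ (iffr r) pr ; (fb , eb) = proj₂ (iffb b) pb in
             ((fr , fb) , fs) , ≡.cong₂ _∷_ (≡.cong₂ _,_ er eb) es)
          (λ _ → refl))
        (trans (when-× (br? r) _) (when-congʳ (br? r) (λ _ → when-× (bb? b) _)))

    ∑-below : ∀ {k} b (gs : Vec Gap (suc k)) ys₀ → FitsAll gs ys₀ → Settled gs ys₀ → (G : Graded) →
              ∑ (levels M k) (λ ys → when (same? gs ys₀ ys) (G (bitsBelow b gs ys) (b + ∣ ys ∣ᴸ))) ≈ rowSum b (rowsBelow gs ys₀) G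
    ∑-below b (g ∷ [])      []         _ _ G = trans (+-identityʳ _) (trans (when-yes (same? (g ∷ []) [] []) (tt , ≡.refl)) (reflexive (≡.cong (G []) (ℕₚ.+-identityʳ b))))
    ∑-below b (g ∷ g' ∷ gs) (y₀ ∷ ys₀) (F , Fs) (S , Ss) G = trans (∑-node g g' gs y₀ ys₀ F S _)
      (interval-cong (redLo g y₀ g') (redHi g y₀ g') (λ r _ _ → interval-cong (blueLo g y₀ g') (blueHi g y₀ g') (λ b' _ _ →
        trans (∑-cong (levels M _) (λ ys → when-congʳ (same? (g' ∷ gs) ys₀ ys) (λ _ → reflexive (≡.cong (G _) (≡.cong (b ℕ.+_) (ℕₚ.+-assoc r b' ∣ ys ∣ᴸ))))))
          (∑-below b' (g' ∷ gs) ys₀ Fs Ss (λ bs z → G (evenBit (hiᴮ g) (loᴿ g) b r ∷ oddBit (hiᴿ g') (loᴮ g) r b' ∷ bs) (b + (r + z)))))))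

    -- The levels with the same cut as y₀ form a box. Its rows are taken in the order red, blue,
    -- red, blue, ..., so that odd and even bits link consecutive rows and `rows-zero` applies.
    level-zero : ∀ {k} (gs : Vec Gap (suc (suc k))) (y₀ : Level (suc k)) → FitsAll gs y₀ → Settled gs y₀ → GapsBounded M gs →
                 ends (_⊔ t) (_⊔ t') gs ≡ suc (∣ cut t t' y₀ ∣ᴸ + ∣ cut t t' y₀ ∣ᴸ) →
                 (G : Graded) → (∀ K → suc K ≡ ends id id gs → ∀ bs → Alternating K (G bs)) →
                 ∑ (levels M (suc k)) (λ y → when (same? gs y₀ y) (G (bits gs y) ∣ y ∣ᴸ)) ≈ 0#
    level-zero (g ∷ g' ∷ gs) (y₀ ∷ ys₀) (F , Fs) (S , Ss) gsM e G A = begin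
      ∑ (levels M _) (λ y → when (same? (g ∷ g' ∷ gs) (y₀ ∷ ys₀) y) (G (bits (g ∷ g' ∷ gs) y) ∣ y ∣ᴸ))
        ≈⟨ ∑-node g g' gs y₀ ys₀ F S _ ⟩
      interval (redLo g y₀ g') (redHi g y₀ g') (λ r → interval (blueLo g y₀ g') (blueHi g y₀ g') (λ b →
        ∑ (levels M _) (λ ys → when (same? (g' ∷ gs) ys₀ ys) (G (oddBit (hiᴿ g') (loᴮ g) r b ∷ bitsBelow b (g' ∷ gs) ys) ((r + b) + ∣ ys ∣ᴸ)))))
        ≈⟨ interval-cong (redLo g y₀ g') (redHi g y₀ g') (λ r _ _ → interval-cong (blueLo g y₀ g') (blueHi g y₀ g') (λ b _ _ →
             trans (∑-cong (levels M _) (λ ys → when-congʳ (same? (g' ∷ gs) ys₀ ys) (λ _ → reflexive (≡.cong (G _) (ℕₚ.+-assoc r b ∣ ys ∣ᴸ)))))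
               (∑-below b (g' ∷ gs) ys₀ Fs Ss (λ bs z → G (oddBit (hiᴿ g') (loᴮ g) r b ∷ bs) (r + z))))) ⟩
      interval (redLo g y₀ g') (redHi g y₀ g') (λ r → rowSum r (blueRow g y₀ g' ∷ rowsBelow (g' ∷ gs) ys₀) G)
        ≈⟨ rows-zero (redLo g y₀ g') (redHi g y₀ g') (blueRow g y₀ g' ∷ rowsBelow (g' ∷ gs) ys₀)
             (rangeHi≤ (hiᴿ g') (loᴿ g) t _ M (proj₂ (proj₁ F)) (proj₁ (proj₁ gsM))) (linked M g y₀ g' gs ys₀ gsM F Fs)
             (A _ (centre-gaps g y₀ g' gs ys₀ F Fs (S , Ss) e)) ⟩
      0# ∎

-- Positions of a vector having a successor.
data Inner : ℕ → Set where
  first : ∀ {n} → Inner (suc (suc n))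
  next  : ∀ {n} → Inner n → Inner (suc n)

inners : ∀ n → List (Inner n)
inners zero          = []
inners (suc zero)    = []
inners (suc (suc n)) = first ∷ map next (inners (suc n))

module _ {X : Set} where
  put : ∀ {n} → Inner n → Vec X n → X → Vec X n
  put first    (u ∷ U) y = y ∷ U
  put (next i) (u ∷ U) y = u ∷ put i U y

  left : ∀ {n} → X → Inner n → Vec X n → X
  left m first    U       = m
  left m (next i) (u ∷ U) = left u i U

  mid right : ∀ {n} → Inner n → Vec X n → X
  mid first    (u ∷ U) = u
  mid (next i) (u ∷ U) = mid i U
  right first    (u ∷ q ∷ U) = q
  right (next i) (u ∷ U)     = right i U

  mid-put : ∀ {n} (i : Inner n) U y → mid i (put i U y) ≡ y
  mid-put first    (u ∷ U) y = ≡.refl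
  mid-put (next i) (u ∷ U) y = mid-put i U y

  left-put : ∀ {n} m (i : Inner n) U y → left m i (put i U y) ≡ left m i U
  left-put m first    (u ∷ U) y = ≡.refl
  left-put m (next i) (u ∷ U) y = left-put u i U y

  right-put : ∀ {n} (i : Inner n) U y → right i (put i U y) ≡ right i U
  right-put first    (u ∷ q ∷ U) y = ≡.refl
  right-put (next i) (u ∷ U)     y = right-put i U y

module _ {X Y : Set} (f : X → Y) where
  map-put : ∀ {n} (i : Inner n) U y → Vec.map f (put i U y) ≡ put i (Vec.map f U) (f y)
  map-put first    (u ∷ U) y = ≡.refl
  map-put (next i) (u ∷ U) y = ≡.cong (f u ∷_) (map-put i U y)

  map-left : ∀ {n} m (i : Inner n) U → f (left m i U) ≡ left (f m) i (Vec.map f U)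
  map-left m first    U       = ≡.refl
  map-left m (next i) (u ∷ U) = map-left u i U

  map-right : ∀ {n} (i : Inner n) U → f (right i U) ≡ right i (Vec.map f U)
  map-right first    (u ∷ q ∷ U) = ≡.refl
  map-right (next i) (u ∷ U)     = map-right i U

module ChainPositions {X : Set} (E : X → X → Set) where
  private module I = Interlacing E

  Rest : ∀ {k n} → Vec X k → Vec X k → Inner n → Vec (Vec X k) n → Set
  Rest top m first    (u ∷ q ∷ U) = I.Chain top q U
  Rest top m (next i) (u ∷ U)     = I.Zig m u × Rest top u i U

  chain-put⁻ : ∀ {k n} top m (i : Inner n) (U : Vec (Vec X k) n) y → I.Chain top m (put i U y) →
               Rest top m i U × I.Zig (left m i U) y × I.Zig y (right i U)
  chain-put⁻ top m first    (u ∷ q ∷ U) y (a , b , c) = c , a , b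
  chain-put⁻ top m (next i) (u ∷ U)     y (a , c) with chain-put⁻ top u i U y c
  ... | r , z = (a , r) , z

  chain-put : ∀ {k n} top m (i : Inner n) (U : Vec (Vec X k) n) y →
              Rest top m i U → I.Zig (left m i U) y → I.Zig y (right i U) → I.Chain top m (put i U y)
  chain-put top m first    (u ∷ q ∷ U) y c       a b = a , b , c
  chain-put top m (next i) (u ∷ U)     y (z , r) a b = z , chain-put top u i U y r a b

  module Decide (E? : ∀ x y → Dec (E x y)) (_≟_ : DecidableEquality X) where
    private module D = I.Decide E? _≟_
    rest? : ∀ {k n} top m (i : Inner n) (U : Vec (Vec X k) n) → Dec (Rest top m i U)
    rest? top m first    (u ∷ q ∷ U) = D.chain? top q U
    rest? top m (next i) (u ∷ U)     = D.zig? m u ×-dec rest? top u i U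

module StraightPos = ChainPositions _⊑_
module PlusPos = ChainPositions _⊑⁺_
module PlusPosDec = PlusPos.Decide _⊑⁺?_ _≟ᴸ_

zig-bounded : ∀ {M k} (m u : Level k) → Zig m u → Bounded M u → Bounded M m
zig-bounded []       []       _                     _               = tt
zig-bounded (m ∷ ms) (u ∷ us) ((a , b) , _ , z) ((p , q) , B) = (ℕₚ.≤-trans a p , ℕₚ.≤-trans b q) , zig-bounded ms us z B

chain-bounded : ∀ {M k n} top (m : Level k) (U : Vec (Level k) n) → Chain top m U → Bounded M top → Bounded M m
chain-bounded top m []      ≡.refl  B = B
chain-bounded top m (u ∷ U) (z , c) B = zig-bounded m u z (chain-bounded top u U c B)

rest-bounded : ∀ {M k n} top (m : Level k) (i : Inner n) U → StraightPos.Rest top m i U → Bounded M top → Bounded M (right i U)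
rest-bounded top m first    (u ∷ q ∷ U) c       B = chain-bounded top q U c B
rest-bounded top m (next i) (u ∷ U)     (_ , r) B = rest-bounded top u i U r B

gaps-bounded : ∀ {M k} P (p q : Level k) → Bounded M q → GapsBounded M (gapsFrom P p q)
gaps-bounded P []            []            B = tt
gaps-bounded P (p ∷ [])      (q ∷ [])      ((a , b) , B) = (ℕₚ.≤-trans (ℕₚ.m⊓n≤n _ _) a , ℕₚ.≤-trans (ℕₚ.m⊓n≤n _ _) b) , tt
gaps-bounded P (p ∷ p' ∷ ps) (q ∷ q' ∷ qs) ((a , b) , B) = (ℕₚ.≤-trans (ℕₚ.m⊓n≤n _ _) a , ℕₚ.≤-trans (ℕₚ.m⊓n≤n _ _) b) , gaps-bounded p (p' ∷ ps) (q' ∷ qs) B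

label-put : ∀ {k n} (i : Inner n) (U : Vec (Level k) n) F y f → label (put i U y) (put i F f) ≡ put i (label U F) (zip y f)
label-put first    (u ∷ U) (g ∷ F) y f = ≡.refl
label-put (next i) (u ∷ U) (g ∷ F) y f = ≡.cong (zip u g ∷_) (label-put i U F y f)

label-put-mid : ∀ {k n} (i : Inner n) (U : Vec (Level k) n) F y → label (put i U y) F ≡ put i (label U F) (zip y (mid i F))
label-put-mid first    (u ∷ U) (g ∷ F) y = ≡.refl
label-put-mid (next i) (u ∷ U) (g ∷ F) y = ≡.cong (zip u g ∷_) (label-put-mid i U F y)

left-label : ∀ {k n} m g (i : Inner n) (U : Vec (Level k) n) F → Vec.map proj₁ (left (zip m g) i (label U F)) ≡ left m i U
left-label m g first    U       F        = Vecₚ.map-proj₁-zip m g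
left-label m g (next i) (u ∷ U) (f ∷ F) = left-label u f i U F

right-label : ∀ {k n} (i : Inner n) (U : Vec (Level k) n) F → Vec.map proj₁ (right i (label U F)) ≡ right i U
right-label first    (u ∷ q ∷ U) (_ ∷ f ∷ F) = Vecₚ.map-proj₁-zip q f
right-label (next i) (u ∷ U)     (f ∷ F)     = right-label i U F

module Uncuttability {k n : ℕ} (top : Level (suc k)) (gt : Labels (suc k)) (m : Level (suc k)) (g : Labels (suc k)) (i : Inner n) (U : Vec (Level (suc k)) n) where
  gapsᴸ : Vec (Labels (suc k)) n → Vec LGap (suc (suc k))
  gapsᴸ F = gaps (left (zip m g) i (label U F)) (right i (label U F))

  Extends : List Bool → Vec (Labels (suc k)) n → Set
  Extends bs F = PlusPos.Rest (zip top gt) (zip m g) i (label U F) × Compatible (gapsᴸ F) bs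

  -- By `cut⇒compatible` and `compatible⇒cut` the level at `i` enters the connectivity of the whole
  -- pattern only through its bits, which makes this a condition on the bits.
  Blocked : List Bool → Set
  Blocked bs = ¬ Any (Extends bs) (labelings (suc k) n)

  blocked? : ∀ bs → Dec (Blocked bs)
  blocked? bs = ¬? (any? (λ F → PlusPosDec.rest? (zip top gt) (zip m g) i (label U F) ×-dec compatible? (gapsᴸ F) bs) (labelings (suc k) n))

  levelBits : Level (suc k) → List Bool
  levelBits y = bits (gaps (left m i U) (right i U)) y

  private
    gapsEq : ∀ F → gaps (Vec.map proj₁ (left (zip m g) i (label U F))) (Vec.map proj₁ (right i (label U F))) ≡ gaps (left m i U) (right i U)
    gapsEq F = ≡.cong₂ gaps (left-label m g i U F) (right-label i U F)

  blocked⇒uncuttable : ∀ y → Blocked (levelBits y) → ¬ ∃ λ F → Cuttable top gt m g F (put i U y)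
  blocked⇒uncuttable y b (F , c) with PlusPos.chain-put⁻ (zip top gt) (zip m g) i (label U F) (zip y (mid i F)) (≡.subst (Plus.Chain (zip top gt) (zip m g)) (label-put-mid i U F y) c)
  ... | r , z , w = b (lose (∈-labelings F) (r , ≡.subst (λ gs → Compatible (gapsᴸ F) (bits gs y)) (gapsEq F) (cut⇒compatible _ _ y (mid i F) z w)))

  uncuttable⇒blocked : ∀ y → (¬ ∃ λ F → Cuttable top gt m g F (put i U y)) → Blocked (levelBits y)
  uncuttable⇒blocked y ¬c a with find a
  ... | F , _ , r , C with compatible⇒cut _ _ y (≡.subst (λ gs → Compatible (gapsᴸ F) (bits gs y)) (≡.sym (gapsEq F)) C)
  ...   | f , z , w = ¬c (put i F f , ≡.subst (Plus.Chain (zip top gt) (zip m g)) (≡.sym (label-put i U F y f)) (PlusPos.chain-put (zip top gt) (zip m g) i (label U F) (zip y f) r z w))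

weightAt : ∀ {k n} → Inner n → Level k → Vec (Level k) n → ℕ → Vec ℤ n
weightAt first    m (u ∷ q ∷ U) z = (+ z ℤ.- + ∣ m ∣ᴸ) ∷ (+ ∣ q ∣ᴸ ℤ.- + z) ∷ weight q U
weightAt (next i) m (u ∷ U)     z = (+ ∣ u ∣ᴸ ℤ.- + ∣ m ∣ᴸ) ∷ weightAt i u U z

weight-put : ∀ {k n} (i : Inner n) (m : Level k) U y → weight m (put i U y) ≡ weightAt i m U ∣ y ∣ᴸ
weight-put first    m (u ∷ q ∷ U) y = ≡.refl
weight-put (next i) m (u ∷ U)     y = ≡.cong (_ ∷_) (weight-put i u U y)

Bad : ∀ {k n} → Level k → ℕ → ℕ → Inner n → Vec (Level k) n → Set
Bad m a b j U = ∣ mid j W ∣ᴸ + ∣ mid j W ∣ᴸ < ∣ left (cut a b m) j W ∣ᴸ + ∣ right j W ∣ᴸ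
  where W = Vec.map (cut a b) U

bad? : ∀ {k n} (m : Level k) a b (j : Inner n) U → Dec (Bad m a b j U)
bad? m a b j U = _ ℕ.<? _

bad⇒violates : ∀ {k n} (m : Level k) a b (i : Inner n) U y → Bad m a b i (put i U y) → Violates a b (left m i U) y (right i U)
bad⇒violates m a b i U y v = ≡.subst₂ _<_ (≡.cong (λ x → ∣ x ∣ᴸ + ∣ x ∣ᴸ) (≡.trans (≡.cong (mid i) (map-put (cut a b) i U y)) (mid-put i _ _)))
  (≡.cong₂ (λ x y → ∣ x ∣ᴸ + ∣ y ∣ᴸ)
    (≡.trans (≡.cong (left (cut a b m) i) (map-put (cut a b) i U y)) (≡.trans (left-put _ i _ _) (≡.sym (map-left (cut a b) m i U))))
    (≡.trans (≡.cong (right i) (map-put (cut a b) i U y)) (≡.trans (right-put i _ _) (≡.sym (map-right (cut a b) i U))))) v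

violates⇒bad : ∀ {k n} (m : Level k) a b (i : Inner n) U y → Violates a b (left m i U) y (right i U) → Bad m a b i (put i U y)
violates⇒bad m a b i U y v = ≡.subst₂ _<_ (≡.sym (≡.cong (λ x → ∣ x ∣ᴸ + ∣ x ∣ᴸ) (≡.trans (≡.cong (mid i) (map-put (cut a b) i U y)) (mid-put i _ _))))
  (≡.sym (≡.cong₂ (λ x y → ∣ x ∣ᴸ + ∣ y ∣ᴸ)
    (≡.trans (≡.cong (left (cut a b m) i) (map-put (cut a b) i U y)) (≡.trans (left-put _ i _ _) (≡.sym (map-left (cut a b) m i U))))
    (≡.trans (≡.cong (right i) (map-put (cut a b) i U y)) (≡.trans (right-put i _ _) (≡.sym (map-right (cut a b) i U)))))) v

cut-cut : ∀ {k} a b a' b' → a ≤ a' → b ≤ b' → (y : Level k) → cut a' b' (cut a b y) ≡ cut a' b' y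
cut-cut a b a' b' p q []             = ≡.refl
cut-cut a b a' b' p q ((r , s) ∷ y) = ≡.cong₂ _∷_ (≡.cong₂ _,_ (absorb r p) (absorb s q)) (cut-cut a b a' b' p q y)
  where
  absorb : ∀ x {c d} → c ≤ d → (x ⊔ c) ⊔ d ≡ x ⊔ d
  absorb x {c} {d} le = ≡.trans (ℕₚ.⊔-assoc x c d) (≡.cong (x ⊔_) (ℕₚ.m≤n⇒m⊔n≡n le))

-- Cutting further to the right factors through the present cut, as (x ⊔ a) ⊔ a' = x ⊔ a' for a ≤
-- a'. What was decided at earlier cuts is therefore constant on the class of y.
bad-invariant : ∀ {k n} (m : Level k) a b a' b' (j i : Inner n) U y y' → a ≤ a' → b ≤ b' → cut a b y ≡ cut a b y' → Bad m a' b' j (put i U y) → Bad m a' b' j (put i U y')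
bad-invariant m a b a' b' j i U y y' p q e v = ≡.subst (λ W → ∣ mid j W ∣ᴸ + ∣ mid j W ∣ᴸ < ∣ left (cut a' b' m) j W ∣ᴸ + ∣ right j W ∣ᴸ)
  (≡.trans (map-put (cut a' b') i U y) (≡.trans (≡.cong (put i (Vec.map (cut a' b') U)) (≡.trans (≡.sym (cut-cut a b a' b' p q y)) (≡.trans (≡.cong (cut a' b') e) (cut-cut a b a' b' p q y'))))
    (≡.sym (map-put (cut a' b') i U y')))) v

high-cut : ∀ {M k} a b → M ≤ a → M ≤ b → (y z : Level k) → Bounded M y → Bounded M z → cut a b y ≡ cut a b z
high-cut a b p q []            []              _             _               = ≡.refl
high-cut a b p q ((r , s) ∷ y) ((r' , s') ∷ z) ((c , d) , B) ((c' , d') , B') = ≡.cong₂ _∷_ (≡.cong₂ _,_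
  (≡.trans (ℕₚ.m≤n⇒m⊔n≡n (ℕₚ.≤-trans c p)) (≡.sym (ℕₚ.m≤n⇒m⊔n≡n (ℕₚ.≤-trans c' p))))
  (≡.trans (ℕₚ.m≤n⇒m⊔n≡n (ℕₚ.≤-trans d q)) (≡.sym (ℕₚ.m≤n⇒m⊔n≡n (ℕₚ.≤-trans d' q))))) (high-cut a b p q y z B B')

high-fine : ∀ {M k} a b → M ≤ a → M ≤ b → (p y q : Level k) → Bounded M p → Bounded M y → Bounded M q → ¬ Violates a b p y q
high-fine a b pa pb p y q Bp By Bq v = ℕₚ.<-irrefl (≡.cong₂ (λ x z → ∣ x ∣ᴸ + ∣ z ∣ᴸ) (high-cut a b pa pb y p By Bp) (high-cut a b pa pb y q By Bq)) v

-- Cancellation at one position and one cut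

module Cancellation (R : CommutativeRing 0ℓ 0ℓ) (gen : ℕ → CommutativeRing.Carrier R) (M : ℕ) {k : ℕ} where
  open CommutativeRing R hiding (zero) renaming (_+_ to _⊹_)
  open Sums R
  open SchurDeterminants R gen
  open CompleteAction R
  open Relation.Binary.Reasoning.Setoid setoid

  ∑-put : ∀ {X : Set} (xs : List X) → X → ∀ {n} (i : Inner n) (Φ : Vec X n → Carrier) → (∀ U → ∑ xs (λ y → Φ (put i U y)) ≈ 0#) → ∑ (vecs xs n) Φ ≈ 0#
  ∑-put xs x₀ (first {n}) Φ e = trans (∑-vecs xs (suc n) Φ) (trans (∑-swap xs (vecs xs (suc n)) _) (∑-zero (vecs xs (suc n)) (λ U → e (x₀ ∷ U))))
  ∑-put xs x₀ (next {n} i) Φ e = trans (∑-vecs xs n Φ) (∑-zero xs (λ u → ∑-put xs x₀ i (λ U → Φ (u ∷ U)) (λ U → e (u ∷ U))))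

  -- Classes are split off one at a time, with the elements of `xs` in turn as representatives. A
  -- class split off before contributes nothing when it is met again, which makes repetitions
  -- harmless.
  ∑-classes : ∀ {X Z : Set} (_≟_ : DecidableEquality Z) (cls : X → Z) (xs : List X) (f : X → Carrier) →
              (∀ y → ∑ xs (λ x → when (cls x ≟ cls y) (f x)) ≈ 0#) → ∑ xs f ≈ 0#
  ∑-classes {X} _≟_ cls xs f e = trans (outside xs) (trans (go xs (λ x∈ → x∈)) (∑-0 xs))
    where
    seen? : ∀ ys x → Dec (Any (λ y → cls x ≡ cls y) ys)
    seen? ys x = any? (λ y → cls x ≟ cls y) ys
    outside : ∀ ys → ∑ xs f ≈ ∑ xs (λ x → when (¬? (seen? ys x)) (f x))
    outside []       = ∑-cong xs (λ x → sym (when-yes (¬? (seen? [] x)) (λ ())))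
    outside (y ∷ ys) = begin
      ∑ xs f                                                 ≈⟨ outside ys ⟩
      ∑ xs (λ x → when (¬? (seen? ys x)) (f x))              ≈⟨ trans (∑-cong xs (λ x → when-split (¬? (seen? ys x)) (cls x ≟ cls y) (f x))) (∑-+ xs _ _) ⟩
      ∑ xs (λ x → when (¬? (seen? ys x) ×-dec (cls x ≟ cls y)) (f x)) ⊹ ∑ xs (λ x → when (¬? (seen? ys x) ×-dec ¬? (cls x ≟ cls y)) (f x))
        ≈⟨ +-cong new (∑-cong xs (λ x → when-cong (¬? (seen? ys x) ×-dec ¬? (cls x ≟ cls y)) (¬? (seen? (y ∷ ys) x))
             (λ (a , b) → λ { (here p) → b p ; (there p) → a p }) (λ a → (λ p → a (there p)) , (λ p → a (here p))) (λ _ → refl))) ⟩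
      0# ⊹ ∑ xs (λ x → when (¬? (seen? (y ∷ ys) x)) (f x))   ≈⟨ +-identityˡ _ ⟩
      ∑ xs (λ x → when (¬? (seen? (y ∷ ys) x)) (f x))        ∎
      where
      new : ∑ xs (λ x → when (¬? (seen? ys x) ×-dec (cls x ≟ cls y)) (f x)) ≈ 0#
      new with seen? ys y
      ... | yes s = ∑-zero xs (λ x → when-no (¬? (seen? ys x) ×-dec (cls x ≟ cls y)) (λ (a , b) → a (Any.map (λ p → ≡.trans b p) s)))
      ... | no ¬s = trans (∑-cong xs (λ x → when-cong (¬? (seen? ys x) ×-dec (cls x ≟ cls y)) (cls x ≟ cls y) proj₂
              (λ b → (λ s → ¬s (Any.map (λ p → ≡.trans (≡.sym b) p) s)) , b) (λ _ → refl))) (e y)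
    go : ∀ ys → (∀ {x} → x ∈ ys → x ∈ xs) → ∑ ys (λ x → when (¬? (seen? xs x)) (f x)) ≈ ∑ ys (λ _ → 0#)
    go []       _   = refl
    go (y ∷ ys) sub = +-cong (when-no (¬? (seen? xs y)) (λ a → a (Any.map (≡.cong cls) (sub (here ≡.refl))))) (go ys (λ p → sub (there p)))

  -- The level sum z enters two neighbouring contents, z - |p| and |q| - z for the levels p and q
  -- beside it. Replacing z by |p| + |q| - 1 - z exchanges them with the shift by one that `Alt`
  -- prescribes.
  alternating-weightAt : ∀ {n} (i : Inner n) (m : Level (suc k)) U {t : Weights n} K → Alt t → suc K ≡ ∣ left m i U ∣ᴸ + ∣ right i U ∣ᴸ →
                         Alternating K (λ z → t (weightAt i m U z))
  alternating-weightAt first m (u ∷ q ∷ U) {t} K (A , Z , _) e = mkAlt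
      (λ z z' p → trans (+-cong (at z z' p) (at z' z (≡.trans (ℕₚ.+-comm z' z) p))) (A _ _ _))
      (λ z p → trans (at z z p) (Z _ _))
    where
    shift : ∀ z z' → z + z' ≡ K → + ∣ q ∣ᴸ ℤ.- + z ≡ ℤ.suc (+ z' ℤ.- + ∣ m ∣ᴸ)
    shift z z' p = ℤ-lemma (+ ∣ q ∣ᴸ) (+ z) (+ z') (+ ∣ m ∣ᴸ) (≡.trans (≡.sym (ℤₚ.pos-+ ∣ m ∣ᴸ ∣ q ∣ᴸ)) (≡.trans (≡.cong +_ (≡.trans (≡.sym e) (≡.cong suc (≡.sym p)))) (≡.cong (ℤ._+_ (+ 1)) (ℤₚ.pos-+ z z'))))
      where
      ℤ-lemma : ∀ q z z' m → m ℤ.+ q ≡ + 1 ℤ.+ (z ℤ.+ z') → q ℤ.- z ≡ + 1 ℤ.+ (z' ℤ.- m)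
      ℤ-lemma q z z' m e = ≡.trans (ℤS.solve 3 (λ q z m → q ℤS.:- z ℤS.:= (m ℤS.:+ q) ℤS.:- (m ℤS.:+ z)) ≡.refl q z m)
        (≡.trans (≡.cong (ℤ._- (m ℤ.+ z)) e) (ℤS.solve 3 (λ z z' m → (ℤS.con (+ 1) ℤS.:+ (z ℤS.:+ z')) ℤS.:- (m ℤS.:+ z) ℤS.:= ℤS.con (+ 1) ℤS.:+ (z' ℤS.:- m)) ≡.refl z z' m))
    at : ∀ z z' → z + z' ≡ K → t (weightAt first m (u ∷ q ∷ U) z) ≈ t ((+ z ℤ.- + ∣ m ∣ᴸ) ∷ ℤ.suc (+ z' ℤ.- + ∣ m ∣ᴸ) ∷ weight q U)
    at z z' p = reflexive (≡.cong (λ w → t ((+ z ℤ.- + ∣ m ∣ᴸ) ∷ w ∷ weight q U)) (shift z z' p))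
  alternating-weightAt {suc (suc n)} (next i) m (u ∷ U) K (_ , _ , B) e = alternating-weightAt i u U K (B _) e
  alternating-weightAt {suc zero} (next ()) m U K A e

  module _ {n : ℕ} (bot top : Level (suc k)) (top≤M : Bounded M (sorted top)) where

    Us : List (Vec (Level (suc k)) n)
    Us = vecs (levels M (suc k)) n

    -- A condition on the columns already read does not see a change of level i that keeps its cut.
    -- In this form the goodness of all earlier cuts passes through the cancellation.
    Stable : ℕ → ℕ → Inner n → (Vec (Level (suc k)) n → Set) → Set
    Stable a b i P = ∀ U y y' → cut a b y ≡ cut a b y' → P (put i U y) → P (put i U y')

    Ready : ℕ → ℕ → Inner n → (Vec (Level (suc k)) n → Set) → Set
    Ready a b i P = ∀ U → Chain (sorted top) (sorted bot) U → P U →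
      (¬ Bad (sorted bot) (suc a) b i U ⊎ ¬ Bad (sorted bot) a (suc b) i U) × ¬ Bad (sorted bot) (suc a) (suc b) i U

    -- All levels but the one at `i` are fixed, together with the cut of that one. A class without a
    -- pattern to be counted contributes nothing. Otherwise one such pattern y₁ shows that the class
    -- is a box, on which the summand depends only on the bits and on the level sum, and
    -- `level-zero` applies.
    bad-zero : ∀ a b → b ≤ a → a ≤ suc b → (i : Inner n) (P : Vec (Level (suc k)) n → Set) (P? : ∀ U → Dec (P U)) → Stable a b i P → Ready a b i P →
      ∑ Us (λ U → when (unswappable? bot top U ×-dec (P? U ×-dec bad? (sorted bot) a b i U)) (s (weight (sorted bot) U))) ≈ 0#
    bad-zero a b b≤a a≤b i P P? stable ready = ∑-put (levels M (suc k)) (Vec.replicate _ (0 , 0)) i _ (λ U →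
        ∑-classes (Vecₚ.≡-dec _≟ᴺ_) (cut a b) (levels M (suc k)) _ (class U))
      where
      b' = sorted bot
      t' = sorted top
      Q : Vec (Level (suc k)) n → Set
      Q U = Unswappable bot top U × P U × Bad b' a b i U
      Q? : ∀ U → Dec (Q U)
      Q? U = unswappable? bot top U ×-dec (P? U ×-dec bad? b' a b i U)
      class : ∀ U y₀ → ∑ (levels M (suc k)) (λ y → when (Vecₚ.≡-dec _≟ᴺ_ (cut a b y) (cut a b y₀)) (when (Q? (put i U y)) (s (weight b' (put i U y))))) ≈ 0#
      class U y₀ with any? (λ y → Q? (put i U y) ×-dec Vecₚ.≡-dec _≟ᴺ_ (cut a b y) (cut a b y₀)) (levels M (suc k))
      ... | no none = trans (go (levels M (suc k)) (λ p → p)) (∑-0 (levels M (suc k)))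
        where
        go : ∀ ys → (∀ {y} → y ∈ ys → y ∈ levels M (suc k)) →
             ∑ ys (λ y → when (Vecₚ.≡-dec _≟ᴺ_ (cut a b y) (cut a b y₀)) (when (Q? (put i U y)) (s (weight b' (put i U y))))) ≈ ∑ ys (λ _ → 0#)
        go []       _   = refl
        go (y ∷ ys) sub = +-cong (when-zero (Vecₚ.≡-dec _≟ᴺ_ (cut a b y) (cut a b y₀)) (λ e → when-no (Q? (put i U y)) (λ q → none (lose (sub (here ≡.refl)) (q , e))))) (go ys (λ p → sub (there p)))
      ... | yes some with find some
      ...   | y₁ , _ , (D@(ch , _) , pre , bad) , cut₁ with StraightPos.chain-put⁻ t' b' i U y₁ ch
      ...     | rest , z , w = begin
          ∑ (levels M (suc k)) (λ y → when (Vecₚ.≡-dec _≟ᴺ_ (cut a b y) (cut a b y₀)) (when (Q? (put i U y)) (s (weight b' (put i U y)))))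
            ≈⟨ ∑-cong (levels M (suc k)) (λ y → term y) ⟩
          ∑ (levels M (suc k)) (λ y → when (same? a b b≤a a≤b R M gs y₁ y) (G (bits gs y) ∣ y ∣ᴸ))
            ≈⟨ level-zero a b b≤a a≤b R M gs y₁ fits (proj₁ settled) (bounded q (rest-bounded t' b' i U rest top≤M))
                 (≡.trans (ends-gaps (_⊔ a) (_⊔ b) p q) (proj₂ settled)) G G-alternating ⟩
          0# ∎
        where
        p q : Level (suc k)
        p = left b' i U
        q = right i U
        gs = gaps p q
        open Uncuttability t' (signs top) b' (signs bot) i U
        fits : FitsAll gs y₁
        fits = between⇒fits gs y₁ (InGaps.zig⇒between _⊑_ p y₁ q z w)
        settled = let (ok₁ , ok₂) = ready (put i U y₁) ch pre in
          violation-settled a b b≤a a≤b p y₁ q fits (bad⇒violates b' a b i U y₁ bad)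
            (Sum.map (λ ¬b v → ¬b (violates⇒bad b' (suc a) b i U y₁ v)) (λ ¬b v → ¬b (violates⇒bad b' a (suc b) i U y₁ v)) ok₁)
            (λ v → ok₂ (violates⇒bad b' (suc a) (suc b) i U y₁ v))
        bounded : ∀ q → Bounded M q → GapsBounded M (gaps p q)
        bounded (q₀ ∷ q) B = gaps-bounded q₀ p (q₀ ∷ q) B
        mapid : ∀ {k} (y : Level k) → Vec.map (mapᴺ id id) y ≡ y
        mapid y = Vecₚ.map-id y
        sumEq : ends id id gs ≡ ∣ p ∣ᴸ + ∣ q ∣ᴸ
        sumEq = ≡.trans (ends-gaps id id p q) (≡.cong₂ (λ x y → ∣ x ∣ᴸ + ∣ y ∣ᴸ) (mapid p) (mapid q))
        G : List Bool → ℕ → Carrier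
        G bs z = when (blocked? bs) (s (weightAt i b' U z))
        G-alternating : ∀ K → suc K ≡ ends id id gs → ∀ bs → Alternating K (G bs)
        G-alternating K e bs with blocked? bs
        ... | yes _ = alternating-weightAt i b' U K Alt-s (≡.trans e sumEq)
        ... | no _  = mkAlt (λ _ _ _ → +-identityˡ 0#) (λ _ _ → refl)
        term : ∀ y → when (Vecₚ.≡-dec _≟ᴺ_ (cut a b y) (cut a b y₀)) (when (Q? (put i U y)) (s (weight b' (put i U y)))) ≈
                     when (same? a b b≤a a≤b R M gs y₁ y) (G (bits gs y) ∣ y ∣ᴸ)
        term y = begin
          when eq? (when (Q? (put i U y)) (s (weight b' (put i U y))))
            ≈⟨ when-× eq? (Q? (put i U y)) ⟨
          when (eq? ×-dec Q? (put i U y)) (s (weight b' (put i U y)))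
            ≈⟨ when-cong (eq? ×-dec Q? (put i U y)) (same? a b b≤a a≤b R M gs y₁ y ×-dec blocked? (bits gs y))
                 (λ (e , (c , ¬v) , _ , _) → let (_ , z , w) = StraightPos.chain-put⁻ t' b' i U y c in
                    (between⇒fits gs y (InGaps.zig⇒between _⊑_ p y q z w) , ≡.trans e (≡.sym cut₁)) ,
                    uncuttable⇒blocked y (unswappable⇒uncuttable bot top (put i U y) (c , ¬v)))
                 (λ ((f , e) , bl) → let (z , w) = InGaps.between⇒zig _⊑_ p y q (fits⇒between gs y f) in
                    ≡.trans e cut₁ , uncuttable⇒unswappable bot top (put i U y) (StraightPos.chain-put t' b' i U y rest z w) (blocked⇒uncuttable y bl) ,
                    stable U y₁ y (≡.sym e) pre , bad-invariant b' a b a b i i U y₁ y ℕₚ.≤-refl ℕₚ.≤-refl (≡.sym e) bad)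
                 (λ _ → reflexive (≡.cong s (weight-put i b' U y))) ⟩
          when (same? a b b≤a a≤b R M gs y₁ y ×-dec blocked? (bits gs y)) (s (weightAt i b' U ∣ y ∣ᴸ))
            ≈⟨ when-× (same? a b b≤a a≤b R M gs y₁ y) (blocked? (bits gs y)) ⟩
          when (same? a b b≤a a≤b R M gs y₁ y) (G (bits gs y) ∣ y ∣ᴸ) ∎
          where
          eq? = Vecₚ.≡-dec _≟ᴺ_ (cut a b y) (cut a b y₀)

-- Cancellation of all non-partition contents

put-mid : ∀ {X : Set} {n} (i : Inner n) (U : Vec X n) → put i U (mid i U) ≡ U
put-mid first    (u ∷ U) = ≡.refl
put-mid (next i) (u ∷ U) = ≡.cong (u ∷_) (put-mid i U)

∈-inners : ∀ {n} (i : Inner n) → i ∈ inners n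
∈-inners first = here ≡.refl
∈-inners {suc (suc n)} (next i) = there (∈ₚ.∈-map⁺ next (∈-inners i))
∈-inners {suc zero} (next ())

high-good : ∀ {M k n} a b → M ≤ a → M ≤ b → ∀ top (m : Level k) (i : Inner n) U → Bounded M top → Chain top m U → ¬ Bad m a b i U
high-good {M} a b pa pb top m i U B c bad with StraightPos.chain-put⁻ top m i U (mid i U) (≡.subst (Chain top m) (≡.sym (put-mid i U)) c)
... | rest , z , w = high-fine a b pa pb (left m i U) (mid i U) (right i U) (zig-bounded _ _ z By) By Bq
        (bad⇒violates m a b i U (mid i U) (≡.subst (Bad m a b i) (≡.sym (put-mid i U)) bad))
  where
  Bq : Bounded M (right i U)
  Bq = rest-bounded top m i U rest B
  By : Bounded M (mid i U)
  By = zig-bounded _ _ w Bq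

GoodAt : ∀ {k n} → Level k → ℕ → ℕ → Vec (Level k) n → Set
GoodAt {n = n} m a b U = All (λ i → ¬ Bad m a b i U) (inners n)

goodAt? : ∀ {k n} (m : Level k) a b (U : Vec (Level k) n) → Dec (GoodAt m a b U)
goodAt? m a b U = all? (λ i → ¬? (bad? m a b i U)) (inners _)

-- Every prefix read down to column M - d + 1 has a partition as its content.  In each column blue is read before red.
Good : ∀ {k n} → ℕ → Level k → ℕ → Vec (Level k) n → Set
Good M m zero    U = ⊤
Good M m (suc d) U = (Good M m d U × GoodAt m (suc (M ∸ d)) (M ∸ d) U) × GoodAt m (M ∸ d) (M ∸ d) U

good? : ∀ {k n} M (m : Level k) d (U : Vec (Level k) n) → Dec (Good M m d U)
good? M m zero    U = yes tt
good? M m (suc d) U = (good? M m d U ×-dec goodAt? m (suc (M ∸ d)) (M ∸ d) U) ×-dec goodAt? m (M ∸ d) (M ∸ d) U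

module Stages (R : CommutativeRing 0ℓ 0ℓ) (gen : ℕ → CommutativeRing.Carrier R) (M : ℕ) {k n : ℕ} (bot top : Level (suc k)) (top≤M : Bounded M (sorted top)) where
  open CommutativeRing R hiding (zero) renaming (_+_ to _⊹_)
  open Sums R
  open SchurDeterminants R gen
  open Relation.Binary.Reasoning.Setoid setoid

  private
    module C = Cancellation R gen M {k}
    m = sorted bot
    Us = C.Us {n} bot top top≤M
    Config = Vec (Level (suc k)) n

  restricted : (P : Config → Set) → (∀ U → Dec (P U)) → Carrier
  restricted P P? = ∑ Us (λ U → when (unswappable? bot top U ×-dec P? U) (s (weight m U)))

  -- Several positions may fail at the same cut, so they are discarded one at a time. Not failing at
  -- the positions treated before is itself stable and is added to `P`.
  good-cut : ∀ a b → b ≤ a → a ≤ suc b → (P : Config → Set) (P? : ∀ U → Dec (P U)) →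
             (∀ i → C.Stable bot top top≤M a b i P) → (∀ i → C.Ready bot top top≤M a b i P) → ∀ (is : List (Inner n)) →
             restricted P P? ≈ restricted (λ U → P U × All (λ i → ¬ Bad m a b i U) is) (λ U → P? U ×-dec all? (λ i → ¬? (bad? m a b i U)) is)
  good-cut a b b≤a a≤b P P? stable ready [] = ∑-cong Us (λ U → when-cong (unswappable? bot top U ×-dec P? U) (unswappable? bot top U ×-dec (P? U ×-dec all? (λ i → ¬? (bad? m a b i U)) [])) (λ (d , p) → d , p , []) (λ (d , p , _) → d , p) (λ _ → refl))
  good-cut a b b≤a a≤b P P? stable ready (i ∷ is) = begin
    restricted P P?
      ≈⟨ good-cut a b b≤a a≤b P P? stable ready is ⟩
    restricted P' P'?
      ≈⟨ trans (∑-cong Us (λ U → when-split (unswappable? bot top U ×-dec P'? U) (bad? m a b i U) _)) (∑-+ Us _ _) ⟩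
    ∑ Us (λ U → when ((unswappable? bot top U ×-dec P'? U) ×-dec bad? m a b i U) (s (weight m U))) ⊹
    ∑ Us (λ U → when ((unswappable? bot top U ×-dec P'? U) ×-dec ¬? (bad? m a b i U)) (s (weight m U)))
      ≈⟨ +-cong
           (trans (∑-cong Us (λ U → when-cong ((unswappable? bot top U ×-dec P'? U) ×-dec bad? m a b i U) (unswappable? bot top U ×-dec (P'? U ×-dec bad? m a b i U))
               (λ ((d , p) , e) → d , p , e) (λ (d , p , e) → (d , p) , e) (λ _ → refl)))
             (C.bad-zero bot top top≤M a b b≤a a≤b i P' P'?
               (λ U y y' e (p , gs) → stable i U y y' e p , All.map (λ {j} g v → g (bad-invariant m a b a b j i U y' y ℕₚ.≤-refl ℕₚ.≤-refl (≡.sym e) v)) gs)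
               (λ U c (p , _) → ready i U c p)))
           (∑-cong Us (λ U → when-cong ((unswappable? bot top U ×-dec P'? U) ×-dec ¬? (bad? m a b i U)) (unswappable? bot top U ×-dec (P? U ×-dec all? (λ i → ¬? (bad? m a b i U)) (i ∷ is)))
               (λ ((d , p , gs) , g) → d , p , g ∷ gs) (λ { (d , p , g ∷ gs) → (d , p , gs) , g }) (λ _ → refl))) ⟩
    0# ⊹ restricted (λ U → P U × All (λ i → ¬ Bad m a b i U) (i ∷ is)) (λ U → P? U ×-dec all? (λ i → ¬? (bad? m a b i U)) (i ∷ is))
      ≈⟨ +-identityˡ _ ⟩
    restricted (λ U → P U × All (λ i → ¬ Bad m a b i U) (i ∷ is)) (λ U → P? U ×-dec all? (λ i → ¬? (bad? m a b i U)) (i ∷ is)) ∎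
    where
    P' : Config → Set
    P' U = P U × All (λ i → ¬ Bad m a b i U) is
    P'? : ∀ U → Dec (P' U)
    P'? U = P? U ×-dec all? (λ i → ¬? (bad? m a b i U)) is

  goodAt-stable : ∀ a b a' b' i → a ≤ a' → b ≤ b' → C.Stable {n} bot top top≤M a b i (GoodAt m a' b')
  goodAt-stable a b a' b' i p q U y y' e = All.map (λ {j} g v → g (bad-invariant m a b a' b' j i U y' y p q (≡.sym e) v))

  step-down : ∀ d → suc d ≤ M → suc (M ∸ suc d) ≡ M ∸ d
  step-down d d<M = ≡.sym (ℕₚ.+-∸-assoc 1 d<M)

  good-stable : ∀ d a b i → d ≤ M → a ≤ suc (M ∸ d) → b ≤ suc (M ∸ d) → C.Stable {n} bot top top≤M a b i (Good M m d)
  good-stable zero    a b i d≤M p q U y y' e _ = tt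
  good-stable (suc d) a b i d<M p q U y y' e ((g , h) , h') =
      (good-stable d a b i (ℕₚ.<⇒≤ d<M) (ℕₚ.m≤n⇒m≤1+n p') (ℕₚ.m≤n⇒m≤1+n q') U y y' e g , goodAt-stable a b _ _ i (ℕₚ.m≤n⇒m≤1+n p') q' U y y' e h) ,
      goodAt-stable a b _ _ i p' q' U y y' e h'
    where
    p' : a ≤ M ∸ d
    p' = ≡.subst (a ≤_) (step-down d d<M) p
    q' : b ≤ M ∸ d
    q' = ≡.subst (b ≤_) (step-down d d<M) q

  previous : ∀ d → d ≤ M → ∀ U → Chain (sorted top) m U → Good M m d U → ∀ (i : Inner n) →
             ¬ Bad m (suc (M ∸ d)) (suc (M ∸ d)) i U × ¬ Bad m (suc (suc (M ∸ d))) (suc (M ∸ d)) i U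
  -- At the start both cuts lie beyond M, where all cut levels coincide.
  previous zero    _   U c _ i = high-good (suc M) (suc M) (ℕₚ.n≤1+n M) (ℕₚ.n≤1+n M) (sorted top) m i U top≤M c ,
                                 high-good (suc (suc M)) (suc M) (ℕₚ.m≤n⇒m≤1+n (ℕₚ.n≤1+n M)) (ℕₚ.n≤1+n M) (sorted top) m i U top≤M c
  previous (suc d) d<M U c ((_ , h) , h') i rewrite step-down d d<M = All.lookup h' (∈-inners i) , All.lookup h (∈-inners i)

  -- With t = M - d, column t + 1 is read: first in blue, which leads to the cut (t + 1 , t), then
  -- in red, which leads to (t , t).
  stage : ∀ d → d ≤ M → restricted (Good M m d) (good? M m d) ≈ restricted (Good M m (suc d)) (good? M m (suc d))
  stage d d≤M = trans
    (good-cut (suc t) t (ℕₚ.n≤1+n t) ℕₚ.≤-refl (Good M m d) (good? M m d)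
      (λ i → good-stable d (suc t) t i d≤M ℕₚ.≤-refl (ℕₚ.n≤1+n t))
      (λ i U c g → inj₂ (proj₁ (previous d d≤M U c g i)) , proj₂ (previous d d≤M U c g i)) (inners n))
    (good-cut t t ℕₚ.≤-refl (ℕₚ.n≤1+n t) (λ U → Good M m d U × GoodAt m (suc t) t U) (λ U → good? M m d U ×-dec goodAt? m (suc t) t U)
      (λ i U y y' e (g , h) → good-stable d t t i d≤M (ℕₚ.n≤1+n t) (ℕₚ.n≤1+n t) U y y' e g , goodAt-stable t t (suc t) t i (ℕₚ.n≤1+n t) ℕₚ.≤-refl U y y' e h)
      (λ i U c (g , h) → inj₁ (All.lookup h (∈-inners i)) , proj₁ (previous d d≤M U c g i)) (inners n))
    where t = M ∸ d

  cancel-all : ∑ Us (λ U → when (unswappable? bot top U) (s (weight m U))) ≈ restricted (Good M m (suc M)) (good? M m (suc M))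
  cancel-all = trans (∑-cong Us (λ U → when-cong (unswappable? bot top U) (unswappable? bot top U ×-dec yes tt) (λ d → d , tt) proj₁ (λ _ → refl))) (go (suc M) ℕₚ.≤-refl)
    where
    go : ∀ d → d ≤ suc M → restricted (Good M m 0) (good? M m 0) ≈ restricted (Good M m d) (good? M m d)
    go zero    _         = refl
    go (suc d) (s≤s d≤M) = trans (go d (ℕₚ.m≤n⇒m≤1+n d≤M)) (stage d d≤M)

content : ∀ {k n} → Level k → Vec (Level k) n → Vec ℕ n
content m []      = []
content m (u ∷ U) = (∣ u ∣ᴸ ∸ ∣ m ∣ᴸ) ∷ content u U

zig-mono : ∀ {k} (m u : Level k) → Zig m u → ∣ m ∣ᴸ ≤ ∣ u ∣ᴸ
zig-mono m u z = ≡.subst (∣ m ∣ᴸ ≤_) (rise-sum m u z) (ℕₚ.m≤m+n ∣ m ∣ᴸ (rise m u))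

content-weight : ∀ {k n} top (m : Level k) (U : Vec (Level k) n) → Chain top m U → ∀ i → lookup (weight m U) i ≡ + lookup (content m U) i
content-weight top m (u ∷ U) (z , c) zero    = ≡.trans (ℤₚ.m-n≡m⊖n ∣ u ∣ᴸ ∣ m ∣ᴸ) (ℤₚ.⊖-≥ (zig-mono m u z))
content-weight top m (u ∷ U) (z , c) (suc i) = content-weight top u U c i

Concave : ∀ {k n} → Level k → Vec (Level k) n → Set
Concave {n = n} m U = ∀ (i : Inner n) → ∣ left m i U ∣ᴸ + ∣ right i U ∣ᴸ ≤ ∣ mid i U ∣ᴸ + ∣ mid i U ∣ᴸ

content-decreasing : ∀ {k n} top (m : Level k) (U : Vec (Level k) n) → Chain top m U → Concave m U → Decreasing (lookup (content m U))
content-decreasing top m (u ∷ [])     _             C zero    zero    ()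
content-decreasing top m (u ∷ q ∷ U) (z , c)       C zero    (suc j) _ = ℕₚ.≤-trans (to-head j) head-step
  where
  to-head : ∀ j → lookup (content u (q ∷ U)) j ≤ ∣ q ∣ᴸ ∸ ∣ u ∣ᴸ
  to-head zero    = ℕₚ.≤-refl
  to-head (suc j) = content-decreasing top u (q ∷ U) c (λ i → C (next i)) zero (suc j) (s≤s z≤n)
  head-step : ∣ q ∣ᴸ ∸ ∣ u ∣ᴸ ≤ ∣ u ∣ᴸ ∸ ∣ m ∣ᴸ
  head-step = ℕₚ.m≤n+o⇒m∸n≤o _ ∣ u ∣ᴸ (≡.subst (∣ q ∣ᴸ ≤_) (ℕₚ.+-∸-assoc ∣ u ∣ᴸ (zig-mono m u z))
    (≡.subst (_≤ (∣ u ∣ᴸ + ∣ u ∣ᴸ) ∸ ∣ m ∣ᴸ) (ℕₚ.m+n∸m≡n ∣ m ∣ᴸ ∣ q ∣ᴸ) (ℕₚ.∸-monoˡ-≤ ∣ m ∣ᴸ (C first))))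
content-decreasing top m (u ∷ q ∷ U) (z , c)       C (suc i) (suc j) (s≤s p) = content-decreasing top u (q ∷ U) c (λ i → C (next i)) i j p

cut-zero : ∀ {k} (y : Level k) → cut 0 0 y ≡ y
cut-zero []            = ≡.refl
cut-zero ((r , b) ∷ y) = ≡.cong₂ _∷_ (≡.cong₂ _,_ (ℕₚ.⊔-identityʳ r) (ℕₚ.⊔-identityʳ b)) (cut-zero y)

good⇒concave : ∀ {k n} M (m : Level k) (U : Vec (Level k) n) → Good M m (suc M) U → Concave m U
good⇒concave M m U (_ , g) i = ℕₚ.≮⇒≥ (λ lt → All.lookup g (∈-inners i) (≡.subst (λ a → Bad m a a i U) (≡.sym (ℕₚ.n∸n≡0 M)) (bad lt)))
  where
  maps : Vec.map (cut 0 0) U ≡ U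
  maps = ≡.trans (Vecₚ.map-cong cut-zero U) (Vecₚ.map-id U)
  bad : ∣ mid i U ∣ᴸ + ∣ mid i U ∣ᴸ < ∣ left m i U ∣ᴸ + ∣ right i U ∣ᴸ → Bad m 0 0 i U
  bad lt = ≡.subst₂ (λ W m' → ∣ mid i W ∣ᴸ + ∣ mid i W ∣ᴸ < ∣ left m' i W ∣ᴸ + ∣ right i W ∣ᴸ) (≡.sym maps) (≡.sym (cut-zero m)) lt

-- The surviving Schur functions

module Terms (M : ℕ) {k n : ℕ} (bot top : Level (suc k)) where
  Kept : Vec (Level (suc k)) n → Set
  Kept U = Unswappable bot top U × Good M (sorted bot) (suc M) U

  kept? : ∀ U → Dec (Kept U)
  kept? U = unswappable? bot top U ×-dec good? M (sorted bot) (suc M) U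

  partition : ∀ U → Kept U → Partition
  partition U ((c , _) , g) = record { len = n ; parts = lookup (content (sorted bot) U) ; dec = content-decreasing (sorted top) (sorted bot) U c (good⇒concave M (sorted bot) U g) }

  -- The list is formed from patterns alone, before any ring is given, so one expansion serves all
  -- rings and all values of the h's.
  terms : List (Vec (Level (suc k)) n) → List (Partition × ℕ)
  terms []       = []
  terms (U ∷ Us) with kept? U
  ... | yes p = (partition U p , 1) ∷ terms Us
  ... | no _  = terms Us

  module _ (R : CommutativeRing 0ℓ 0ℓ) (gen : ℕ → CommutativeRing.Carrier R) where
    open CommutativeRing R hiding (zero) renaming (_+_ to _⊹_)
    open Sums R
    open Determinants R
    open SchurDeterminants R gen

    linComb-terms : ∀ Us → linComb (terms Us) R gen ≈ ∑ Us (λ U → when (kept? U) (s (weight (sorted bot) U)))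
    linComb-terms []       = refl
    linComb-terms (U ∷ Us) with kept? U
    ... | no _  = trans (linComb-terms Us) (sym (+-identityˡ _))
    ... | yes p = +-cong (trans (+-identityʳ _) (trans (sym (Det-def _)) (Det-cong (λ a b → reflexive (≡.cong (λ w → h ((w ℤ.- + toℕ a) ℤ.+ + toℕ b))
                    (≡.sym (content-weight (sorted top) (sorted bot) U (proj₁ (proj₁ p)) a))))))) (linComb-terms Us)

sorted-tabulate : ∀ {k} (v : Fin k → Node) → sorted (tabulate v) ≡ tabulate (λ a → swapᴺ (sign (v a)) (v a))
sorted-tabulate {zero}  v = ≡.refl
sorted-tabulate {suc k} v = ≡.cong (swapᴺ (sign (v zero)) (v zero) ∷_) (sorted-tabulate (v ∘ suc))

zip-tabulate : ∀ {X Y : Set} {k} (f : Fin k → X) (g : Fin k → Y) → zip (tabulate f) (tabulate g) ≡ tabulate (λ a → f a , g a)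
zip-tabulate {k = zero}  f g = ≡.refl
zip-tabulate {k = suc k} f g = ≡.cong ((f zero , g zero) ∷_) (zip-tabulate (f ∘ suc) (g ∘ suc))

sorted-corner : ∀ {k} (f g : Fin k → ℕ) → sorted (corner f g) ≡ corner (λ a → f a ⊔ g a) (λ a → f a ⊓ g a)
sorted-corner f g = ≡.trans (≡.cong sorted (zip-tabulate _ _)) (≡.trans (sorted-tabulate _) (≡.trans (Vecₚ.tabulate-cong (λ a → node (f a) (g a) (toℕ a))) (≡.sym (zip-tabulate _ _))))
  where
  node : ∀ x y c → swapᴺ (sign (x + c , y + c)) (x + c , y + c) ≡ ((x ⊔ y) + c , (x ⊓ y) + c)
  node x y c with x + c ℕ.<? y + c
  ... | yes lt = let le = ℕₚ.<⇒≤ (ℕₚ.+-cancelʳ-< c x y lt) in ≡.cong₂ (λ u w → u + c , w + c) (≡.sym (ℕₚ.m≤n⇒m⊔n≡n le)) (≡.sym (ℕₚ.m≤n⇒m⊓n≡m le))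
  ... | no ¬lt = let ge = ℕₚ.+-cancelʳ-≤ c y x (ℕₚ.≮⇒≥ ¬lt) in ≡.cong₂ (λ u w → u + c , w + c) (≡.sym (ℕₚ.m≥n⇒m⊔n≡m ge)) (≡.sym (ℕₚ.m≥n⇒m⊓n≡n ge))

corner-bounded : ∀ {k} B (f g : Fin k → ℕ) → (∀ a → f a ≤ B) → (∀ a → g a ≤ B) → Bounded (B + k) (corner f g)
corner-bounded {k} B f g f≤ g≤ = ≡.subst (Bounded (B + k)) (≡.sym (zip-tabulate _ _)) (go _ (λ a →
    ℕₚ.+-mono-≤ (f≤ a) (ℕₚ.<⇒≤ (Finₚ.toℕ<n a)) , ℕₚ.+-mono-≤ (g≤ a) (ℕₚ.<⇒≤ (Finₚ.toℕ<n a))))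
  where
  go : ∀ {k M} (v : Fin k → Node) → (∀ a → proj₁ (v a) ≤ M × proj₂ (v a) ≤ M) → Bounded M (tabulate v)
  go {zero}  v p = tt
  go {suc k} v p = p zero , go (v ∘ suc) (p ∘ suc)

maximum : ∀ {n} → (Fin n → ℕ) → ℕ
maximum {zero}  f = 0
maximum {suc n} f = f zero ⊔ maximum (f ∘ suc)

≤-maximum : ∀ {n} (f : Fin n → ℕ) i → f i ≤ maximum f
≤-maximum f zero    = ℕₚ.m≤m⊔n _ _
≤-maximum f (suc i) = ℕₚ.≤-trans (≤-maximum (f ∘ suc) i) (ℕₚ.m≤n⊔m (f zero) _)

decreasing-weak : ∀ {n} (μ : Fin n → ℕ) → Decreasing μ → ∀ {i j} → i Fin.≤ j → μ j ≤ μ i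
decreasing-weak μ dec {i} {j} le with i Fin.≟ j
... | yes ≡.refl = ℕₚ.≤-refl
... | no i≢j    = dec i j (Finₚ.≤∧≢⇒< le i≢j)

decreasing-min : ∀ {n} (μ : Fin n → ℕ) → Decreasing μ → ∀ i j → μ (minF i j) ≡ μ i ⊔ μ j
decreasing-min μ dec i j with i Fin.≤? j
... | yes le = ≡.sym (ℕₚ.m≥n⇒m⊔n≡m (decreasing-weak μ dec le))
... | no ¬le = ≡.sym (ℕₚ.m≤n⇒m⊔n≡n (dec j i (ℕₚ.≰⇒> ¬le)))

decreasing-max : ∀ {n} (μ : Fin n → ℕ) → Decreasing μ → ∀ i j → μ (maxF i j) ≡ μ i ⊓ μ j
decreasing-max μ dec i j with i Fin.≤? j
... | yes le = ≡.sym (ℕₚ.m≥n⇒m⊓n≡n (decreasing-weak μ dec le))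
... | no ¬le = ≡.sym (ℕₚ.m≤n⇒m⊓n≡m (dec j i (ℕₚ.≰⇒> ¬le)))

theorem3p1 : ∀ (n k : ℕ) (μ ν : Fin n → ℕ) → Decreasing μ → Decreasing ν →
    ∀ (I J I' J' : Fin k → Fin n) →
    StrictInc I → StrictInc J → StrictInc I' → StrictInc J' →
    SchurNonneg (jtDiff μ ν I J I' J')
-- All minors are empty determinants, so the difference is zero and the empty combination represents
-- it.
theorem3p1 n zero    μ ν dμ dν I J I' J' incI incJ incI' incJ' = [] , λ R gen → CommutativeRing.-‿inverseʳ R _
theorem3p1 n (suc k) μ ν dμ dν I J I' J' incI incJ incI' incJ' = terms Us , equality
  where
  B M : ℕ
  B = maximum μ ⊔ maximum ν
  -- Stored boundary entries are a part plus its position, hence below B + suc k.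
  M = B + suc k
  bot top : Level (suc k)
  bot = corner (ν ∘ J) (ν ∘ J')
  top = corner (μ ∘ I) (μ ∘ I')
  open Terms M {n = suc k + suc k} bot top
  Us : List (Vec (Level (suc k)) (suc k + suc k))
  Us = vecs (levels M (suc k)) (suc k + suc k)
  μ≤ : ∀ i → μ i ≤ B
  μ≤ i = ℕₚ.≤-trans (≤-maximum μ i) (ℕₚ.m≤m⊔n _ _)
  ν≤ : ∀ i → ν i ≤ B
  ν≤ i = ℕₚ.≤-trans (≤-maximum ν i) (ℕₚ.m≤n⊔m (maximum μ) _)
  B≤M : B ≤ M
  B≤M = ℕₚ.m≤m+n B (suc k)
  μ⊔ μ⊓ ν⊔ ν⊓ : Fin (suc k) → ℕ
  μ⊔ a = μ (I a) ⊔ μ (I' a)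
  μ⊓ a = μ (I a) ⊓ μ (I' a)
  ν⊔ a = ν (J a) ⊔ ν (J' a)
  ν⊓ a = ν (J a) ⊓ ν (J' a)
  μ⊔≤ : ∀ a → μ⊔ a ≤ B
  μ⊔≤ a = ℕₚ.⊔-lub (μ≤ _) (μ≤ _)
  μ⊓≤ : ∀ a → μ⊓ a ≤ B
  μ⊓≤ a = ℕₚ.≤-trans (ℕₚ.m⊓n≤m _ _) (μ≤ _)
  dec∘ : ∀ (λ' : Fin n → ℕ) → Decreasing λ' → ∀ (A : Fin (suc k) → Fin n) → StrictInc A → Decreasing (λ' ∘ A)
  dec∘ λ' d A inc a b a<b = d (A a) (A b) (inc a b a<b)
  top≤M : Bounded M (sorted top)
  top≤M = ≡.subst (Bounded M) (≡.sym (sorted-corner (μ ∘ I) (μ ∘ I'))) (corner-bounded B μ⊔ μ⊓ μ⊔≤ μ⊓≤)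

  equality : ∀ (R : CommutativeRing 0ℓ 0ℓ) (gen : ℕ → CommutativeRing.Carrier R) →
             CommutativeRing._≈_ R (jtDiff μ ν I J I' J' R gen) (linComb (terms Us) R gen)
  equality R gen = begin
    minor X (I ∨ₛ I') (J ∨ₛ J') * minor X (I ∧ₛ I') (J ∧ₛ J') - minor X I J * minor X I' J'
      -- As μ and ν decrease, the minor at the meets has the larger parts. It belongs to red, the
      -- larger colour of a sorted node, and therefore comes first.
      ≈⟨ +-cong (trans (*-comm _ _) (*-cong larger smaller)) (-‿cong (*-cong (sym (Det-def _)) (sym (Det-def _)))) ⟩
    Det (λ a b → h (+ μ⊔ a ℤ.- + ν⊔ b)) * Det (λ a b → h (+ μ⊓ a ℤ.- + ν⊓ b)) - Det (λ a b → h (+ μ (I a) ℤ.- + ν (J b))) * Det (λ a b → h (+ μ (I' a) ℤ.- + ν (J' b)))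
      ≈⟨ +-cong (Det-product μ⊔ ν⊔ μ⊓ ν⊓
                   (λ a b p → ℕₚ.⊔-mono-≤ (dI a b p) (dI' a b p)) (λ a b p → ℕₚ.⊔-mono-≤ (dJ a b p) (dJ' a b p))
                   (λ a b p → ℕₚ.⊓-mono-≤ (dI a b p) (dI' a b p)) (λ a b p → ℕₚ.⊓-mono-≤ (dJ a b p) (dJ' a b p))
                   (λ a → ℕₚ.≤-trans (μ⊔≤ a) B≤M) (λ a → ℕₚ.≤-trans (μ⊓≤ a) B≤M)
                   (corner-bounded B ν⊔ ν⊓ (λ a → ℕₚ.⊔-lub (ν≤ _) (ν≤ _)) (λ a → ℕₚ.≤-trans (ℕₚ.m⊓n≤m _ _) (ν≤ _))))
                (-‿cong (Det-product (μ ∘ I) (ν ∘ J) (μ ∘ I') (ν ∘ J') dI dJ dI' dJ'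
                   (λ a → ℕₚ.≤-trans (μ≤ _) B≤M) (λ a → ℕₚ.≤-trans (μ≤ _) B≤M) (corner-bounded B (ν ∘ J) (ν ∘ J') (λ a → ν≤ _) (λ a → ν≤ _)))) ⟩
    chains N (corner ν⊔ ν⊓) (corner μ⊔ μ⊓) - chains N bot top
      ≈⟨ +-congʳ (reflexive (≡.cong₂ (chains N) (sorted-corner (ν ∘ J) (ν ∘ J')) (sorted-corner (μ ∘ I) (μ ∘ I')))) ⟨
    chains N (sorted bot) (sorted top) - chains N bot top
      ≈⟨ SwapBijection.chains-difference R gen M N bot top ⟩
    ∑ Us (λ U → when (unswappable? bot top U) (s (weight (sorted bot) U)))
      ≈⟨ Stages.cancel-all R gen M {k} {N} bot top top≤M ⟩
    ∑ Us (λ U → when (kept? U) (s (weight (sorted bot) U)))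
      ≈⟨ linComb-terms R gen Us ⟨
    linComb (terms Us) R gen ∎
    where
    open CommutativeRing R hiding (zero) renaming (_+_ to _⊹_)
    open Ring R using (minor; JT)
    open Sums R
    open Determinants R
    open SchurDeterminants R gen
    open MinorProducts R gen M
    open Relation.Binary.Reasoning.Setoid setoid
    N = suc k + suc k
    X = JT gen μ ν
    dI = dec∘ μ dμ I incI
    dI' = dec∘ μ dμ I' incI'
    dJ = dec∘ ν dν J incJ
    dJ' = dec∘ ν dν J' incJ'
    larger : minor X (I ∧ₛ I') (J ∧ₛ J') ≈ Det (λ a b → h (+ μ⊔ a ℤ.- + ν⊔ b))
    larger = trans (sym (Det-def _)) (Det-cong (λ a b → reflexive (≡.cong₂ (λ x y → h (+ x ℤ.- + y)) (decreasing-min μ dμ (I a) (I' a)) (decreasing-min ν dν (J b) (J' b)))))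
    smaller : minor X (I ∨ₛ I') (J ∨ₛ J') ≈ Det (λ a b → h (+ μ⊓ a ℤ.- + ν⊓ b))
    smaller = trans (sym (Det-def _)) (Det-cong (λ a b → reflexive (≡.cong₂ (λ x y → h (+ x ℤ.- + y)) (decreasing-max μ dμ (I a) (I' a)) (decreasing-max ν dν (J b) (J' b)))))
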